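{- Let $\mathbb{F}_q$ be a finite field of odd characteristic with $q\equiv 1\pmod 6$, let $T$ be a generator of the group of multiplicative characters of $\mathbb{F}_q$, and let $a,b,c\in\mathbb{F}_q^\times$ be all distinct. If $h\in\mathbb{F}_q^\times$ satisfies $$3h^2+2\,\frac{ab+bc+ca}{bc}\,h+\frac{ab+ca+a^2}{bc}=0,$$ then $$\varphi_{(1,1,1)}(a,b,c)=-1+q\,\varphi(bc)\,\varphi(-3f)\;{_2}F_1\left(\begin{array}{cc}T^{\frac{q-1}{6}},&T^{\frac{5(q-1)}{6}}\\ &\varepsilon\end{array}\Big|\ -\frac{3^3g}{2^2f^3}\right),$$ where $$f=3h+\frac{ab+bc+ca}{bc},\qquad g=h^3+\frac{ab+bc+ca}{bc}h^2+\frac{ab+ca+a^2}{bc}h+\frac{a^2}{bc}.$$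
   Context: Multiplicative characters $\chi:\mathbb{F}_q^\times\to\mathbb{C}^\times$ are extended to $\mathbb{F}_q$ by $\chi(0):=0$, including the trivial character $\varepsilon$; $\overline{\chi}$ is the inverse of $\chi$. $\varphi$ is the quadratic character and $\varepsilon$ the trivial character of $\mathbb{F}_q$. $\varphi_{(1,1,1)}(a,b,c):=\sum_{x\in\mathbb{F}_q}\varphi(x)\varphi(x+a)\varphi(x+b)\varphi(x+c)$. For characters $A,B,C$ and $x\in\mathbb{F}_q$, Greene's finite field hypergeometric series is $${_2}F_1\left(\begin{array}{cc}A,&B\\ &C\end{array}\Big|\ x\right):=\varepsilon(x)\frac{BC(-1)}{q}\sum_{y\in\mathbb{F}_q}B(y)\,\overline{B}C(1-y)\,\overline{A}(1-xy).$$ -}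

module Defs where

open import Level using (Level; _⊔_) renaming (suc to lsuc)
open import Algebra.Apartness.Bundles using (HeytingField; HeytingCommutativeRing)
import Algebra.Apartness.Properties.HeytingCommutativeRing as HeytingProperties
open import Algebra.Bundles using (Group; AbelianGroup; CommutativeRing; Semiring)
import Algebra.Definitions.RawMonoid as RawMonoidDefs
import Algebra.Definitions.RawSemiring as RawSemiringDefs
open import Algebra.Morphism.Bundles using (GroupHomomorphism)
import Algebra.Properties.AbelianGroup as AbelianGroupProperties
import Algebra.Properties.CommutativeSemigroup as CommutativeSemigroupProperties
open import Data.Fin.Base using (Fin; toℕ)
import Data.Fin.Properties as Fin
open import Data.Integer.Base using (ℤ; +_; -[1+_])
open import Data.Nat.Base using (ℕ; suc; NonZero; _%_)
open import Data.Nat.Divisibility using (_∣_)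
open import Data.Product.Base using (∃; ∃-syntax; _×_; _,_; proj₁; proj₂)
open import Data.Vec.Functional using (Vector)
open import Function.Bundles using (Inverse; _⇔_)
import Relation.Binary.PropositionalEquality as ≡
open ≡ using (_≡_)
import Relation.Binary.Reasoning.Setoid as SetoidReasoning
open import Relation.Nullary.Decidable using (Dec; yes; no; map′)

private variable
  a b c ℓ ℓ₁ ℓ₂ c′ ℓ₁′ ℓ₂′ : Level

------------------------------------------------------------------------
-- Groups

module GroupPower (G : Group c ℓ) where
  open Group G
  open RawMonoidDefs rawMonoid using () renaming (_×_ to _×ᴳ_)

  infixr 8 _^ᶻ_
  _^ᶻ_ : Carrier → ℤ → Carrier
  g ^ᶻ (+ n)    = n ×ᴳ g
  g ^ᶻ -[1+ n ] = (suc n ×ᴳ g) ⁻¹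

  IsGenerator : Carrier → Set (c ⊔ ℓ)
  IsGenerator g = ∀ x → ∃[ k ] x ≈ g ^ᶻ k

Hom : AbelianGroup a ℓ₁ → AbelianGroup b ℓ₂ → AbelianGroup (a ⊔ b ⊔ ℓ₁ ⊔ ℓ₂) (a ⊔ ℓ₂)
Hom G H = record
  { Carrier = GroupHomomorphism G.rawGroup H.rawGroup
  ; _≈_ = λ χ ψ → ∀ x → ⟦ χ ⟧ x H.≈ ⟦ ψ ⟧ x
  ; _∙_ = λ χ ψ → hom (λ x → ⟦ χ ⟧ x H.∙ ⟦ ψ ⟧ x)
      (λ x≈y → H.∙-cong (cong χ x≈y) (cong ψ x≈y))
      (λ x y → H.trans (H.∙-cong (homo χ x y) (homo ψ x y)) (interchange _ _ _ _))
  ; ε = hom (λ _ → H.ε) (λ _ → H.refl) (λ _ _ → H.sym (H.identityˡ H.ε))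
  ; _⁻¹ = λ χ → hom (λ x → ⟦ χ ⟧ x H.⁻¹)
      (λ x≈y → H.⁻¹-cong (cong χ x≈y))
      (λ x y → H.trans (H.⁻¹-cong (homo χ x y)) (H.sym (⁻¹-∙-comm _ _)))
  ; isAbelianGroup = record
    { isGroup = record
      { isMonoid = record
        { isSemigroup = record
          { isMagma = record
            { isEquivalence = record
              { refl = λ _ → H.refl
              ; sym = λ e x → H.sym (e x)
              ; trans = λ d e x → H.trans (d x) (e x)
              }
            ; ∙-cong = λ d e x → H.∙-cong (d x) (e x)
            }
          ; assoc = λ χ ψ ω x → H.assoc _ _ _
          }
        ; identity = (λ χ x → H.identityˡ _) , (λ χ x → H.identityʳ _)
        }
      ; inverse = (λ χ x → H.inverseˡ _) , (λ χ x → H.inverseʳ _)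
      ; ⁻¹-cong = λ e x → H.⁻¹-cong (e x)
      }
    ; comm = λ χ ψ x → H.comm _ _
    }
  }
  where
  module G = AbelianGroup G
  module H = AbelianGroup H
  open GroupHomomorphism using (⟦_⟧; homo) renaming (⟦⟧-cong to cong)
  open AbelianGroupProperties H using (⁻¹-∙-comm; identityʳ-unique; inverseˡ-unique)
  open CommutativeSemigroupProperties H.commutativeSemigroup using (interchange)

  hom : (f : G.Carrier → H.Carrier) →
        (∀ {x y} → x G.≈ y → f x H.≈ f y) →
        (∀ x y → f (x G.∙ y) H.≈ f x H.∙ f y) →
        GroupHomomorphism G.rawGroup H.rawGroup
  hom f f-cong f-homo = record
    { ⟦_⟧ = f
    ; isGroupHomomorphism = record
      { isMonoidHomomorphism = record
        { isMagmaHomomorphism = record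
          { isRelHomomorphism = record { cong = f-cong }
          ; homo = f-homo
          }
        ; ε-homo = fε
        }
      ; ⁻¹-homo = λ x → inverseˡ-unique _ _
          (H.trans (H.sym (f-homo _ _)) (H.trans (f-cong (G.inverseˡ x)) fε))
      }
    }
    where
    fε : f G.ε H.≈ H.ε
    fε = identityʳ-unique _ _ (H.trans (H.sym (f-homo _ _)) (f-cong (G.identityˡ _)))

------------------------------------------------------------------------
-- Fields

module FieldOps (K : HeytingField c ℓ₁ ℓ₂) where
  open HeytingField K public
  open CommutativeRing (HeytingCommutativeRing.commutativeRing heytingCommutativeRing) public
    using (semiring)
  open HeytingProperties heytingCommutativeRing public
    using (1#0; x#0y#0→xy#0; x-0≈x; invertibleˡ⇒#)
  -- `n × x` is the n-fold sum of x; in particular `n × 1#` is the image of n.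
  open RawSemiringDefs (Semiring.rawSemiring semiring) public
    using (_^_; sum) renaming (_×_ to infixr 8 _×ⁿ_)

  recip : ∀ {x} → x # 0# → Carrier
  recip x#0 = proj₁ (#⇒invertible x#0)

  recip-inverseˡ : ∀ {x} (x#0 : x # 0#) → recip x#0 * x ≈ 1#
  recip-inverseˡ {x} x#0 =
    trans (*-congˡ (sym (x-0≈x x))) (proj₁ (proj₂ (#⇒invertible x#0)))

  recip#0 : ∀ {x} (x#0 : x # 0#) → recip x#0 # 0#
  recip#0 {x} x#0 = invertibleˡ⇒# (x ,
    trans (*-congˡ (x-0≈x _)) (trans (*-comm _ _) (recip-inverseˡ x#0)))

  units : AbelianGroup (c ⊔ ℓ₂) ℓ₁
  units = record
    { Carrier = ∃[ x ] x # 0#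
    ; _≈_ = λ u v → proj₁ u ≈ proj₁ v
    ; _∙_ = λ u v → proj₁ u * proj₁ v , x#0y#0→xy#0 (proj₂ u) (proj₂ v)
    ; ε = 1# , 1#0
    ; _⁻¹ = λ u → recip (proj₂ u) , recip#0 (proj₂ u)
    ; isAbelianGroup = record
      { isGroup = record
        { isMonoid = record
          { isSemigroup = record
            { isMagma = record
              { isEquivalence = record { refl = refl ; sym = sym ; trans = trans }
              ; ∙-cong = *-cong
              }
            ; assoc = λ _ _ _ → *-assoc _ _ _
            }
          ; identity = (λ _ → *-identityˡ _) , (λ _ → *-identityʳ _)
          }
        ; inverse = (λ u → recip-inverseˡ (proj₂ u))
                  , (λ u → trans (*-comm _ _) (recip-inverseˡ (proj₂ u)))
        ; ⁻¹-cong = λ {u} {v} → recip-cong u v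
        }
      ; comm = λ _ _ → *-comm _ _
      }
    }
    where
    open SetoidReasoning setoid
    recip-cong : ∀ (u v : ∃[ x ] x # 0#) → proj₁ u ≈ proj₁ v →
                 recip (proj₂ u) ≈ recip (proj₂ v)
    recip-cong (x , p) (y , r) x≈y = begin
      recip p                 ≈⟨ *-identityˡ _ ⟨
      1# * recip p            ≈⟨ *-congʳ (recip-inverseˡ r) ⟨
      recip r * y * recip p   ≈⟨ *-congʳ (*-congˡ x≈y) ⟨
      recip r * x * recip p   ≈⟨ *-assoc _ _ _ ⟩
      recip r * (x * recip p) ≈⟨ *-congˡ (trans (*-comm _ _) (recip-inverseˡ p)) ⟩
      recip r * 1#            ≈⟨ *-identityʳ _ ⟩
      recip r                 ∎

  HasCharacteristic : ℕ → Set ℓ₁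
  HasCharacteristic p = ∀ n → (n ×ⁿ 1# ≈ 0#) ⇔ (p ∣ n)

  OddCharacteristic : Set ℓ₁
  OddCharacteristic = ∃[ p ] HasCharacteristic p × p % 2 ≡ 1

-- Stands in for ℂ: a result about every such field applies in particular to
-- ℂ.  Equality is only required to be tight, not decidable, since equality of
-- complex numbers is not constructively decidable.
record AlgClosedField₀ c ℓ₁ ℓ₂ : Set (lsuc (c ⊔ ℓ₁ ⊔ ℓ₂)) where
  field
    heytingField : HeytingField c ℓ₁ ℓ₂
  open FieldOps heytingField
  field
    charZero  : ∀ n → .{{NonZero n}} → n ×ⁿ 1# # 0#
    algClosed : ∀ n (coeff : Vector Carrier (suc n)) →
                ∃[ z ] z ^ suc n + sum (λ i → coeff i * z ^ toℕ i) ≈ 0#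

record FiniteField (q : ℕ) c ℓ₁ ℓ₂ : Set (lsuc (c ⊔ ℓ₁ ⊔ ℓ₂)) where
  field
    heytingField : HeytingField c ℓ₁ ℓ₂
  open FieldOps heytingField public
  field
    enumeration : Inverse setoid (≡.setoid (Fin q))
  open Inverse enumeration public using ()
    renaming (to to index; from to element; to-cong to index-cong)

  element-index : ∀ x → element (index x) ≈ x
  element-index x = Inverse.inverseʳ enumeration ≡.refl

  infix 4 _≟_
  _≟_ : ∀ x y → Dec (x ≈ y)
  x ≟ y = map′
    (λ e → trans (sym (element-index x))
                 (trans (Inverse.from-cong enumeration e) (element-index y)))
    index-cong
    (index x Fin.≟ index y)

  unit? : ∀ x → Dec (x # 0#)
  unit? x = map′
    (λ (i , e) → invertibleˡ⇒# (element i , trans (*-congˡ (x-0≈x x)) e))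
    (λ x#0 → index (recip x#0)
           , trans (*-congʳ (element-index _)) (recip-inverseˡ x#0))
    (Fin.any? (λ i → element i * x ≟ 1#))

  square? : ∀ x → Dec (∃[ y ] y * y ≈ x)
  square? x = map′
    (λ (i , e) → element i , e)
    (λ (y , e) → index y , trans (*-cong (element-index y) (element-index y)) e)
    (Fin.any? (λ i → element i * element i ≟ x))

  -- Totalised by x / y = 0 when y is not a unit.
  infixl 7 _/_
  _/_ : Carrier → Carrier → Carrier
  x / y with unit? y
  ... | yes y#0 = x * recip y#0
  ... | no  _   = 0#

  q-nonZero : NonZero q
  q-nonZero = Fin.nonZeroIndex (index 0#)

------------------------------------------------------------------------
-- Multiplicative characters of a finite field and sums of them

module Characters {q} (𝔽 : FiniteField q c ℓ₁ ℓ₂) (𝕂 : AlgClosedField₀ c′ ℓ₁′ ℓ₂′) where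
  private
    module F = FiniteField 𝔽
    module K = FieldOps (AlgClosedField₀.heytingField 𝕂)

  characterGroup : AbelianGroup _ _
  characterGroup = Hom F.units K.units

  open AbelianGroup characterGroup public
    using () renaming (Carrier to Character; ε to εᶜ; _∙_ to _∙ᶜ_; _⁻¹ to _⁻¹ᶜ)
  open GroupPower (AbelianGroup.group characterGroup) public
  open GroupHomomorphism using (⟦_⟧)

  -- Evaluation on all of 𝔽, extended by χ(0) = 0 (also for the trivial character).
  infix 9 _⟨_⟩
  _⟨_⟩ : Character → F.Carrier → K.Carrier
  χ ⟨ x ⟩ with F.unit? x
  ... | yes x#0 = proj₁ (⟦ χ ⟧ (x , x#0))
  ... | no  _   = K.0#

  φ : F.Carrier → K.Carrier
  φ x with F.unit? x | F.square? x
  ... | no  _ | _     = K.0#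
  ... | yes _ | yes _ = K.1#
  ... | yes _ | no  _ = K.- K.1#

  Σ𝔽 : (F.Carrier → K.Carrier) → K.Carrier
  Σ𝔽 s = K.sum (λ i → s (F.element i))

  qᴷ : K.Carrier
  qᴷ = q K.×ⁿ K.1#

  qᴷ⁻¹ : K.Carrier
  qᴷ⁻¹ = K.recip (AlgClosedField₀.charZero 𝕂 q {{F.q-nonZero}})

  φ₁₁₁ : (a b c : F.Carrier) → K.Carrier
  φ₁₁₁ a b c = Σ𝔽 λ x → φ x K.* φ (x F.+ a) K.* φ (x F.+ b) K.* φ (x F.+ c)

  ₂F₁ : (A B C : Character) → F.Carrier → K.Carrier
  ₂F₁ A B C x =
    εᶜ ⟨ x ⟩ K.* ((B ∙ᶜ C) ⟨ F.- F.1# ⟩ K.* qᴷ⁻¹) K.*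
    Σ𝔽 λ y → B ⟨ y ⟩ K.* ((B ⁻¹ᶜ) ∙ᶜ C) ⟨ F.1# F.- y ⟩ K.* (A ⁻¹ᶜ) ⟨ F.1# F.- x F.* y ⟩

{-# OPTIONS --safe #-}
module Submission where

-- Substituting a/z for x, and then an affine function of v for z, turns the quartic sum into
-- -1 + φ(bc) φ(3f) Σ φ(v³ - 3v + c), with c = 2 - 4x and x the argument of ₂F₁; the equation for h
-- removes the linear term of the cubic.  The number of solutions of v³ - 3v = u is
-- 1 + Σ ω(r) over r + 1/r = u, where ω has order 3: if u² - 4 is a square, the substitution
-- v = w + 1/w turns the equation into w³ = r, and if it is a nonsquare, both counts are trivial
-- because v³ - 3v permutes the v with v² - 4 nonsquare.  Hence the sum equals
-- Σ ω(r) φ(r + 1/r + c) = Σ χ(r) φ((r + 1)² - 4rx) with χ = φω of order 6, and this is Σ χ(r) over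
-- the points of r y (1 - xy) = 1 - y, which is the sum defining ₂F₁.
-- That T ^ ((q - 1)/6) has order 6 needs a character of 𝔽 whose (q - 1)/6-th power has order 6; it is
-- built from a unit γ whose order has full 2- and 3-parts.

open import Defs
open import Data.Integer.Base using (+_)
open import Data.Nat.Base as ℕ using (ℕ; _∸_; _%_)
open import Relation.Binary.PropositionalEquality using (_≡_)

open import Algebra.Apartness.Bundles using (HeytingField; HeytingCommutativeRing)
import Algebra.Apartness.Properties.HeytingCommutativeRing as HeytingProperties
open import Algebra.Bundles using (AbelianGroup; CommutativeMonoid; CommutativeRing)
open import Algebra.Morphism.Bundles using (GroupHomomorphism)
import Algebra.Properties.AbelianGroup as AbelianGroupProperties
import Algebra.Properties.CommutativeMonoid.Sum as SumProperties
import Algebra.Properties.CommutativeSemigroup as CommutativeSemigroupProperties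
import Algebra.Properties.CommutativeSemiring.Exp as ExpProperties
import Algebra.Properties.Group as GroupProperties
import Algebra.Properties.Ring as RingProperties
import Algebra.Properties.Semiring.Mult.TCOptimised as Multiples
import Algebra.Properties.Semiring.Sum as SemiringSum
import Algebra.Solver.Ring as RingSolver
open import Algebra.Solver.Ring.AlmostCommutativeRing using (fromCommutativeRing; _-Raw-AlmostCommutative⟶_)
open import Data.Fin.Base as Fin using (Fin; zero; suc; toℕ)
import Data.Fin.Permutation as Perm
import Data.Fin.Properties as Fin
open import Data.Integer.Base as ℤ using (ℤ; -[1+_])
import Data.Integer.Properties as ℤ
open import Data.Maybe.Base using (Maybe; just; nothing)
open import Data.Nat.Base using (zero; suc; NonZero)
import Data.Nat.DivMod as ℕ
import Data.Nat.Divisibility as ℕ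
open import Data.Nat.Divisibility using (_∣_; divides)
open import Data.Nat.Induction using (<-rec)
import Data.Nat.Properties as ℕ
import Data.Nat.Solver as ℕ-Solver
open import Data.Product.Base using (∃-syntax; _×_; _,_; proj₁; proj₂)
open import Data.Sum.Base using (_⊎_; inj₁; inj₂; [_,_]′)
open import Data.Vec.Functional using (Vector)
open import Function.Base using (_∘_; id)
open import Function.Bundles using (Inverse)
open import Level using (_⊔_)
open import Relation.Binary.Definitions using (tri<; tri≈; tri>)
import Relation.Binary.PropositionalEquality as ≡
open ≡ using (_≢_)
import Relation.Binary.Reasoning.Setoid as SetoidReasoning
open import Relation.Nullary.Decidable using (Dec; yes; no; _×-dec_; map′)
open import Relation.Nullary.Negation using (¬_; contradiction)
open import Relation.Unary using (Pred; Decidable)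

-- That the units of 𝔽 form a cyclic group is never established. Only classes modulo squares and
-- cubes matter, hence modulo sixth powers, and there γ generates: the index e of its subgroup is
-- prime to 6, so e² is 1 modulo 6, and u^(e²), a power of γ, differs from u by a sixth power. The
-- same congruence makes the lifted character send `γ ^ m` to exactly the sixth root of unity it was
-- built from. Equality in 𝕂 is tight but not decidable, so a vanishing product there cannot simply
-- be split into cases. "Primitive sixth root of unity" is therefore expressed by x² - x + 1 ≈ 0,
-- and unwanted factors are discarded by Bézout identities whose value is 2 or 3. The polynomial v³
-- - 3v arises because a cubic w³ + f w² + g with f nonzero becomes, up to a factor, v³ - 3v plus a
-- constant under w = (f/3)(v - 1). It satisfies D(w + 1/w) = w³ + 1/w³, so its fibres are governed
-- by cube roots; that 𝔽 contains a square root of -3 is used throughout their count.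

-- Integer coefficients for ring identities

module IntegerCoefficients {c ℓ} (R : CommutativeRing c ℓ) where
  open CommutativeRing R
  open Multiples semiring using (1+×; ×-homo-+; ×1-homo-*) renaming (_×_ to _×′_)
  open RingProperties ring
  open AbelianGroupProperties +-abelianGroup using (⁻¹-∙-comm)
  open SetoidReasoning setoid

  -- With this form of the multiple `nat 1` reduces to `1#`, so `con (+ 1)` in a ring identity
  -- denotes the literal unit.
  nat : ℕ → Carrier
  nat n = n ×′ 1#

  nat-suc : ∀ n → nat (suc n) ≈ 1# + nat n
  nat-suc n = 1+× n 1#

  nat-+ : ∀ m n → nat (m ℕ.+ n) ≈ nat m + nat n
  nat-+ = ×-homo-+ 1#

  nat-* : ∀ m n → nat (m ℕ.* n) ≈ nat m * nat n
  nat-* = ×1-homo-*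

  int : ℤ → Carrier
  int (+ n)    = nat n
  int -[1+ n ] = - nat (suc n)

  cancel-+ : ∀ x y z → (x + y) - (x + z) ≈ y - z
  cancel-+ x y z = begin
    (x + y) - (x + z)     ≈⟨ +-cong (+-comm x y) (sym (⁻¹-∙-comm x z)) ⟩
    (y + x) + (- x - z)   ≈⟨ +-assoc _ _ _ ⟩
    y + (x + (- x - z))   ≈⟨ +-congˡ (+-assoc _ _ _) ⟨
    y + ((x - x) - z)     ≈⟨ +-congˡ (+-congʳ (-‿inverseʳ x)) ⟩
    y + (0# - z)          ≈⟨ +-congˡ (+-identityˡ _) ⟩
    y - z                 ∎

  int-⊖ : ∀ m n → int (m ℤ.⊖ n) ≈ nat m - nat n
  int-⊖ m       zero    = sym (trans (+-congˡ -0#≈0#) (+-identityʳ _))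
  int-⊖ zero    (suc n) = sym (+-identityˡ _)
  int-⊖ (suc m) (suc n) = begin
    int (suc m ℤ.⊖ suc n)             ≡⟨ ≡.cong int (ℤ.[1+m]⊖[1+n]≡m⊖n m n) ⟩
    int (m ℤ.⊖ n)                     ≈⟨ int-⊖ m n ⟩
    nat m - nat n                     ≈⟨ cancel-+ 1# _ _ ⟨
    (1# + nat m) - (1# + nat n)       ≈⟨ +-cong (nat-suc m) (-‿cong (nat-suc n)) ⟨
    nat (suc m) - nat (suc n)         ∎

  int-neg : ∀ n → int (ℤ.- (+ n)) ≈ - nat n
  int-neg zero    = sym -0#≈0#
  int-neg (suc n) = refl

  int-+ : ∀ i j → int (i ℤ.+ j) ≈ int i + int j
  int-+ (+ m)    (+ n)    = nat-+ m n
  int-+ (+ m)    -[1+ n ] = int-⊖ m (suc n)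
  int-+ -[1+ m ] (+ n)    = trans (int-⊖ n (suc m)) (+-comm _ _)
  int-+ -[1+ m ] -[1+ n ] = begin
    - nat (suc (suc (m ℕ.+ n)))      ≡⟨ ≡.cong (λ k → - nat (suc k)) (≡.sym (ℕ.+-suc m n)) ⟩
    - nat (suc m ℕ.+ suc n)          ≈⟨ -‿cong (nat-+ (suc m) (suc n)) ⟩
    - (nat (suc m) + nat (suc n))    ≈⟨ ⁻¹-∙-comm _ _ ⟨
    - nat (suc m) - nat (suc n)      ∎

  int-* : ∀ i j → int (i ℤ.* j) ≈ int i * int j
  int-* (+ m)    (+ n)    = begin
    int (+ m ℤ.* + n)     ≡⟨ ≡.cong int (ℤ.pos-* m n) ⟨
    nat (m ℕ.* n)         ≈⟨ nat-* m n ⟩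
    nat m * nat n         ∎
  int-* (+ m)    -[1+ n ] = begin
    int (+ m ℤ.* -[1+ n ])   ≡⟨ ≡.cong int (ℤ.-◃n≡-n (m ℕ.* suc n)) ⟩
    int (ℤ.- (+ (m ℕ.* suc n))) ≈⟨ int-neg (m ℕ.* suc n) ⟩
    - nat (m ℕ.* suc n)      ≈⟨ -‿cong (nat-* m (suc n)) ⟩
    - (nat m * nat (suc n))  ≈⟨ -‿distribʳ-* _ _ ⟩
    nat m * (- nat (suc n))  ∎
  int-* -[1+ m ] (+ n)    = begin
    int (-[1+ m ] ℤ.* + n)   ≡⟨ ≡.cong int (ℤ.-◃n≡-n (suc m ℕ.* n)) ⟩
    int (ℤ.- (+ (suc m ℕ.* n))) ≈⟨ int-neg (suc m ℕ.* n) ⟩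
    - nat (suc m ℕ.* n)      ≈⟨ -‿cong (nat-* (suc m) n) ⟩
    - (nat (suc m) * nat n)  ≈⟨ -‿distribˡ-* _ _ ⟩
    (- nat (suc m)) * nat n  ∎
  int-* -[1+ m ] -[1+ n ] = begin
    nat (suc m ℕ.* suc n)    ≈⟨ nat-* (suc m) (suc n) ⟩
    nat (suc m) * nat (suc n) ≈⟨ -‿involutive _ ⟨
    - (- (nat (suc m) * nat (suc n))) ≈⟨ -‿cong (-‿distribʳ-* _ _) ⟩
    - (nat (suc m) * (- nat (suc n))) ≈⟨ -‿distribˡ-* _ _ ⟩
    (- nat (suc m)) * (- nat (suc n)) ∎

  int-- : ∀ i → int (ℤ.- i) ≈ - int i
  int-- (+ n)    = int-neg n
  int-- -[1+ n ] = sym (-‿involutive _)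

  homomorphism : ℤ.+-*-rawRing -Raw-AlmostCommutative⟶ fromCommutativeRing R
  homomorphism = record
    { ⟦_⟧ = int ; +-homo = int-+ ; *-homo = int-* ; -‿homo = int--
    ; 0-homo = refl ; 1-homo = refl }

  -- Distinct integers may have equal images in positive characteristic, so a negative answer
  -- asserts nothing.
  coefficient-≟ : ∀ i j → Maybe (int i ≈ int j)
  coefficient-≟ i j with i ℤ.≟ j
  ... | yes i≡j = just (reflexive (≡.cong int i≡j))
  ... | no  _   = nothing

  open RingSolver ℤ.+-*-rawRing (fromCommutativeRing R) homomorphism coefficient-≟ public
    using (solve; _:=_; _:+_; _:*_; _:-_; :-_; _:^_; con)

-- Fields with an apartness relation

module FieldProperties {c ℓ₁ ℓ₂} (K : HeytingField c ℓ₁ ℓ₂) where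
  open FieldOps K hiding (zero)
  open HeytingProperties heytingCommutativeRing public using (#-congʳ)

  commutativeRing : CommutativeRing c ℓ₁
  commutativeRing = HeytingCommutativeRing.commutativeRing heytingCommutativeRing

  open CommutativeRing commutativeRing using (commutativeSemiring; ring)
  open CommutativeRing commutativeRing public using (+-commutativeMonoid; *-commutativeMonoid)
  open ExpProperties commutativeSemiring public
    using (^-homo-*; ^-assocʳ; ^-distrib-*; ^-congˡ; ^-congʳ)
  open RingProperties ring public using (-‿involutive; -0#≈0#; +-identityʳ-unique)
    renaming (x∙y⁻¹≈ε⇒x≈y to x-y≈0⇒x≈y; x≈y⇒x∙y⁻¹≈ε to x≈y⇒x-y≈0)
  open IntegerCoefficients commutativeRing public
  open SetoidReasoning setoid

  ×ⁿ≈nat* : ∀ n x → n ×ⁿ x ≈ nat n * x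
  ×ⁿ≈nat* zero    x = sym (zeroˡ x)
  ×ⁿ≈nat* (suc n) x = begin
    x + n ×ⁿ x          ≈⟨ +-cong (sym (*-identityˡ x)) (×ⁿ≈nat* n x) ⟩
    1# * x + nat n * x  ≈⟨ distribʳ x 1# (nat n) ⟨
    (1# + nat n) * x    ≈⟨ *-congʳ (nat-suc n) ⟨
    nat (suc n) * x     ∎

  recip-inverseʳ : ∀ {x} (x#0 : x # 0#) → x * recip x#0 ≈ 1#
  recip-inverseʳ x#0 = trans (*-comm _ _) (recip-inverseˡ x#0)

  invertible⇒#0 : ∀ {x} y → y * x ≈ 1# → x # 0#
  invertible⇒#0 {x} y yx≈1 = invertibleˡ⇒# (y , trans (*-congˡ (x-0≈x x)) yx≈1)

  #⇒≉ : ∀ {x y} → x # y → ¬ x ≈ y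
  #⇒≉ x#y x≈y = #-irrefl x≈y x#y

  1≉0 : ¬ 1# ≈ 0#
  1≉0 = #⇒≉ 1#0

  *-cancelˡ-#0 : ∀ {x y z} → x # 0# → x * y ≈ x * z → y ≈ z
  *-cancelˡ-#0 {x} {y} {z} x#0 xy≈xz = begin
    y                      ≈⟨ *-identityˡ y ⟨
    1# * y                 ≈⟨ *-congʳ (recip-inverseˡ x#0) ⟨
    recip x#0 * x * y      ≈⟨ *-assoc _ _ _ ⟩
    recip x#0 * (x * y)    ≈⟨ *-congˡ xy≈xz ⟩
    recip x#0 * (x * z)    ≈⟨ *-assoc _ _ _ ⟨
    recip x#0 * x * z      ≈⟨ *-congʳ (recip-inverseˡ x#0) ⟩
    1# * z                 ≈⟨ *-identityˡ z ⟩
    z                      ∎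

  xy≈0⇒y≈0 : ∀ {x y} → x # 0# → x * y ≈ 0# → y ≈ 0#
  xy≈0⇒y≈0 x#0 xy≈0 = *-cancelˡ-#0 x#0 (trans xy≈0 (sym (zeroʳ _)))

  ≈-resp-#0 : ∀ {x y} → x ≈ y → x # 0# → y # 0#
  ≈-resp-#0 = #-congʳ

  xy#0⇒x#0 : ∀ {x y} → x * y # 0# → x # 0#
  xy#0⇒x#0 {x} {y} xy#0 = invertible⇒#0 (recip xy#0 * y) (begin
    recip xy#0 * y * x     ≈⟨ *-assoc _ _ _ ⟩
    recip xy#0 * (y * x)   ≈⟨ *-congˡ (*-comm y x) ⟩
    recip xy#0 * (x * y)   ≈⟨ recip-inverseˡ xy#0 ⟩
    1#                     ∎)

  #⇒-#0 : ∀ {x y} → x # y → x - y # 0#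
  #⇒-#0 x#y = let (z , zx≈1 , _) = #⇒invertible x#y in invertible⇒#0 z zx≈1

  -- Cotransitivity compares y with both x + y and 0. This is the substitute for a case distinction
  -- where equality is undecidable.
  +#0⇒#0 : ∀ {x y} → x + y # 0# → x # 0# ⊎ y # 0#
  +#0⇒#0 {x} {y} x+y#0 with #-cotrans x+y#0 y
  ... | inj₁ x+y#y = inj₁ (≈-resp-#0 (solve 2 (λ x y → (x :+ y) :- y := x) refl x y)
                                     (#⇒-#0 x+y#y))
  ... | inj₂ y#0   = inj₂ y#0

  ^-#0 : ∀ {x} n → x # 0# → x ^ n # 0#
  ^-#0 zero    x#0 = 1#0
  ^-#0 (suc n) x#0 = x#0y#0→xy#0 x#0 (^-#0 n x#0)

  1^n≈1 : ∀ n → 1# ^ n ≈ 1#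
  1^n≈1 zero    = refl
  1^n≈1 (suc n) = trans (*-identityˡ _) (1^n≈1 n)

  x^n≈1⇒x^[n*k]≈1 : ∀ {x} n k → x ^ n ≈ 1# → x ^ (n ℕ.* k) ≈ 1#
  x^n≈1⇒x^[n*k]≈1 {x} n k x^n≈1 =
    trans (sym (^-assocʳ x n k)) (trans (^-congˡ k x^n≈1) (1^n≈1 k))

  ∣⇒^≈1 : ∀ {x} d {n} → x ^ d ≈ 1# → d ∣ n → x ^ n ≈ 1#
  ∣⇒^≈1 {x} d x^d≈1 (divides k ≡.refl) =
    trans (^-congʳ x (ℕ.*-comm k d)) (x^n≈1⇒x^[n*k]≈1 d k x^d≈1)

  ^-∸ : ∀ {x i j} → x # 0# → i ℕ.≤ j → x ^ j ≈ x ^ i * x ^ (j ℕ.∸ i)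
  ^-∸ {x} {i} {j} x#0 i≤j =
    trans (^-congʳ x (≡.sym (ℕ.m+[n∸m]≡n i≤j))) (^-homo-* x i (j ℕ.∸ i))

  x^i≈x^j⇒x^[j∸i]≈1 : ∀ {x i j} → x # 0# → i ℕ.≤ j → x ^ i ≈ x ^ j → x ^ (j ℕ.∸ i) ≈ 1#
  x^i≈x^j⇒x^[j∸i]≈1 {x} {i} {j} x#0 i≤j eq = *-cancelˡ-#0 (^-#0 i x#0)
    (trans (sym (^-∸ x#0 i≤j)) (trans (sym eq) (sym (*-identityʳ _))))

-- Finite fields and sums over all their elements

module FiniteFieldProperties {q c ℓ₁ ℓ₂} (𝔽 : FiniteField q c ℓ₁ ℓ₂) where
  open FiniteField 𝔽 hiding (sum; zero)
  open FieldProperties heytingField public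

  ≉0⇒#0 : ∀ {x} → ¬ x ≈ 0# → x # 0#
  ≉0⇒#0 {x} x≉0 with unit? x
  ... | yes x#0 = x#0
  ... | no ¬x#0 = contradiction (tight _ _ .proj₁ ¬x#0) x≉0

  ≉⇒-#0 : ∀ {x y} → ¬ x ≈ y → x - y # 0#
  ≉⇒-#0 x≉y = ≉0⇒#0 (λ e → x≉y (x-y≈0⇒x≈y _ _ e))

  0-or-#0 : ∀ x → x ≈ 0# ⊎ x # 0#
  0-or-#0 x with unit? x
  ... | yes x#0 = inj₂ x#0
  ... | no ¬x#0 = inj₁ (tight _ _ .proj₁ ¬x#0)

  xy≈0⇒x≈0⊎y≈0 : ∀ {x y} → x * y ≈ 0# → x ≈ 0# ⊎ y ≈ 0#
  xy≈0⇒x≈0⊎y≈0 {x} xy≈0 with 0-or-#0 x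
  ... | inj₁ x≈0 = inj₁ x≈0
  ... | inj₂ x#0 = inj₂ (xy≈0⇒y≈0 x#0 xy≈0)

  -- Total, with 0 sent to 0, so that z ↦ a/z can be used to reindex sums over the whole field.
  inv : Carrier → Carrier
  inv x with unit? x
  ... | yes x#0 = recip x#0
  ... | no  _   = 0#

  inv-inverseˡ : ∀ {x} → x # 0# → inv x * x ≈ 1#
  inv-inverseˡ {x} x#0 with unit? x
  ... | yes p = recip-inverseˡ p
  ... | no ¬p = contradiction x#0 ¬p

  inv-inverseʳ : ∀ {x} → x # 0# → x * inv x ≈ 1#
  inv-inverseʳ x#0 = trans (*-comm _ _) (inv-inverseˡ x#0)

  inv#0 : ∀ {x} → x # 0# → inv x # 0#
  inv#0 {x} x#0 = invertible⇒#0 x (inv-inverseʳ x#0)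

  inv-0 : ∀ {x} → x ≈ 0# → inv x ≈ 0#
  inv-0 {x} x≈0 with unit? x
  ... | yes p = contradiction x≈0 (#⇒≉ p)
  ... | no ¬p = refl

  /-*-cancel : ∀ x {y} → y # 0# → (x / y) * y ≈ x
  /-*-cancel x {y} y#0 with unit? y
  ... | yes p = trans (*-assoc _ _ _) (trans (*-congˡ (recip-inverseˡ p)) (*-identityʳ x))
  ... | no ¬p = contradiction y#0 ¬p

  element-injective : ∀ {i j} → element i ≈ element j → i ≡ j
  element-injective e = ≡.trans (≡.sym (Inverse.inverseˡ enumeration refl))
    (≡.trans (index-cong e) (Inverse.inverseˡ enumeration refl))

  index-element : ∀ i → index (element i) ≡ i
  index-element i = element-injective (element-index _)

  -- Pigeonhole: a missed value `y`, put in front of the q values of `f`, would give an injection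
  -- from `Fin (suc q)` to `Fin q`.
  injective⇒surjective : (f : Carrier → Carrier) → (∀ {x y} → f x ≈ f y → x ≈ y) →
                         ∀ y → ∃[ x ] f x ≈ y
  injective⇒surjective f f-inj y with Fin.any? (λ i → f (element i) ≟ y)
  ... | yes (i , e) = element i , e
  ... | no  y∉f     = contradiction (Fin.injective⇒≤ {f = g} g-inj) ℕ.1+n≰n
    where
    g : Fin (suc q) → Fin q
    g zero    = index y
    g (suc i) = index (f (element i))

    index-injective : ∀ {x y} → index x ≡ index y → x ≈ y
    index-injective e = trans (sym (element-index _))
      (trans (Inverse.from-cong enumeration e) (element-index _))

    g-inj : ∀ {i j} → g i ≡ g j → i ≡ j
    g-inj {zero}  {zero}  e = ≡.refl
    g-inj {zero}  {suc j} e = contradiction (j , sym (index-injective e)) y∉f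
    g-inj {suc i} {zero}  e = contradiction (i , index-injective e) y∉f
    g-inj {suc i} {suc j} e = ≡.cong suc (element-injective (f-inj (index-injective e)))

  -- Stated over any commutative monoid because three are needed: sums in 𝔽 for the characteristic,
  -- products in 𝔽 for Fermat's theorem, and sums in 𝕂 for characters.
  module Sums {b ℓ} (M : CommutativeMonoid b ℓ) where
    private module M = CommutativeMonoid M
    open SumProperties M using (sum; sum-cong-≋; sum-permute; ∑-distrib-+; ∑-comm; sum-replicate-zero)

    Σᶠ : (Carrier → M.Carrier) → M.Carrier
    Σᶠ s = sum (λ i → s (element i))

    Congruent : (Carrier → M.Carrier) → Set _
    Congruent s = ∀ {x y} → x ≈ y → s x M.≈ s y

    Σᶠ-cong : ∀ {s t} → (∀ x → s x M.≈ t x) → Σᶠ s M.≈ Σᶠ t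
    Σᶠ-cong s≈t = sum-cong-≋ (λ i → s≈t (element i))

    Σᶠ-∙ : ∀ s t → Σᶠ (λ x → s x M.∙ t x) M.≈ Σᶠ s M.∙ Σᶠ t
    Σᶠ-∙ s t = ∑-distrib-+ {q} (λ i → s (element i)) (λ i → t (element i))

    Σᶠ-comm : ∀ (s : Carrier → Carrier → M.Carrier) →
              Σᶠ (λ x → Σᶠ (λ y → s x y)) M.≈ Σᶠ (λ y → Σᶠ (λ x → s x y))
    Σᶠ-comm s = ∑-comm {q} {q} (λ i j → s (element i) (element j))

    Σᶠ-ε : ∀ {s} → (∀ x → s x M.≈ M.ε) → Σᶠ s M.≈ M.ε
    Σᶠ-ε s≈ε = M.trans (Σᶠ-cong s≈ε) (sum-replicate-zero q)

    Σᶠ-reindex : ∀ {s} → Congruent s → (f g : Carrier → Carrier) →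
                 (∀ {x y} → x ≈ y → f x ≈ f y) → (∀ {x y} → x ≈ y → g x ≈ g y) →
                 (∀ x → f (g x) ≈ x) → (∀ x → g (f x) ≈ x) →
                 Σᶠ (λ x → s (f x)) M.≈ Σᶠ s
    Σᶠ-reindex {s} s-cong f g f-cong g-cong fg gf = M.sym (M.trans
      (sum-permute (λ i → s (element i)) π)
      (sum-cong-≋ {q} (λ i → s-cong (element-index (f (element i))))))
      where
      π : Perm.Permutation q q
      π = Perm.permutation (λ i → index (f (element i))) (λ i → index (g (element i)))
        (λ i → ≡.trans (index-cong (trans (f-cong (element-index _)) (fg _))) (index-element i))
        (λ i → ≡.trans (index-cong (trans (g-cong (element-index _)) (gf _))) (index-element i))

    private
      sum-single : ∀ {n} (t : Vector M.Carrier n) i → (∀ j → j ≢ i → t j M.≈ M.ε) → sum t M.≈ t i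
      sum-single {suc n} t zero    t≈ε = M.trans
        (M.∙-congˡ (M.trans (sum-cong-≋ (λ j → t≈ε (suc j) (λ ()))) (sum-replicate-zero n)))
        (M.identityʳ _)
      sum-single t (suc i) t≈ε = M.trans
        (M.∙-cong (t≈ε zero (λ ()))
                  (sum-single (t ∘ suc) i (λ j j≢i → t≈ε (suc j) (j≢i ∘ Fin.suc-injective))))
        (M.identityˡ _)

    Σᶠ-single : ∀ {s} → Congruent s → ∀ a → (∀ x → ¬ x ≈ a → s x M.≈ M.ε) → Σᶠ s M.≈ s a
    Σᶠ-single {s} s-cong a s≈ε = M.trans
      (sum-single _ (index a) (λ j j≢ → s≈ε (element j)
        (λ e → j≢ (≡.trans (≡.sym (index-element j)) (index-cong e)))))
      (s-cong (element-index a))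

-- Least witnesses, and the bound on the number of roots of a polynomial

least : ∀ {p} {P : Pred ℕ p} → Decidable P → ∀ n → P n → ∃[ d ] P d × (∀ {j} → j ℕ.< d → ¬ P j)
least {P = P} P? = <-rec _ search
  where
  search : ∀ n → (∀ {k} → k ℕ.< n → P k → ∃[ d ] P d × (∀ {j} → j ℕ.< d → ¬ P j)) →
           P n → ∃[ d ] P d × (∀ {j} → j ℕ.< d → ¬ P j)
  search n rec Pn with ℕ.anyUpTo? P? n
  ... | yes (k , k<n , Pk) = rec k<n Pk
  ... | no  none           = n , Pn , λ j<n Pj → none (_ , j<n , Pj)

module Polynomials {c ℓ₁ ℓ₂} (K : HeytingField c ℓ₁ ℓ₂) where
  open FieldOps K hiding (zero)
  open FieldProperties K
  open SetoidReasoning setoid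

  -- f is a polynomial function of formal degree n with leading coefficient l,
  -- expressed through iterated divided differences.
  HasLeading : ℕ → Carrier → (Carrier → Carrier) → Set (c ⊔ ℓ₁)
  HasLeading zero    l f = ∀ x → f x ≈ l
  HasLeading (suc n) l f =
    ∀ r → ∃[ g ] HasLeading n l g × (∀ x → f x - f r ≈ (x - r) * g x)

  -- The degree is only formal. Padding with a zero leading coefficient lets summands of different
  -- degrees be added.
  raise : ∀ n {l f} → HasLeading n l f → HasLeading (suc n) 0# f
  raise zero {l} f≈l r = (λ _ → 0#) , (λ _ → refl) , λ x →
    trans (+-cong (f≈l x) (-‿cong (f≈l r)))
          (solve 3 (λ l x r → l :- l := (x :- r) :* con (+ 0)) refl l x r)
  raise (suc n) p r = let (g , p′ , e) = p r in g , raise n p′ , e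

  +-leading : ∀ n {l l′ f f′} → HasLeading n l f → HasLeading n l′ f′ →
              HasLeading n (l + l′) (λ x → f x + f′ x)
  +-leading zero    p p′ x = +-cong (p x) (p′ x)
  +-leading (suc n) {f = f} {f′} p p′ r =
    let (g , d , e) = p r ; (g′ , d′ , e′) = p′ r in
    (λ x → g x + g′ x) , +-leading n d d′ , λ x → begin
      (f x + f′ x) - (f r + f′ r)
        ≈⟨ solve 4 (λ a b c d → (a :+ b) :- (c :+ d) := (a :- c) :+ (b :- d)) refl _ _ _ _ ⟩
      (f x - f r) + (f′ x - f′ r)       ≈⟨ +-cong (e x) (e′ x) ⟩
      (x - r) * g x + (x - r) * g′ x    ≈⟨ distribˡ _ _ _ ⟨
      (x - r) * (g x + g′ x)            ∎

  *-leading : ∀ n {l f} a → HasLeading n l f → HasLeading n (a * l) (λ x → a * f x)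
  *-leading zero    a p x = *-congˡ (p x)
  *-leading (suc n) {f = f} a p r =
    let (g , d , e) = p r in
    (λ x → a * g x) , *-leading n a d , λ x → begin
      a * f x - a * f r     ≈⟨ solve 3 (λ a b c → a :* b :- a :* c := a :* (b :- c)) refl _ _ _ ⟩
      a * (f x - f r)       ≈⟨ *-congˡ (e x) ⟩
      a * ((x - r) * g x)   ≈⟨ solve 3 (λ a b c → a :* (b :* c) := b :* (a :* c)) refl _ _ _ ⟩
      (x - r) * (a * g x)   ∎

  ≈-leading : ∀ n {l l′ f} → l ≈ l′ → HasLeading n l f → HasLeading n l′ f
  ≈-leading zero    l≈l′ p x = trans (p x) l≈l′
  ≈-leading (suc n) l≈l′ p r = let (g , d , e) = p r in g , ≈-leading n l≈l′ d , e

  -- If g is the difference quotient of f at r, that of x f(x) is f(x) + r g(x); the second summand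
  -- has lower degree, so the leading coefficient is still that of f.
  x*-leading : ∀ n {l f} → HasLeading n l f → HasLeading (suc n) l (λ x → x * f x)
  x*-leading zero {l} {f} p r = f , p , λ x → begin
    x * f x - r * f r   ≈⟨ +-congˡ (-‿cong (*-congˡ (trans (p r) (sym (p x))))) ⟩
    x * f x - r * f x   ≈⟨ solve 3 (λ x r a → x :* a :- r :* a := (x :- r) :* a) refl _ _ _ ⟩
    (x - r) * f x       ∎
  x*-leading (suc n) {l} {f} p r =
    let (g , d , e) = p r in
    (λ x → f x + r * g x) ,
    ≈-leading (suc n) (+-identityʳ l) (+-leading (suc n) p (raise n (*-leading n r d))) ,
    λ x → begin
      x * f x - r * f r
        ≈⟨ solve 4 (λ x r a b → x :* a :- r :* b := (x :- r) :* a :+ r :* (a :- b)) refl _ _ _ _ ⟩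
      (x - r) * f x + r * (f x - f r)          ≈⟨ +-congˡ (*-congˡ (e x)) ⟩
      (x - r) * f x + r * ((x - r) * g x)
        ≈⟨ solve 4 (λ d r a b → d :* a :+ r :* (d :* b) := d :* (a :+ r :* b)) refl _ _ _ _ ⟩
      (x - r) * (f x + r * g x)                ∎

  x^n-1-leading : ∀ n → HasLeading (suc n) 1# (λ x → x ^ suc n - 1#)
  x^n-1-leading n =
    ≈-leading (suc n) (+-identityʳ 1#) (+-leading (suc n) {f = _^ suc n} {f′ = λ _ → - 1#} (power (suc n)) (constant n (- 1#)))
    where
    power : ∀ n → HasLeading n 1# (_^ n)
    power zero    x = refl
    power (suc n)   = x*-leading n (power n)

    zeroPolynomial : ∀ n → HasLeading n 0# (λ _ → 0#)
    zeroPolynomial zero    x = refl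
    zeroPolynomial (suc n)   = raise n {f = λ _ → 0#} (zeroPolynomial n)

    constant : ∀ n a → HasLeading (suc n) 0# (λ _ → a)
    constant zero    a = raise zero {a} (λ _ → refl)
    constant (suc n) a = raise (suc n) {f = λ _ → a} (constant n a)

  -- The difference quotient at the first root has one degree less and the same leading coefficient,
  -- and it vanishes at all other roots because differences of roots are invertible.
  too-many-roots : ∀ n {l f} → HasLeading n l f → l # 0# → (root : Fin (suc n) → Carrier) →
                   (∀ i j → i ≢ j → root i - root j # 0#) → ¬ (∀ i → f (root i) ≈ 0#)
  too-many-roots zero    p l#0 root distinct f≈0 =
    #⇒≉ l#0 (trans (sym (p (root zero))) (f≈0 zero))
  too-many-roots (suc n) {f = f} p l#0 root distinct f≈0 =
    let (g , d , e) = p (root zero) in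
    too-many-roots n d l#0 (root ∘ suc)
      (λ i j i≢j → distinct (suc i) (suc j) (i≢j ∘ Fin.suc-injective))
      (λ i → xy≈0⇒y≈0 (distinct (suc i) zero (λ ()))
        (trans (sym (e (root (suc i))))
          (trans (+-cong (f≈0 (suc i)) (-‿cong (f≈0 zero))) (-‿inverseʳ 0#))))

-- Characteristic, Fermat's theorem and units that are not roots of unity of small order

module SexticStructure {q c ℓ₁ ℓ₂} (𝔽 : FiniteField q c ℓ₁ ℓ₂) (m : ℕ) (q≡ : q ≡ suc (m ℕ.* 6)) where
  open FiniteField 𝔽 hiding (sum; zero)
  open FiniteFieldProperties 𝔽
  open Polynomials heytingField
  open SetoidReasoning setoid
  private
    module Additive = Sums +-commutativeMonoid
    module Multiplicative = Sums *-commutativeMonoid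

  -- Translation by 1 permutes 𝔽, so the sum `S` of all elements is unchanged when q ones are added
  -- to it.
  nat-q≈0 : nat q ≈ 0#
  nat-q≈0 = +-identityʳ-unique S (nat q) (begin
    S + nat q                              ≈⟨ +-congˡ (trans (sym (*-identityʳ _)) (sym (×ⁿ≈nat* q 1#))) ⟩
    S + q ×ⁿ 1#                            ≈⟨ +-congˡ (sum-replicate q) ⟨
    S + Additive.Σᶠ (λ _ → 1#)             ≈⟨ Additive.Σᶠ-∙ id (λ _ → 1#) ⟨
    Additive.Σᶠ (_+ 1#)                    ≈⟨ Additive.Σᶠ-reindex id (_+ 1#) (_- 1#) +-congʳ +-congʳ
                                                (λ x → solve 1 (λ x → (x :- con (+ 1)) :+ con (+ 1) := x) refl x)
                                                (λ x → solve 1 (λ x → (x :+ con (+ 1)) :- con (+ 1) := x) refl x) ⟩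
    S                                      ∎)
    where
    S = Additive.Σᶠ id
    open SumProperties +-commutativeMonoid using (sum-replicate)

  -- The image of q = 1 + 6m is 0; if a divisor of 6 also vanished, this image would be 1.
  nat#0 : ∀ {k} → k ∣ 6 → nat k # 0#
  nat#0 {k} (divides l 6≡l*k) = ≉0⇒#0 λ k≈0 → 1≉0 (begin
    1#                                ≈⟨ +-identityʳ 1# ⟨
    1# + 0#                           ≈⟨ +-congˡ (*0 k≈0) ⟨
    1# + nat (m ℕ.* 6)                ≈⟨ nat-suc (m ℕ.* 6) ⟨
    nat (suc (m ℕ.* 6))               ≡⟨ ≡.cong nat q≡ ⟨
    nat q                             ≈⟨ nat-q≈0 ⟩
    0#                                ∎)
    where
    *0 : nat k ≈ 0# → nat (m ℕ.* 6) ≈ 0#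
    *0 k≈0 = begin
      nat (m ℕ.* 6)                ≈⟨ nat-* m 6 ⟩
      nat m * nat 6                ≡⟨ ≡.cong (λ n → nat m * nat n) 6≡l*k ⟩
      nat m * nat (l ℕ.* k)        ≈⟨ *-congˡ (nat-* l k) ⟩
      nat m * (nat l * nat k)      ≈⟨ *-congˡ (*-congˡ k≈0) ⟩
      nat m * (nat l * 0#)         ≈⟨ solve 2 (λ a b → a :* (b :* con (+ 0)) := con (+ 0)) refl _ _ ⟩
      0#                           ∎

  2#0 : nat 2 # 0#
  2#0 = nat#0 {2} (divides 3 ≡.refl)

  3#0 : nat 3 # 0#
  3#0 = nat#0 {3} (divides 2 ≡.refl)

  -- Scaling by u permutes the units, so u ^ (q - 1) times the product of the units is that
  -- product; 0 is kept in the product by giving it the factor 1.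
  u^[q-1]≈1 : ∀ {u} → u # 0# → u ^ (m ℕ.* 6) ≈ 1#
  u^[q-1]≈1 {u} u#0 = *-cancelˡ-#0 u#0 (begin
    u * u ^ (m ℕ.* 6)                  ≡⟨ ≡.cong (u ^_) q≡ ⟨
    u ^ q                              ≈⟨ sum-replicate q ⟨
    Π (λ _ → u)                        ≈⟨ Multiplicative.Σᶠ-cong split ⟨
    Π (λ x → atUnit u x * atZero u x)  ≈⟨ Multiplicative.Σᶠ-∙ (atUnit u) (atZero u) ⟩
    Π (atUnit u) * Π (atZero u)        ≈⟨ *-cong Πu≈1 Π0≈u ⟩
    1# * u                             ≈⟨ *-comm 1# u ⟩
    u * 1#                             ∎)
    where
    open SumProperties *-commutativeMonoid using (sum-replicate)
    Π = Multiplicative.Σᶠ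

    atUnit : Carrier → Carrier → Carrier
    atUnit y x with x ≟ 0#
    ... | yes _ = 1#
    ... | no  _ = y

    atZero : Carrier → Carrier → Carrier
    atZero y x with x ≟ 0#
    ... | yes _ = y
    ... | no  _ = 1#

    split : ∀ x → atUnit u x * atZero u x ≈ u
    split x with x ≟ 0#
    ... | yes _ = *-identityˡ u
    ... | no  _ = *-identityʳ u

    atZero-0 : ∀ {x} → x ≈ 0# → atZero u x ≈ u
    atZero-0 {x} x≈0 with x ≟ 0#
    ... | yes _   = refl
    ... | no  x≉0 = contradiction x≈0 x≉0

    atZero-≉0 : ∀ {x} → ¬ x ≈ 0# → atZero u x ≈ 1#
    atZero-≉0 {x} x≉0 with x ≟ 0#
    ... | yes x≈0 = contradiction x≈0 x≉0
    ... | no  _   = refl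

    atZero-cong : ∀ {x y} → x ≈ y → atZero u x ≈ atZero u y
    atZero-cong {x} {y} x≈y with y ≟ 0#
    ... | yes y≈0 = atZero-0 (trans x≈y y≈0)
    ... | no  y≉0 = atZero-≉0 (λ x≈0 → y≉0 (trans (sym x≈y) x≈0))

    Π0≈u : Π (atZero u) ≈ u
    Π0≈u = trans (Multiplicative.Σᶠ-single atZero-cong 0# (λ x → atZero-≉0)) (atZero-0 refl)

    unitOr1 : Carrier → Carrier
    unitOr1 x = atUnit x x

    unitOr1-0 : ∀ {x} → x ≈ 0# → unitOr1 x ≈ 1#
    unitOr1-0 {x} x≈0 with x ≟ 0#
    ... | yes _   = refl
    ... | no  x≉0 = contradiction x≈0 x≉0

    unitOr1-≉0 : ∀ {x} → ¬ x ≈ 0# → unitOr1 x ≈ x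
    unitOr1-≉0 {x} x≉0 with x ≟ 0#
    ... | yes x≈0 = contradiction x≈0 x≉0
    ... | no  _   = refl

    unitOr1-cong : ∀ {x y} → x ≈ y → unitOr1 x ≈ unitOr1 y
    unitOr1-cong {x} {y} x≈y with y ≟ 0#
    ... | yes y≈0 = unitOr1-0 (trans x≈y y≈0)
    ... | no  y≉0 = trans (unitOr1-≉0 (λ x≈0 → y≉0 (trans (sym x≈y) x≈0))) x≈y

    scale : ∀ x → atUnit u x * unitOr1 x ≈ unitOr1 (u * x)
    scale x with x ≟ 0#
    ... | yes x≈0 = trans (*-identityˡ 1#) (sym (unitOr1-0 (trans (*-congˡ x≈0) (zeroʳ u))))
    ... | no  x≉0 = sym (unitOr1-≉0 (λ ux≈0 → x≉0 (xy≈0⇒y≈0 u#0 ux≈0)))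

    ΠunitOr1#0 : ∀ n (t : Vector Carrier n) → (∀ i → t i # 0#) →
               SumProperties.sum *-commutativeMonoid t # 0#
    ΠunitOr1#0 zero    t t#0 = 1#0
    ΠunitOr1#0 (suc n) t t#0 = x#0y#0→xy#0 (t#0 zero) (ΠunitOr1#0 n (t ∘ suc) (t#0 ∘ suc))

    unitOr1#0 : ∀ x → unitOr1 x # 0#
    unitOr1#0 x with x ≟ 0#
    ... | yes _   = 1#0
    ... | no  x≉0 = ≉0⇒#0 x≉0

    Πu≈1 : Π (atUnit u) ≈ 1#
    Πu≈1 = *-cancelˡ-#0 (ΠunitOr1#0 q (λ i → unitOr1 (element i)) (λ i → unitOr1#0 _)) (begin
      Π unitOr1 * Π (atUnit u)          ≈⟨ *-comm _ _ ⟩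
      Π (atUnit u) * Π unitOr1          ≈⟨ Multiplicative.Σᶠ-∙ (atUnit u) unitOr1 ⟨
      Π (λ x → atUnit u x * unitOr1 x)  ≈⟨ Multiplicative.Σᶠ-cong scale ⟩
      Π (λ x → unitOr1 (u * x))         ≈⟨ Multiplicative.Σᶠ-reindex unitOr1-cong (u *_) (recip u#0 *_) *-congˡ *-congˡ
                                           (λ x → trans (sym (*-assoc _ _ _)) (trans (*-congʳ (recip-inverseʳ u#0)) (*-identityˡ x)))
                                           (λ x → trans (sym (*-assoc _ _ _)) (trans (*-congʳ (recip-inverseˡ u#0)) (*-identityˡ x))) ⟩
      Π unitOr1                         ≈⟨ *-identityʳ _ ⟨
      Π unitOr1 * 1#                    ∎)

  -- Otherwise every element of 𝔽 would be a root of x (x^(n+1) - 1), whose degree n + 2 is less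
  -- than q. The factor x makes 0 a root as well, so that no enumeration of the units alone is
  -- needed.
  non-root : ∀ n → suc n ℕ.< m ℕ.* 6 → ∃[ u ] u # 0# × ¬ u ^ suc n ≈ 1#
  non-root n n< with Fin.any? (λ i → unit-non-root? (element i))
    where
    unit-non-root? : ∀ u → Dec (u # 0# × ¬ u ^ suc n ≈ 1#)
    unit-non-root? u with unit? u | u ^ suc n ≟ 1#
    ... | no ¬u#0 | _      = no (¬u#0 ∘ proj₁)
    ... | yes u#0 | yes e  = no (λ (_ , ne) → ne e)
    ... | yes u#0 | no  ne = yes (u#0 , ne)
  ... | yes (i , p) = element i , p
  ... | no  none    = contradiction all-roots
          (too-many-roots (suc (suc n)) (x*-leading (suc n) (x^n-1-leading n)) 1#0 root root-distinct)
    where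
    2+n<q : suc (suc (suc n)) ℕ.≤ q
    2+n<q = ≡.subst (suc (suc (suc n)) ℕ.≤_) (≡.sym q≡) (ℕ.s≤s n<)

    root : Fin (suc (suc (suc n))) → Carrier
    root i = element (Fin.inject≤ i 2+n<q)

    root-distinct : ∀ i j → i ≢ j → root i - root j # 0#
    root-distinct i j i≢j = ≉⇒-#0 (λ e → i≢j (Fin.inject≤-injective _ _ i j (element-injective e)))

    all-roots : ∀ i → root i * (root i ^ suc n - 1#) ≈ 0#
    all-roots i with 0-or-#0 (root i)
    ... | inj₁ x≈0 = trans (*-congʳ x≈0) (zeroˡ _)
    ... | inj₂ x#0 with root i ^ suc n ≟ 1#
    ...   | yes e  = trans (*-congˡ (x≈y⇒x-y≈0 e)) (zeroʳ _)
    ...   | no  ne = contradiction (Fin.inject≤ i 2+n<q , x#0 , ne) none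

-- Residues modulo 2, 3 and 6

module ℕ-* = CommutativeSemigroupProperties ℕ.*-commutativeSemigroup

-- The residues prime to 6 are 1 and 5, with squares 1 and 25. Such an `e` is thus its own inverse
-- modulo 6, which spares a search for Bézout coefficients.
square-mod-6 : ∀ e → ¬ 2 ∣ e → ¬ 3 ∣ e → ∃[ k ] e ℕ.* e ≡ 1 ℕ.+ k ℕ.* 6
square-mod-6 e 2∤e 3∤e with e ℕ.% 6 in e%6≡ | e ℕ./ 6 | ℕ.m≡m%n+[m/n]*n e 6 | ℕ.m%n<n e 6
... | 0 | k | e≡ | _ = contradiction (divides (k ℕ.* 3) (≡.trans e≡ (solve 1 (λ k → k :* con 6 := k :* con 3 :* con 2) ≡.refl k))) 2∤e
  where open ℕ-Solver.+-*-Solver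
... | 1 | k | e≡ | _ = k ℕ.* 2 ℕ.+ k ℕ.* k ℕ.* 6 , ≡.trans (≡.cong₂ ℕ._*_ e≡ e≡)
  (solve 1 (λ k → (con 1 :+ k :* con 6) :* (con 1 :+ k :* con 6) := con 1 :+ (k :* con 2 :+ k :* k :* con 6) :* con 6) ≡.refl k)
  where open ℕ-Solver.+-*-Solver
... | 2 | k | e≡ | _ = contradiction (divides (1 ℕ.+ k ℕ.* 3) (≡.trans e≡ (solve 1 (λ k → con 2 :+ k :* con 6 := (con 1 :+ k :* con 3) :* con 2) ≡.refl k))) 2∤e
  where open ℕ-Solver.+-*-Solver
... | 3 | k | e≡ | _ = contradiction (divides (1 ℕ.+ k ℕ.* 2) (≡.trans e≡ (solve 1 (λ k → con 3 :+ k :* con 6 := (con 1 :+ k :* con 2) :* con 3) ≡.refl k))) 3∤e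
  where open ℕ-Solver.+-*-Solver
... | 4 | k | e≡ | _ = contradiction (divides (2 ℕ.+ k ℕ.* 3) (≡.trans e≡ (solve 1 (λ k → con 4 :+ k :* con 6 := (con 2 :+ k :* con 3) :* con 2) ≡.refl k))) 2∤e
  where open ℕ-Solver.+-*-Solver
... | 5 | k | e≡ | _ = 4 ℕ.+ k ℕ.* 10 ℕ.+ k ℕ.* k ℕ.* 6 , ≡.trans (≡.cong₂ ℕ._*_ e≡ e≡)
  (solve 1 (λ k → (con 5 :+ k :* con 6) :* (con 5 :+ k :* con 6) := con 1 :+ (con 4 :+ k :* con 10 :+ k :* k :* con 6) :* con 6) ≡.refl k)
  where open ℕ-Solver.+-*-Solver
... | suc (suc (suc (suc (suc (suc r))))) | k | e≡ | ℕ.s≤s (ℕ.s≤s (ℕ.s≤s (ℕ.s≤s (ℕ.s≤s (ℕ.s≤s ())))))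

halve : ∀ j → ∃[ k ] (j ≡ k ℕ.* 2 ⊎ j ≡ suc (k ℕ.* 2))
halve j with j ℕ.% 2 | j ℕ./ 2 | ℕ.m≡m%n+[m/n]*n j 2 | ℕ.m%n<n j 2
... | 0 | k | j≡ | _ = k , inj₁ j≡
... | 1 | k | j≡ | _ = k , inj₂ j≡
... | suc (suc _) | _ | _ | ℕ.s≤s (ℕ.s≤s ())

third : ∀ j → ∃[ k ] (j ≡ k ℕ.* 3 ⊎ j ≡ suc (k ℕ.* 3) ⊎ j ≡ suc (suc (k ℕ.* 3)))
third j with j ℕ.% 3 | j ℕ./ 3 | ℕ.m≡m%n+[m/n]*n j 3 | ℕ.m%n<n j 3
... | 0 | k | j≡ | _ = k , inj₁ j≡
... | 1 | k | j≡ | _ = k , inj₂ (inj₁ j≡)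
... | 2 | k | j≡ | _ = k , inj₂ (inj₂ j≡)
... | suc (suc (suc _)) | _ | _ | ℕ.s≤s (ℕ.s≤s (ℕ.s≤s ()))

-- An element generating the units modulo sixth powers

module SexticGenerator {q c ℓ₁ ℓ₂} (𝔽 : FiniteField q c ℓ₁ ℓ₂) (m : ℕ) (q≡ : q ≡ suc (m ℕ.* 6)) where
  open FiniteField 𝔽 hiding (sum; zero)
  open FiniteFieldProperties 𝔽
  open Polynomials heytingField
  open SexticStructure 𝔽 m q≡ public
  open SetoidReasoning setoid

  m-nonZero : NonZero m
  m-nonZero = ℕ.≢-nonZero λ m≡0 → 1≉0 (begin
    1#                     ≈⟨ element-index 1# ⟨
    element (index 1#)     ≡⟨ ≡.cong element (Fin1-unique (≡.trans q≡ (≡.cong (λ m → suc (m ℕ.* 6)) m≡0)) _ _) ⟩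
    element (index 0#)     ≈⟨ element-index 0# ⟩
    0#                     ∎)
    where
    Fin1-unique : ∀ {n} → n ≡ 1 → (i j : Fin n) → i ≡ j
    Fin1-unique ≡.refl zero zero = ≡.refl

  non-root-m* : ∀ k → suc k ℕ.< 6 → ∃[ u ] u # 0# × ¬ u ^ (m ℕ.* suc k) ≈ 1#
  non-root-m* k k<6 with m ℕ.* suc k in eq | ℕ.m*n≢0 m (suc k) {{m-nonZero}} | ℕ.*-monoʳ-< m {{m-nonZero}} k<6
  ... | suc n | _ | n< = non-root n n<

  u^[m*6]≈1⇒ : ∀ {u} → u # 0# → (u ^ m) ^ 6 ≈ 1#
  u^[m*6]≈1⇒ {u} u#0 = trans (^-assocʳ u m 6) (u^[q-1]≈1 u#0)

  opaque
    -- With `α ^ (3m)` different from 1, `A ^ 3` is -1; with `β ^ (2m)` different from 1, `B ^ 2` is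
    -- a primitive cube root of unity. Their product is a primitive sixth root of unity, and it is
    -- `γ ^ m` for γ = α³β². Only γ^m is claimed to be primitive, of order 6; γ itself may generate
    -- a proper subgroup.
    primitive-element : ∃[ γ ] γ # 0# × (γ ^ m) ^ 2 - γ ^ m + 1# ≈ 0#
    primitive-element =
      let (α , α#0 , α≉) = non-root-m* 2 (ℕ.s≤s (ℕ.s≤s (ℕ.s≤s (ℕ.s≤s ℕ.z≤n))))
          (β , β#0 , β≉) = non-root-m* 1 (ℕ.s≤s (ℕ.s≤s (ℕ.s≤s ℕ.z≤n)))
          A = α ^ m ; B = β ^ m
          A³+1≈0 : A ^ 3 + 1# ≈ 0#
          A³+1≈0 = xy≈0⇒y≈0 (≉⇒-#0 λ e → α≉ (trans (sym (^-assocʳ α m 3)) e))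
            (trans (solve 1 (λ a → (a :^ 3 :- con (+ 1)) :* (a :^ 3 :+ con (+ 1)) := a :^ 6 :- con (+ 1)) refl A)
                   (x≈y⇒x-y≈0 (u^[m*6]≈1⇒ α#0)))
          B⁴+B²+1≈0 : B ^ 4 + B ^ 2 + 1# ≈ 0#
          B⁴+B²+1≈0 = xy≈0⇒y≈0 (≉⇒-#0 λ e → β≉ (trans (sym (^-assocʳ β m 2)) e))
            (trans (solve 1 (λ b → (b :^ 2 :- con (+ 1)) :* (b :^ 4 :+ b :^ 2 :+ con (+ 1)) := b :^ 6 :- con (+ 1)) refl B)
                   (x≈y⇒x-y≈0 (u^[m*6]≈1⇒ β#0)))
          γ = α ^ 3 * β ^ 2
          γ^m≈ : γ ^ m ≈ A ^ 3 * B ^ 2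
          γ^m≈ = trans (^-distrib-* (α ^ 3) (β ^ 2) m)
                       (*-cong (^-swap α 3) (^-swap β 2))
      in γ , x#0y#0→xy#0 (^-#0 3 α#0) (^-#0 2 β#0) , (begin
        (γ ^ m) ^ 2 - γ ^ m + 1#
          ≈⟨ +-congʳ (+-cong (^-congˡ 2 γ^m≈) (-‿cong γ^m≈)) ⟩
        (A ^ 3 * B ^ 2) ^ 2 - A ^ 3 * B ^ 2 + 1#
          ≈⟨ solve 2 (λ a³ b → (a³ :* b :^ 2) :^ 2 :- a³ :* b :^ 2 :+ con (+ 1)
               := (b :^ 4 :+ b :^ 2 :+ con (+ 1)) :+ (a³ :+ con (+ 1)) :* ((a³ :- con (+ 1)) :* b :^ 4 :- b :^ 2))
               refl (A ^ 3) B ⟩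
        (B ^ 4 + B ^ 2 + 1#) + (A ^ 3 + 1#) * ((A ^ 3 - 1#) * B ^ 4 - B ^ 2)
          ≈⟨ +-cong B⁴+B²+1≈0 (trans (*-congʳ A³+1≈0) (zeroˡ _)) ⟩
        0# + 0#   ≈⟨ +-identityʳ 0# ⟩
        0#        ∎)
      where
      ^-swap : ∀ x k → (x ^ k) ^ m ≈ (x ^ m) ^ k
      ^-swap x k = trans (^-assocʳ x k m) (trans (^-congʳ x (ℕ.*-comm k m)) (sym (^-assocʳ x m k)))

  γ : Carrier
  γ = primitive-element .proj₁

  γ#0 : γ # 0#
  γ#0 = primitive-element .proj₂ .proj₁

  ρ : Carrier
  ρ = γ ^ m

  ρ²-ρ+1≈0 : ρ ^ 2 - ρ + 1# ≈ 0#
  ρ²-ρ+1≈0 = primitive-element .proj₂ .proj₂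

  γ^[m*3]≈-1 : γ ^ (m ℕ.* 3) ≈ - 1#
  γ^[m*3]≈-1 = trans (sym (^-assocʳ γ m 3)) (begin
    ρ ^ 3                                   ≈⟨ solve 1 (λ r → r :^ 3 := (r :+ con (+ 1)) :* (r :^ 2 :- r :+ con (+ 1)) :- con (+ 1)) refl ρ ⟩
    (ρ + 1#) * (ρ ^ 2 - ρ + 1#) - 1#        ≈⟨ +-congʳ (trans (*-congˡ ρ²-ρ+1≈0) (zeroʳ _)) ⟩
    0# - 1#                                 ≈⟨ +-identityˡ _ ⟩
    - 1#                                    ∎)

  γ^[m*3]≉1 : ¬ γ ^ (m ℕ.* 3) ≈ 1#
  γ^[m*3]≉1 e = #⇒≉ 2#0 (begin
    nat 2        ≈⟨ solve 0 (con (+ 2) := con (+ 1) :- (:- con (+ 1))) refl ⟩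
    1# - (- 1#)  ≈⟨ x≈y⇒x-y≈0 (trans (sym e) γ^[m*3]≈-1) ⟩
    0#           ∎)

  -- The polynomials x² - x + 1 and x² - 1 have an integral combination equal to 3, so a common root
  -- would make 3 vanish.
  γ^[m*2]≉1 : ¬ γ ^ (m ℕ.* 2) ≈ 1#
  γ^[m*2]≉1 e = #⇒≉ 3#0 (begin
    nat 3
      ≈⟨ solve 1 (λ r → con (+ 3) := (r :^ 2 :- r :+ con (+ 1)) :* (con (+ 2) :+ r) :- (r :^ 2 :- con (+ 1)) :* (con (+ 1) :+ r)) refl ρ ⟩
    (ρ ^ 2 - ρ + 1#) * (nat 2 + ρ) - (ρ ^ 2 - 1#) * (1# + ρ)
      ≈⟨ +-cong (*-congʳ ρ²-ρ+1≈0) (-‿cong (*-congʳ (x≈y⇒x-y≈0 ρ²≈1))) ⟩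
    0# * (nat 2 + ρ) - 0# * (1# + ρ)
      ≈⟨ solve 1 (λ r → con (+ 0) :* (con (+ 2) :+ r) :- con (+ 0) :* (con (+ 1) :+ r) := con (+ 0)) refl ρ ⟩
    0#           ∎)
    where
    ρ²≈1 : ρ ^ 2 ≈ 1#
    ρ²≈1 = trans (^-assocʳ γ m 2) e

  private
    IsExponent : ℕ → Set _
    IsExponent n = 0 ℕ.< n × γ ^ n ≈ 1#

    m*6>0 : 0 ℕ.< m ℕ.* 6
    m*6>0 = ℕ.*-mono-< (ℕ.>-nonZero⁻¹ m {{m-nonZero}}) (ℕ.s≤s ℕ.z≤n)

    opaque
      leastExponent : ∃[ d ] IsExponent d × (∀ {j} → j ℕ.< d → ¬ IsExponent j)
      leastExponent = least (λ n → (0 ℕ.<? n) ×-dec (γ ^ n ≟ 1#)) (m ℕ.* 6) (m*6>0 , u^[q-1]≈1 γ#0)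

  order : ℕ
  order = leastExponent .proj₁

  order>0 : 0 ℕ.< order
  order>0 = leastExponent .proj₂ .proj₁ .proj₁

  order-nonZero : NonZero order
  order-nonZero = ℕ.>-nonZero order>0

  γ^order≈1 : γ ^ order ≈ 1#
  γ^order≈1 = leastExponent .proj₂ .proj₁ .proj₂

  γ^≉1 : ∀ {j} → 0 ℕ.< j → j ℕ.< order → ¬ γ ^ j ≈ 1#
  γ^≉1 0<j j<d γ^j≈1 = leastExponent .proj₂ .proj₂ j<d (0<j , γ^j≈1)

  order-∣ : ∀ {n} → γ ^ n ≈ 1# → order ∣ n
  order-∣ {n} γ^n≈1 = ℕ.m%n≡0⇒n∣m n order {{order-nonZero}} (remainder≡0 (n ℕ.% order) (ℕ.m%n<n n order) (begin
    γ ^ (n ℕ.% order)                                        ≈⟨ *-identityʳ _ ⟨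
    γ ^ (n ℕ.% order) * 1#                                   ≈⟨ *-congˡ (∣⇒^≈1 order γ^order≈1 (divides (n ℕ./ order) ≡.refl)) ⟨
    γ ^ (n ℕ.% order) * γ ^ (n ℕ./ order ℕ.* order)          ≈⟨ ^-homo-* γ (n ℕ.% order) (n ℕ./ order ℕ.* order) ⟨
    γ ^ (n ℕ.% order ℕ.+ n ℕ./ order ℕ.* order)              ≡⟨ ≡.cong (γ ^_) (ℕ.m≡m%n+[m/n]*n n order) ⟨
    γ ^ n                                                  ≈⟨ γ^n≈1 ⟩
    1#                                                     ∎))
    where
    instance
      _ : NonZero order
      _ = order-nonZero
    remainder≡0 : ∀ r → r ℕ.< order → γ ^ r ≈ 1# → r ≡ 0
    remainder≡0 zero    _   _     = ≡.refl
    remainder≡0 (suc r) r<d γ^r≈1 = contradiction γ^r≈1 (γ^≉1 (ℕ.s≤s ℕ.z≤n) r<d)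

  opaque
    order∣m*6 : order ∣ m ℕ.* 6
    order∣m*6 = order-∣ (u^[q-1]≈1 γ#0)

  -- The index in the unit group of the subgroup generated by γ.
  coindex : ℕ
  coindex = _∣_.quotient order∣m*6

  m*6≡coindex*order : m ℕ.* 6 ≡ coindex ℕ.* order
  m*6≡coindex*order = _∣_.equality order∣m*6

  private
    -- If `k` divided the index, then `order` would divide (q - 1)/k, which is `m * l`.
    ∤coindex : ∀ {k l} .{{_ : NonZero k}} → l ℕ.* k ≡ 6 → ¬ γ ^ (m ℕ.* l) ≈ 1# → ¬ k ∣ coindex
    ∤coindex {k} {l} l*k≡6 γ^≉1 (divides e′ e≡) = γ^≉1 (∣⇒^≈1 order {m ℕ.* l} γ^order≈1 (divides e′ (ℕ.*-cancelʳ-≡ (m ℕ.* l) (e′ ℕ.* order) k (≡.trans (ℕ.*-assoc m l k) (≡.trans (≡.cong (m ℕ.*_) l*k≡6)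
      (≡.trans m*6≡coindex*order (≡.trans (≡.cong (ℕ._* order) e≡)
        (ℕ-*.xy∙z≈xz∙y e′ k order))))))))

  opaque
    coindex-square : ∃[ k ] coindex ℕ.* coindex ≡ 1 ℕ.+ k ℕ.* 6
    coindex-square = square-mod-6 coindex (∤coindex {2} {3} ≡.refl γ^[m*3]≉1) (∤coindex {3} {2} ≡.refl γ^[m*2]≉1)

    -- The powers of γ with exponents below `order` are already `order` distinct roots of x^order -
    -- 1; a root `u` outside them would be one too many.
    u^order≈1⇒power : ∀ {u} → u ^ order ≈ 1# → ∃[ i ] u ≈ γ ^ i
    u^order≈1⇒power {u} u^d≈1 with Fin.any? {n = order} (λ i → u ≟ γ ^ toℕ i)
    ... | yes (i , e) = toℕ i , e
    ... | no  none    = contradiction u^d≈1 (no-more order ≡.refl order>0)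
      where
      no-more : ∀ n → order ≡ n → 0 ℕ.< n → ¬ u ^ order ≈ 1#
      no-more (suc n) d≡ _ u^d≈1 = too-many-roots (suc n) (x^n-1-leading n) 1#0 root distinct is-root
        where
        root : Fin (suc (suc n)) → Carrier
        root zero    = u
        root (suc i) = γ ^ toℕ i

        none′ : ∀ (i : Fin (suc n)) → ¬ u ≈ γ ^ toℕ i
        none′ i e = none (Fin.cast (≡.sym d≡) i , trans e (^-congʳ γ (≡.sym (Fin.toℕ-cast (≡.sym d≡) i))))

        ordered : ∀ (i j : Fin (suc n)) → toℕ i ℕ.< toℕ j → ¬ γ ^ toℕ i ≈ γ ^ toℕ j
        ordered i j i<j e = γ^≉1 (ℕ.m<n⇒0<n∸m i<j)
          (≡.subst (toℕ j ℕ.∸ toℕ i ℕ.<_) (≡.sym d≡) (ℕ.≤-<-trans (ℕ.m∸n≤m (toℕ j) (toℕ i)) (Fin.toℕ<n j)))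
          (x^i≈x^j⇒x^[j∸i]≈1 γ#0 (ℕ.<⇒≤ i<j) e)

        distinct : ∀ i j → i ≢ j → root i - root j # 0#
        distinct zero    zero    i≢j = contradiction ≡.refl i≢j
        distinct zero    (suc j) _   = ≉⇒-#0 (none′ j)
        distinct (suc i) zero    _   = ≉⇒-#0 (λ e → none′ i (sym e))
        distinct (suc i) (suc j) i≢j with ℕ.<-cmp (toℕ i) (toℕ j)
        ... | tri< i<j _ _ = ≉⇒-#0 (ordered i j i<j)
        ... | tri≈ _ i≡j _ = contradiction (≡.cong suc (Fin.toℕ-injective i≡j)) i≢j
        ... | tri> _ _ j<i = ≉⇒-#0 (λ e → ordered j i j<i (sym e))

        is-root : ∀ i → root i ^ suc n - 1# ≈ 0#
        is-root zero    = x≈y⇒x-y≈0 (≡.subst (λ d → u ^ d ≈ 1#) d≡ u^d≈1)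
        is-root (suc i) = x≈y⇒x-y≈0 (begin
          (γ ^ toℕ i) ^ suc n       ≈⟨ ^-assocʳ γ (toℕ i) (suc n) ⟩
          γ ^ (toℕ i ℕ.* suc n)     ≈⟨ ∣⇒^≈1 (suc n) (≡.subst (λ d → γ ^ d ≈ 1#) d≡ γ^order≈1) (divides (toℕ i) ≡.refl) ⟩
          1#                        ∎)

    u^coindex-power : ∀ {u} → u # 0# → ∃[ i ] u ^ coindex ≈ γ ^ i
    u^coindex-power {u} u#0 = u^order≈1⇒power (begin
      (u ^ coindex) ^ order       ≈⟨ ^-assocʳ u coindex order ⟩
      u ^ (coindex ℕ.* order)     ≡⟨ ≡.cong (u ^_) m*6≡coindex*order ⟨
      u ^ (m ℕ.* 6)               ≈⟨ u^[q-1]≈1 u#0 ⟩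
      1#                          ∎)

    -- With e the index and e² = 1 + 6k, the element u^(1 + 6k) = (u^e)^e is a power of γ. Dividing
    -- by the sixth power of w = u^k gives u.
    power-times-sixth : ∀ {u} → u # 0# → ∃[ j ] ∃[ s ] s # 0# × u ≈ γ ^ j * s ^ 6
    power-times-sixth {u} u#0 =
      let (i , u^e≈γ^i) = u^coindex-power u#0
          (k , e*e≡)    = coindex-square
          w = u ^ k
          w#0 = ^-#0 k u#0
      in i ℕ.* coindex , inv w , inv#0 w#0 , (begin
        u                                     ≈⟨ *-identityʳ u ⟨
        u * 1#                                ≈⟨ *-congˡ (trans (^-congˡ 6 (inv-inverseʳ w#0)) (1^n≈1 6)) ⟨
        u * (w * inv w) ^ 6                   ≈⟨ *-congˡ (^-distrib-* w (inv w) 6) ⟩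
        u * (w ^ 6 * inv w ^ 6)               ≈⟨ *-assoc _ _ _ ⟨
        u * w ^ 6 * inv w ^ 6                 ≈⟨ *-congʳ (*-congˡ (^-assocʳ u k 6)) ⟩
        u ^ (1 ℕ.+ k ℕ.* 6) * inv w ^ 6       ≡⟨ ≡.cong (λ n → u ^ n * inv w ^ 6) e*e≡ ⟨
        u ^ (coindex ℕ.* coindex) * inv w ^ 6 ≈⟨ *-congʳ (^-assocʳ u coindex coindex) ⟨
        (u ^ coindex) ^ coindex * inv w ^ 6   ≈⟨ *-congʳ (^-congˡ coindex u^e≈γ^i) ⟩
        (γ ^ i) ^ coindex * inv w ^ 6         ≈⟨ *-congʳ (^-assocʳ γ i coindex) ⟩
        γ ^ (i ℕ.* coindex) * inv w ^ 6       ∎)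

  opaque
    -- Multiplying `order` by the square 1 + 6k of the index gives `coindex * (m * 6)`, a multiple
    -- of 6. Since 6k times `order` is one too, 6 divides `order`.
    order/6 : ∃[ d ] order ≡ d ℕ.* 6 × m ≡ coindex ℕ.* d
    order/6 = d , order≡ , ℕ.*-cancelʳ-≡ m _ 6
        (≡.trans m*6≡coindex*order (≡.trans (≡.cong (coindex ℕ.*_) order≡) (≡.sym (ℕ.*-assoc coindex d 6))))
      where
      k : ℕ
      k = coindex-square .proj₁
      6∣order : 6 ∣ order
      6∣order = ℕ.∣m+n∣m⇒∣n
        (divides (coindex ℕ.* m) (≡.trans (ℕ.+-comm (k ℕ.* 6 ℕ.* order) order)
          (≡.trans (≡.cong (ℕ._* order) (≡.sym (coindex-square .proj₂)))
            (≡.trans (ℕ.*-assoc coindex coindex order) (≡.trans (≡.cong (coindex ℕ.*_) (≡.sym m*6≡coindex*order))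
              (≡.sym (ℕ.*-assoc coindex m 6)))))))
        (divides (k ℕ.* order) (ℕ-*.xy∙z≈xz∙y k 6 order))
      d : ℕ
      d = _∣_.quotient 6∣order
      order≡ : order ≡ d ℕ.* 6
      order≡ = _∣_.equality 6∣order

  opaque
    square-class : ∀ {u} → u # 0# → (∃[ v ] v # 0# × u ≈ v * v) ⊎ (∃[ v ] v # 0# × u ≈ γ * (v * v))
    square-class {u} u#0 with power-times-sixth u#0
    ... | j , s , s#0 , u≈ with halve j
    ...   | k , inj₁ ≡.refl = inj₁ (γ ^ k * s ^ 3 , x#0y#0→xy#0 (^-#0 k γ#0) (^-#0 3 s#0) , (begin
      u                                       ≈⟨ u≈ ⟩
      γ ^ (k ℕ.* 2) * s ^ 6                   ≈⟨ *-congʳ (^-assocʳ γ k 2) ⟨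
      (γ ^ k) ^ 2 * s ^ 6                     ≈⟨ solve 2 (λ a s → a :^ 2 :* s :^ 6 := (a :* s :^ 3) :* (a :* s :^ 3)) refl (γ ^ k) s ⟩
      γ ^ k * s ^ 3 * (γ ^ k * s ^ 3)         ∎))
    ...   | k , inj₂ ≡.refl = inj₂ (γ ^ k * s ^ 3 , x#0y#0→xy#0 (^-#0 k γ#0) (^-#0 3 s#0) , (begin
      u                                       ≈⟨ u≈ ⟩
      γ * γ ^ (k ℕ.* 2) * s ^ 6               ≈⟨ *-congʳ (*-congˡ (^-assocʳ γ k 2)) ⟨
      γ * (γ ^ k) ^ 2 * s ^ 6                 ≈⟨ solve 3 (λ g a s → g :* a :^ 2 :* s :^ 6 := g :* ((a :* s :^ 3) :* (a :* s :^ 3))) refl γ (γ ^ k) s ⟩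
      γ * (γ ^ k * s ^ 3 * (γ ^ k * s ^ 3))   ∎))

    cube-class : ∀ {u} → u # 0# → ∃[ v ] v # 0# × (u ≈ v ^ 3 ⊎ u ≈ γ ^ 1 * v ^ 3 ⊎ u ≈ γ ^ 2 * v ^ 3)
    cube-class {u} u#0 with power-times-sixth u#0
    ... | j , s , s#0 , u≈ with third j
    ...   | k , j≡ = γ ^ k * s ^ 2 , x#0y#0→xy#0 (^-#0 k γ#0) (^-#0 2 s#0) , class j≡
      where
      cube : γ ^ (k ℕ.* 3) * s ^ 6 ≈ (γ ^ k * s ^ 2) ^ 3
      cube = begin
        γ ^ (k ℕ.* 3) * s ^ 6        ≈⟨ *-congʳ (^-assocʳ γ k 3) ⟨
        (γ ^ k) ^ 3 * s ^ 6          ≈⟨ solve 2 (λ a s → a :^ 3 :* s :^ 6 := (a :* s :^ 2) :^ 3) refl (γ ^ k) s ⟩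
        (γ ^ k * s ^ 2) ^ 3          ∎

      split : ∀ i → u ≈ γ ^ (i ℕ.+ k ℕ.* 3) * s ^ 6 → u ≈ γ ^ i * (γ ^ k * s ^ 2) ^ 3
      split i e = begin
        u                                    ≈⟨ e ⟩
        γ ^ (i ℕ.+ k ℕ.* 3) * s ^ 6          ≈⟨ *-congʳ (^-homo-* γ i (k ℕ.* 3)) ⟩
        γ ^ i * γ ^ (k ℕ.* 3) * s ^ 6        ≈⟨ *-assoc _ _ _ ⟩
        γ ^ i * (γ ^ (k ℕ.* 3) * s ^ 6)      ≈⟨ *-congˡ cube ⟩
        γ ^ i * (γ ^ k * s ^ 2) ^ 3          ∎

      class : j ≡ k ℕ.* 3 ⊎ j ≡ 1 ℕ.+ k ℕ.* 3 ⊎ j ≡ 2 ℕ.+ k ℕ.* 3 →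
              u ≈ (γ ^ k * s ^ 2) ^ 3 ⊎ u ≈ γ ^ 1 * (γ ^ k * s ^ 2) ^ 3 ⊎ u ≈ γ ^ 2 * (γ ^ k * s ^ 2) ^ 3
      class (inj₁ ≡.refl) = inj₁ (trans u≈ cube)
      class (inj₂ (inj₁ ≡.refl)) = inj₂ (inj₁ (split 1 u≈))
      class (inj₂ (inj₂ ≡.refl)) = inj₂ (inj₂ (split 2 u≈))

  -- Euler's criterion: the power 3m = (q - 1)/2 sends nonzero squares to 1, but not γ.
  γ*square-nonsquare : ∀ {v y} → v # 0# → y # 0# → ¬ y * y ≈ γ * (v * v)
  γ*square-nonsquare {v} {y} v#0 y#0 y²≈γv² = γ^[m*3]≉1 (begin
    γ ^ (m ℕ.* 3)                          ≈⟨ *-identityʳ _ ⟨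
    γ ^ (m ℕ.* 3) * 1#                     ≈⟨ *-congˡ (square v#0) ⟨
    γ ^ (m ℕ.* 3) * (v * v) ^ (m ℕ.* 3)    ≈⟨ ^-distrib-* γ (v * v) (m ℕ.* 3) ⟨
    (γ * (v * v)) ^ (m ℕ.* 3)              ≈⟨ ^-congˡ (m ℕ.* 3) y²≈γv² ⟨
    (y * y) ^ (m ℕ.* 3)                    ≈⟨ square y#0 ⟩
    1#                                     ∎)
    where
    square : ∀ {x} → x # 0# → (x * x) ^ (m ℕ.* 3) ≈ 1#
    square {x} x#0 = begin
      (x * x) ^ (m ℕ.* 3)                ≈⟨ ^-distrib-* x x (m ℕ.* 3) ⟩
      x ^ (m ℕ.* 3) * x ^ (m ℕ.* 3)      ≈⟨ ^-homo-* x (m ℕ.* 3) (m ℕ.* 3) ⟨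
      x ^ (m ℕ.* 3 ℕ.+ m ℕ.* 3)          ≡⟨ ≡.cong (x ^_) (ℕ.*-distribˡ-+ m 3 3) ⟨
      x ^ (m ℕ.* 6)                      ≈⟨ u^[q-1]≈1 x#0 ⟩
      1#                                 ∎

-- Values of multiplicative characters

module CharacterValues {q c ℓ₁ ℓ₂ c′ ℓ₁′ ℓ₂′} (𝔽 : FiniteField q c ℓ₁ ℓ₂) (𝕂 : AlgClosedField₀ c′ ℓ₁′ ℓ₂′) where
  private
    module F where
      open FiniteField 𝔽 public
      open FiniteFieldProperties 𝔽 public
  open FieldOps (AlgClosedField₀.heytingField 𝕂) hiding (zero)
  open FieldProperties (AlgClosedField₀.heytingField 𝕂)
  open Characters 𝔽 𝕂
  open GroupHomomorphism using (⟦_⟧; homo; ⟦⟧-cong; ε-homo)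
  open SetoidReasoning setoid

  -- Opaque, because ⟨_⟩ unfolds to the decision procedure unit?, which is expensive to compare.
  infix 9 _⟪_⟫
  opaque
    _⟪_⟫ : Character → F.Carrier → Carrier
    χ ⟪ x ⟫ = χ ⟨ x ⟩

    ⟪⟫≡⟨⟩ : ∀ χ x → χ ⟪ x ⟫ ≡ χ ⟨ x ⟩
    ⟪⟫≡⟨⟩ χ x = ≡.refl

    ⟪⟫-unit : ∀ χ {x} (x#0 : x F.# F.0#) → χ ⟪ x ⟫ ≈ proj₁ (⟦ χ ⟧ (x , x#0))
    ⟪⟫-unit χ {x} x#0 with F.unit? x
    ... | yes _ = ⟦⟧-cong χ F.refl
    ... | no ¬p = contradiction x#0 ¬p

    ⟪⟫-0 : ∀ χ {x} → x F.≈ F.0# → χ ⟪ x ⟫ ≈ 0#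
    ⟪⟫-0 χ {x} x≈0 with F.unit? x
    ... | yes x#0 = contradiction x≈0 (F.#⇒≉ x#0)
    ... | no  _   = refl

  ⟪⟫-cong : ∀ χ {x y} → x F.≈ y → χ ⟪ x ⟫ ≈ χ ⟪ y ⟫
  ⟪⟫-cong χ {x} {y} x≈y with F.0-or-#0 x
  ... | inj₁ x≈0 = trans (⟪⟫-0 χ x≈0) (sym (⟪⟫-0 χ (F.trans (F.sym x≈y) x≈0)))
  ... | inj₂ x#0 = trans (⟪⟫-unit χ x#0)
                     (trans (⟦⟧-cong χ x≈y) (sym (⟪⟫-unit χ (F.≈-resp-#0 x≈y x#0))))

  ⟪⟫-1 : ∀ χ → χ ⟪ F.1# ⟫ ≈ 1#
  ⟪⟫-1 χ = trans (⟪⟫-unit χ F.1#0) (ε-homo χ)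

  ⟪⟫-* : ∀ χ x y → χ ⟪ x F.* y ⟫ ≈ χ ⟪ x ⟫ * χ ⟪ y ⟫
  ⟪⟫-* χ x y with F.0-or-#0 x | F.0-or-#0 y
  ... | inj₁ x≈0 | _ = trans (⟪⟫-0 χ (F.trans (F.*-congʳ x≈0) (F.zeroˡ y)))
                         (sym (trans (*-congʳ (⟪⟫-0 χ x≈0)) (zeroˡ _)))
  ... | inj₂ _   | inj₁ y≈0 = trans (⟪⟫-0 χ (F.trans (F.*-congˡ y≈0) (F.zeroʳ x)))
                         (sym (trans (*-congˡ (⟪⟫-0 χ y≈0)) (zeroʳ _)))
  ... | inj₂ x#0 | inj₂ y#0 = trans (⟪⟫-unit χ (F.x#0y#0→xy#0 x#0 y#0))
    (trans (homo χ (x , x#0) (y , y#0)) (sym (*-cong (⟪⟫-unit χ x#0) (⟪⟫-unit χ y#0))))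

  ⟪⟫-^ : ∀ χ x n → χ ⟪ x F.^ n ⟫ ≈ χ ⟪ x ⟫ ^ n
  ⟪⟫-^ χ x zero    = ⟪⟫-1 χ
  ⟪⟫-^ χ x (suc n) = trans (⟪⟫-* χ x (x F.^ n)) (*-congˡ (⟪⟫-^ χ x n))

  ^ᶻ-⟦⟧ : ∀ χ n u → proj₁ (⟦ χ ^ᶻ + n ⟧ u) ≈ proj₁ (⟦ χ ⟧ u) ^ n
  ^ᶻ-⟦⟧ χ zero    u = refl
  ^ᶻ-⟦⟧ χ (suc n) u = *-congˡ {proj₁ (⟦ χ ⟧ u)} {proj₁ (⟦ χ ^ᶻ + n ⟧ u)} {proj₁ (⟦ χ ⟧ u) ^ n} (^ᶻ-⟦⟧ χ n u)

  ^ᶻ-⟪⟫ : ∀ χ n {x} → x F.# F.0# → (χ ^ᶻ + n) ⟪ x ⟫ ≈ χ ⟪ x ⟫ ^ n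
  ^ᶻ-⟪⟫ χ n {x} x#0 = trans (⟪⟫-unit (χ ^ᶻ + n) x#0)
    (trans (^ᶻ-⟦⟧ χ n (x , x#0)) (^-congˡ n (sym (⟪⟫-unit χ x#0))))

  -- Negative exponents are covered because a generator of the character group yields integer
  -- exponents.
  ^ᶻ-⟦⟧-torsion : ∀ χ k n u → proj₁ (⟦ χ ⟧ u) ^ n ≈ 1# → proj₁ (⟦ χ ^ᶻ k ⟧ u) ^ n ≈ 1#
  ^ᶻ-⟦⟧-torsion χ (+ k) n u χu^n≈1 =
    trans (^-congˡ n (^ᶻ-⟦⟧ χ k u)) (trans (^-assocʳ _ k n) (∣⇒^≈1 n χu^n≈1 (divides k ≡.refl)))
  ^ᶻ-⟦⟧-torsion χ -[1+ k ] n u χu^n≈1 = recip-torsion (proj₂ (⟦ χ ^ᶻ (+ suc k) ⟧ u)) (^ᶻ-⟦⟧-torsion χ (+ suc k) n u χu^n≈1)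
    where
    recip-torsion : ∀ {z} (z#0 : z # 0#) → z ^ n ≈ 1# → recip z#0 ^ n ≈ 1#
    recip-torsion {z} z#0 z^n≈1 = begin
      recip z#0 ^ n              ≈⟨ *-identityʳ _ ⟨
      recip z#0 ^ n * 1#         ≈⟨ *-congˡ z^n≈1 ⟨
      recip z#0 ^ n * z ^ n      ≈⟨ ^-distrib-* (recip z#0) z n ⟨
      (recip z#0 * z) ^ n        ≈⟨ ^-congˡ n (recip-inverseˡ z#0) ⟩
      1# ^ n                     ≈⟨ 1^n≈1 n ⟩
      1#                         ∎

  ^ᶻ-⟪⟫-torsion : ∀ χ k n {x} → x F.# F.0# → χ ⟪ x ⟫ ^ n ≈ 1# → (χ ^ᶻ k) ⟪ x ⟫ ^ n ≈ 1#
  ^ᶻ-⟪⟫-torsion χ k n {x} x#0 χx^n≈1 = trans (^-congˡ n (⟪⟫-unit (χ ^ᶻ k) x#0))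
    (^ᶻ-⟦⟧-torsion χ k n (x , x#0) (trans (^-congˡ n (sym (⟪⟫-unit χ x#0))) χx^n≈1))

  -- The value may be computed from the proof of `x # 0#`, as the discrete logarithm in `sexticLift`
  -- is. Hence congruence and multiplicativity are required for arbitrary such proofs.
  character : (f : ∀ {x} → x F.# F.0# → Carrier) → (∀ {x} (x#0 : x F.# F.0#) → f x#0 # 0#) →
              (∀ {x y} (x#0 : x F.# F.0#) (y#0 : y F.# F.0#) → x F.≈ y → f x#0 ≈ f y#0) →
              (∀ {x y} (x#0 : x F.# F.0#) (y#0 : y F.# F.0#) (xy#0 : x F.* y F.# F.0#) →
                 f xy#0 ≈ f x#0 * f y#0) →
              Character
  character f f#0 f-cong f-* = record
    { ⟦_⟧ = λ (x , x#0) → f x#0 , f#0 x#0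
    ; isGroupHomomorphism = record
      { isMonoidHomomorphism = record
        { isMagmaHomomorphism = record
          { isRelHomomorphism = record { cong = λ {x} {y} → f-cong (proj₂ x) (proj₂ y) }
          ; homo = λ x y → f-* (proj₂ x) (proj₂ y) _
          }
        ; ε-homo = f1≈1
        }
      ; ⁻¹-homo = λ (x , x#0) → inverseˡ-unique (_ , f#0 (F.recip#0 x#0)) (_ , f#0 x#0)
          (trans (sym (f-* (F.recip#0 x#0) x#0 (F.x#0y#0→xy#0 (F.recip#0 x#0) x#0)))
                 (trans (f-cong _ F.1#0 (F.recip-inverseˡ x#0)) f1≈1))
      }
    }
    where
    open GroupProperties (AbelianGroup.group units) using (inverseˡ-unique)
    f1≈1 : f F.1#0 ≈ 1#
    f1≈1 = *-cancelˡ-#0 (f#0 F.1#0) (begin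
      f F.1#0 * f F.1#0    ≈⟨ f-* F.1#0 F.1#0 (F.x#0y#0→xy#0 F.1#0 F.1#0) ⟨
      f (F.x#0y#0→xy#0 F.1#0 F.1#0)   ≈⟨ f-cong _ F.1#0 (F.*-identityˡ F.1#) ⟩
      f F.1#0              ≈⟨ *-identityʳ _ ⟨
      f F.1#0 * 1#         ∎)

-- Roots in the algebraically closed field

module Roots {c ℓ₁ ℓ₂} (𝕂 : AlgClosedField₀ c ℓ₁ ℓ₂) where
  open AlgClosedField₀ 𝕂 using (heytingField; algClosed)
  open FieldOps heytingField hiding (zero)
  open FieldProperties heytingField
  open SetoidReasoning setoid

  opaque
    sixth-root-of-unity : ∃[ ξ ] ξ ^ 2 - ξ + 1# ≈ 0#
    sixth-root-of-unity = let (ξ , e) = algClosed 1 coefficient in ξ ,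
      trans (solve 1 (λ x → x :^ 2 :- x :+ con (+ 1) :=
               x :^ 2 :+ (con (+ 1) :* con (+ 1) :+ ((:- con (+ 1)) :* x :^ 1 :+ con (+ 0)))) refl ξ) e
      where
      coefficient : Fin 2 → Carrier
      coefficient zero    = 1#
      coefficient (suc _) = - 1#

    root : ∀ n .{{_ : NonZero n}} a → ∃[ z ] z ^ n ≈ a
    root (suc n) a = let (z , e) = algClosed n coefficient in z , x-y≈0⇒x≈y _ _ (begin
      z ^ suc n - a                               ≈⟨ +-congˡ (trans (sym (*-identityʳ _)) (sym (+-identityʳ _))) ⟩
      z ^ suc n + (- a * 1# + 0#)                 ≈⟨ +-congˡ (+-congˡ (sum-zero n (λ i → zeroˡ _))) ⟨
      z ^ suc n + sum (λ i → coefficient i * z ^ toℕ i)  ≈⟨ e ⟩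
      0#                                          ∎)
      where
      coefficient : Fin (suc n) → Carrier
      coefficient zero    = - a
      coefficient (suc _) = 0#

      sum-zero : ∀ k {t : Vector Carrier k} → (∀ i → t i ≈ 0#) → sum t ≈ 0#
      sum-zero zero    t≈0 = refl
      sum-zero (suc k) t≈0 = trans (+-cong (t≈0 zero) (sum-zero k (t≈0 ∘ suc))) (+-identityʳ 0#)

-- Interface of a character of order six, and values of the quadratic character

module _ {q c ℓ₁ ℓ₂ c′ ℓ₁′ ℓ₂′} (𝔽 : FiniteField q c ℓ₁ ℓ₂) (𝕂 : AlgClosedField₀ c′ ℓ₁′ ℓ₂′) where
  private
    module F where
      open FiniteField 𝔽 public
      open FiniteFieldProperties 𝔽 public
  open FieldOps (AlgClosedField₀.heytingField 𝕂) hiding (zero)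
  open Characters 𝔽 𝕂

  -- χ and χ̄ are the values, extended by 0, of a character and its inverse.
  record IsSexticCharacter (χ χ̄ : F.Carrier → Carrier) : Set (c ⊔ ℓ₁ ⊔ ℓ₂ ⊔ ℓ₁′ ⊔ ℓ₂′) where
    field
      χ-cong  : ∀ {x y} → x F.≈ y → χ x ≈ χ y
      χ̄-cong  : ∀ {x y} → x F.≈ y → χ̄ x ≈ χ̄ y
      χ-*     : ∀ x y → χ (x F.* y) ≈ χ x * χ y
      χ̄-*     : ∀ x y → χ̄ (x F.* y) ≈ χ̄ x * χ̄ y
      χ-0     : ∀ {x} → x F.≈ F.0# → χ x ≈ 0#
      χ̄-0     : ∀ {x} → x F.≈ F.0# → χ̄ x ≈ 0#
      χ*χ̄≈1   : ∀ {x} → x F.# F.0# → χ x * χ̄ x ≈ 1#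
      χ̄⁶≈1    : ∀ {x} → x F.# F.0# → χ̄ x ^ 6 ≈ 1#
      φ≈χ³    : ∀ x → φ x ≈ χ x ^ 3
      noncube : ∀ {x} → x F.# F.0# → ¬ (∃[ s ] s F.^ 3 F.≈ x) → 1# + χ̄ x ^ 2 + χ̄ x ^ 4 ≈ 0#
      γ       : F.Carrier
      γ#0     : γ F.# F.0#
      Φ₆[χγ]  : χ γ ^ 2 - χ γ + 1# ≈ 0#

module QuadraticCharacter {q c ℓ₁ ℓ₂ c′ ℓ₁′ ℓ₂′} (𝔽 : FiniteField q c ℓ₁ ℓ₂) (𝕂 : AlgClosedField₀ c′ ℓ₁′ ℓ₂′) where
  private
    module F where
      open FiniteField 𝔽 public
      open FiniteFieldProperties 𝔽 public
  open FieldOps (AlgClosedField₀.heytingField 𝕂) hiding (zero)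
  open Characters 𝔽 𝕂 using (φ)

  φ-square : ∀ {x} → x F.# F.0# → ∃[ y ] y F.* y F.≈ x → φ x ≈ 1#
  φ-square {x} x#0 sq with F.unit? x | F.square? x
  ... | no ¬x#0 | _      = contradiction x#0 ¬x#0
  ... | yes _   | yes _  = refl
  ... | yes _   | no ¬sq = contradiction sq ¬sq

  φ-nonsquare : ∀ {x} → x F.# F.0# → ¬ (∃[ y ] y F.* y F.≈ x) → φ x ≈ - 1#
  φ-nonsquare {x} x#0 ¬sq with F.unit? x | F.square? x
  ... | no ¬x#0 | _      = contradiction x#0 ¬x#0
  ... | yes _   | yes sq = contradiction sq ¬sq
  ... | yes _   | no _   = refl

  φ-0 : ∀ {x} → x F.≈ F.0# → φ x ≈ 0#
  φ-0 {x} x≈0 with F.unit? x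
  ... | yes x#0 = contradiction x≈0 (F.#⇒≉ x#0)
  ... | no  _   = refl

-- The power of T of order six

module SexticCharacters {q c ℓ₁ ℓ₂ c′ ℓ₁′ ℓ₂′} (𝔽 : FiniteField q c ℓ₁ ℓ₂) (𝕂 : AlgClosedField₀ c′ ℓ₁′ ℓ₂′)
                        (m : ℕ) (q≡ : q ≡ suc (m ℕ.* 6)) where
  private
    module F where
      open FiniteField 𝔽 public
      open SexticGenerator 𝔽 m q≡ public
      open FiniteFieldProperties 𝔽 public
  open AlgClosedField₀ 𝕂 using (charZero)
  open FieldOps (AlgClosedField₀.heytingField 𝕂) hiding (zero)
  open FieldProperties (AlgClosedField₀.heytingField 𝕂)
  open Roots 𝕂
  open Characters 𝔽 𝕂
  open CharacterValues 𝔽 𝕂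
  open QuadraticCharacter 𝔽 𝕂
  open SetoidReasoning setoid

  2#0 : nat 2 # 0#
  2#0 = ≈-resp-#0 (trans (×ⁿ≈nat* 2 1#) (*-identityʳ _)) (charZero 2)

  3#0 : nat 3 # 0#
  3#0 = ≈-resp-#0 (trans (×ⁿ≈nat* 3 1#) (*-identityʳ _)) (charZero 3)

  Φ₆⇒^3 : ∀ {x} → x ^ 2 - x + 1# ≈ 0# → x ^ 3 ≈ - 1#
  Φ₆⇒^3 {x} e = begin
    x ^ 3                            ≈⟨ solve 1 (λ x → x :^ 3 := (x :+ con (+ 1)) :* (x :^ 2 :- x :+ con (+ 1)) :- con (+ 1)) refl x ⟩
    (x + 1#) * (x ^ 2 - x + 1#) - 1# ≈⟨ +-congʳ (trans (*-congˡ e) (zeroʳ _)) ⟩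
    0# - 1#                          ≈⟨ +-identityˡ _ ⟩
    - 1#                             ∎

  ^3≈-1⇒^6≈1 : ∀ {x} → x ^ 3 ≈ - 1# → x ^ 6 ≈ 1#
  ^3≈-1⇒^6≈1 {x} e = begin
    x ^ 6            ≈⟨ solve 1 (λ x → x :^ 6 := x :^ 3 :* x :^ 3) refl x ⟩
    x ^ 3 * x ^ 3    ≈⟨ *-cong e e ⟩
    - 1# * - 1#      ≈⟨ solve 0 ((:- con (+ 1)) :* (:- con (+ 1)) := con (+ 1)) refl ⟩
    1#               ∎

  Φ₆⇒^3≉1 : ∀ {x} → x ^ 2 - x + 1# ≈ 0# → ¬ x ^ 3 ≈ 1#
  Φ₆⇒^3≉1 {x} e x³≈1 = #⇒≉ 2#0 (begin
    nat 2        ≈⟨ solve 0 (con (+ 2) := con (+ 1) :- (:- con (+ 1))) refl ⟩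
    1# - (- 1#)  ≈⟨ x≈y⇒x-y≈0 (trans (sym x³≈1) (Φ₆⇒^3 e)) ⟩
    0#           ∎)

  Φ₆⇒^2≉1 : ∀ {x} → x ^ 2 - x + 1# ≈ 0# → ¬ x ^ 2 ≈ 1#
  Φ₆⇒^2≉1 {x} e x²≈1 = #⇒≉ 3#0 (begin
    nat 3
      ≈⟨ solve 1 (λ r → con (+ 3) := (r :^ 2 :- r :+ con (+ 1)) :* (con (+ 2) :+ r) :- (r :^ 2 :- con (+ 1)) :* (con (+ 1) :+ r)) refl x ⟩
    (x ^ 2 - x + 1#) * (nat 2 + x) - (x ^ 2 - 1#) * (1# + x)
      ≈⟨ +-cong (*-congʳ e) (-‿cong (*-congʳ (x≈y⇒x-y≈0 x²≈1))) ⟩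
    0# * (nat 2 + x) - 0# * (1# + x)
      ≈⟨ solve 1 (λ r → con (+ 0) :* (con (+ 2) :+ r) :- con (+ 0) :* (con (+ 1) :+ r) := con (+ 0)) refl x ⟩
    0#           ∎)

  -- X² - X + 1 is palindromic: y² times its value at x is its value at y, up to a multiple of 1 - x
  -- y.
  Φ₆-inverse : ∀ {x y} → x * y ≈ 1# → x ^ 2 - x + 1# ≈ 0# → y ^ 2 - y + 1# ≈ 0#
  Φ₆-inverse {x} {y} xy≈1 e = begin
    y ^ 2 - y + 1#
      ≈⟨ solve 2 (λ t b → b :^ 2 :- b :+ con (+ 1) := b :^ 2 :* (t :^ 2 :- t :+ con (+ 1))
           :+ (con (+ 1) :- t :* b) :* (con (+ 1) :+ t :* b :- b)) refl x y ⟩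
    y ^ 2 * (x ^ 2 - x + 1#) + (1# - x * y) * (1# + x * y - y)
      ≈⟨ +-cong (*-congˡ e) (*-congʳ (x≈y⇒x-y≈0 (sym xy≈1))) ⟩
    y ^ 2 * 0# + 0# * (1# + x * y - y)
      ≈⟨ trans (+-cong (zeroʳ _) (zeroˡ _)) (+-identityʳ 0#) ⟩
    0# ∎

  -- Here and in `Φ₆-sum₂`, `y` is the character value at γ and `z` that at a unit in the class of γ
  -- or γ² modulo cubes. The reason is that X² - X + 1 divides both X⁴ + X² + 1 and X⁸ + X⁴ + 1.
  Φ₆-sum₁ : ∀ {y z} → y ^ 2 - y + 1# ≈ 0# → z ^ 2 ≈ (y ^ 1) ^ 2 → 1# + z ^ 2 + z ^ 4 ≈ 0#
  Φ₆-sum₁ {y} {z} e z²≈ = begin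
    1# + z ^ 2 + z ^ 4
      ≈⟨ solve 1 (λ z → con (+ 1) :+ z :^ 2 :+ z :^ 4 := con (+ 1) :+ z :^ 2 :+ (z :^ 2) :^ 2) refl z ⟩
    1# + z ^ 2 + (z ^ 2) ^ 2              ≈⟨ +-cong (+-congˡ z²≈) (^-congˡ 2 z²≈) ⟩
    1# + (y ^ 1) ^ 2 + ((y ^ 1) ^ 2) ^ 2
      ≈⟨ solve 1 (λ b → con (+ 1) :+ (b :^ 1) :^ 2 :+ ((b :^ 1) :^ 2) :^ 2
           := (b :^ 2 :- b :+ con (+ 1)) :* (b :^ 2 :+ b :+ con (+ 1))) refl y ⟩
    (y ^ 2 - y + 1#) * (y ^ 2 + y + 1#)   ≈⟨ trans (*-congʳ e) (zeroˡ _) ⟩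
    0#                                    ∎

  Φ₆-sum₂ : ∀ {y z} → y ^ 2 - y + 1# ≈ 0# → z ^ 2 ≈ (y ^ 2) ^ 2 → 1# + z ^ 2 + z ^ 4 ≈ 0#
  Φ₆-sum₂ {y} {z} e z²≈ = begin
    1# + z ^ 2 + z ^ 4
      ≈⟨ solve 1 (λ z → con (+ 1) :+ z :^ 2 :+ z :^ 4 := con (+ 1) :+ z :^ 2 :+ (z :^ 2) :^ 2) refl z ⟩
    1# + z ^ 2 + (z ^ 2) ^ 2              ≈⟨ +-cong (+-congˡ z²≈) (^-congˡ 2 z²≈) ⟩
    1# + (y ^ 2) ^ 2 + ((y ^ 2) ^ 2) ^ 2
      ≈⟨ solve 1 (λ b → con (+ 1) :+ (b :^ 2) :^ 2 :+ ((b :^ 2) :^ 2) :^ 2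
           := (b :^ 2 :- b :+ con (+ 1)) :* ((b :^ 2 :+ b :+ con (+ 1)) :* (b :^ 4 :- b :^ 2 :+ con (+ 1)))) refl y ⟩
    (y ^ 2 - y + 1#) * ((y ^ 2 + y + 1#) * (y ^ 4 - y ^ 2 + 1#))   ≈⟨ trans (*-congʳ e) (zeroˡ _) ⟩
    0#                                    ∎

  -- Equality in 𝕂 is not decidable; a Bézout combination apart from 0 shows that one of the
  -- two factors of a vanishing product is apart from 0.
  coprime-factor : ∀ {a b} s t → a * s + b * t # 0# → a * b ≈ 0# → ¬ a ≈ 0# → b ≈ 0#
  coprime-factor s t as+bt#0 ab≈0 a≉0 with +#0⇒#0 as+bt#0
  ... | inj₁ as#0 = xy≈0⇒y≈0 (xy#0⇒x#0 as#0) ab≈0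
  ... | inj₂ bt#0 = contradiction (xy≈0⇒y≈0 (xy#0⇒x#0 bt#0) (trans (*-comm _ _) ab≈0)) a≉0

  -- X⁶ - 1 is (X³ - 1)(X³ + 1), and X³ + 1 is (X + 1)(X² - X + 1). The first pair of factors
  -- combines to 2 and the second to 3, so `coprime-factor` removes X³ - 1 and then X + 1; a root of
  -- the latter would have square 1.
  sixth-root-primitive : ∀ {x} → x ^ 6 ≈ 1# → ¬ x ^ 3 ≈ 1# → ¬ x ^ 2 ≈ 1# → x ^ 2 - x + 1# ≈ 0#
  sixth-root-primitive {x} x⁶≈1 x³≉1 x²≉1 =
    coprime-factor {x + 1#} (nat 2 - x) 1#
      (≈-resp-#0 (solve 1 (λ x → con (+ 3) := (x :+ con (+ 1)) :* (con (+ 2) :- x) :+ (x :^ 2 :- x :+ con (+ 1)) :* con (+ 1)) refl x) 3#0)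
      (trans (solve 1 (λ x → (x :+ con (+ 1)) :* (x :^ 2 :- x :+ con (+ 1)) := x :^ 3 :+ con (+ 1)) refl x) x³+1≈0)
      (λ x+1≈0 → x²≉1 (x-y≈0⇒x≈y _ _ (trans
        (solve 1 (λ x → x :^ 2 :- con (+ 1) := (x :+ con (+ 1)) :* (x :- con (+ 1))) refl x)
        (trans (*-congʳ x+1≈0) (zeroˡ _)))))
    where
    x³+1≈0 : x ^ 3 + 1# ≈ 0#
    x³+1≈0 = coprime-factor {x ^ 3 - 1#} (- 1#) 1#
      (≈-resp-#0 (solve 1 (λ x → con (+ 2) := (x :^ 3 :- con (+ 1)) :* (:- con (+ 1)) :+ (x :^ 3 :+ con (+ 1)) :* con (+ 1)) refl x) 2#0)
      (trans (solve 1 (λ x → (x :^ 3 :- con (+ 1)) :* (x :^ 3 :+ con (+ 1)) := x :^ 6 :- con (+ 1)) refl x) (x≈y⇒x-y≈0 x⁶≈1))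
      (λ e → x³≉1 (x-y≈0⇒x≈y _ _ e))

  -- The character of 𝔽ˣ lifting the sixth root of unity: u ^ coindex is a power γ ^ i, and u is
  -- sent to ζ ^ i.
  opaque
    sexticLift : ∃[ ψ ] (ψ ⟪ F.γ ⟫ ^ m) ^ 2 - ψ ⟪ F.γ ⟫ ^ m + 1# ≈ 0#
    sexticLift = ψ , trans (+-congʳ (+-cong (^-congˡ 2 ψγ^m≈ξ) (-‿cong ψγ^m≈ξ))) Φ₆[ξ]
      where
      e : ℕ
      e = F.coindex

      d : ℕ
      d = F.order/6 .proj₁

      order≡ : F.order ≡ d ℕ.* 6
      order≡ = F.order/6 .proj₂ .proj₁

      m≡ : m ≡ e ℕ.* d
      m≡ = F.order/6 .proj₂ .proj₂

      ξ : Carrier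
      ξ = sixth-root-of-unity .proj₁

      Φ₆[ξ] : ξ ^ 2 - ξ + 1# ≈ 0#
      Φ₆[ξ] = sixth-root-of-unity .proj₂

      ξ⁶≈1 : ξ ^ 6 ≈ 1#
      ξ⁶≈1 = ^3≈-1⇒^6≈1 (Φ₆⇒^3 Φ₆[ξ])

      instance
        d-nonZero : NonZero d
        d-nonZero = ℕ.≢-nonZero λ d≡0 → ℕ.<⇒≢ F.order>0 (≡.sym (≡.trans order≡ (≡.cong (ℕ._* 6) d≡0)))

      -- With d = order/6, the power `ζ ^ order` is ξ⁶ = 1. Hence `ζ ^ i` depends only on `γ ^ i`,
      -- and the character below is well defined.
      ζ : Carrier
      ζ = root d ξ .proj₁

      ζ^d≈ξ : ζ ^ d ≈ ξ
      ζ^d≈ξ = root d ξ .proj₂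

      ζ^order≈1 : ζ ^ F.order ≈ 1#
      ζ^order≈1 = begin
        ζ ^ F.order       ≡⟨ ≡.cong (ζ ^_) order≡ ⟩
        ζ ^ (d ℕ.* 6)     ≈⟨ ^-assocʳ ζ d 6 ⟨
        (ζ ^ d) ^ 6       ≈⟨ ^-congˡ 6 ζ^d≈ξ ⟩
        ξ ^ 6             ≈⟨ ξ⁶≈1 ⟩
        1#                ∎

      ζ#0 : ζ # 0#
      ζ#0 = power#0 F.order F.order>0 ζ^order≈1
        where
        power#0 : ∀ n → 0 ℕ.< n → ζ ^ n ≈ 1# → ζ # 0#
        power#0 (suc n) _ e = invertible⇒#0 (ζ ^ n) (trans (*-comm _ _) e)

      transfer-≤ : ∀ {i j} → i ℕ.≤ j → F.γ F.^ i F.≈ F.γ F.^ j → ζ ^ i ≈ ζ ^ j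
      transfer-≤ {i} {j} i≤j e = sym (trans (^-∸ {i = i} {j} ζ#0 i≤j) (trans
        (*-congˡ (∣⇒^≈1 F.order {j ℕ.∸ i} ζ^order≈1 (F.order-∣ (F.x^i≈x^j⇒x^[j∸i]≈1 {i = i} {j} F.γ#0 i≤j e))))
        (*-identityʳ _)))

      transfer : ∀ {i j} → F.γ F.^ i F.≈ F.γ F.^ j → ζ ^ i ≈ ζ ^ j
      transfer {i} {j} e with ℕ.≤-total i j
      ... | inj₁ i≤j = transfer-≤ {i} {j} i≤j e
      ... | inj₂ j≤i = sym (transfer-≤ {j} {i} j≤i (F.sym e))

      log : ∀ {u} → u F.# F.0# → ℕ
      log u#0 = F.u^coindex-power u#0 .proj₁

      u^e≈γ^log : ∀ {u} (u#0 : u F.# F.0#) → u F.^ e F.≈ F.γ F.^ log u#0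
      u^e≈γ^log u#0 = F.u^coindex-power u#0 .proj₂

      ψ : Character
      ψ = character (λ u#0 → ζ ^ log u#0) (λ u#0 → ^-#0 (log u#0) ζ#0)
        (λ u#0 v#0 u≈v → transfer {log u#0} {log v#0}
          (F.trans (F.sym (u^e≈γ^log u#0)) (F.trans (F.^-congˡ e u≈v) (u^e≈γ^log v#0))))
        (λ {u} {v} u#0 v#0 uv#0 → trans
          (transfer {log uv#0} {log u#0 ℕ.+ log v#0}
            (F.trans (F.sym (u^e≈γ^log uv#0)) (F.trans (F.^-distrib-* u v e)
              (F.trans (F.*-cong (u^e≈γ^log u#0) (u^e≈γ^log v#0)) (F.sym (F.^-homo-* F.γ (log u#0) (log v#0)))))))
          (^-homo-* ζ (log u#0) (log v#0)))

      -- The logarithm of γ counts as e, since γ is first raised to the power e. As m = e d, the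
      -- value is ξ^(e²), and e² is 1 modulo 6.
      ψγ^m≈ξ : ψ ⟪ F.γ ⟫ ^ m ≈ ξ
      ψγ^m≈ξ = begin
        ψ ⟪ F.γ ⟫ ^ m              ≈⟨ ^-congˡ m (trans (⟪⟫-unit ψ F.γ#0) (transfer {log F.γ#0} {e} (F.sym (u^e≈γ^log F.γ#0)))) ⟩
        (ζ ^ e) ^ m                ≈⟨ ^-assocʳ ζ e m ⟩
        ζ ^ (e ℕ.* m)              ≡⟨ ≡.cong (ζ ^_) (≡.trans (≡.cong (e ℕ.*_) m≡)
                                        (≡.trans (≡.sym (ℕ.*-assoc e e d)) (ℕ.*-comm (e ℕ.* e) d))) ⟩
        ζ ^ (d ℕ.* (e ℕ.* e))      ≈⟨ ^-assocʳ ζ d (e ℕ.* e) ⟨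
        (ζ ^ d) ^ (e ℕ.* e)        ≈⟨ ^-congˡ (e ℕ.* e) ζ^d≈ξ ⟩
        ξ ^ (e ℕ.* e)              ≡⟨ ≡.cong (ξ ^_) (F.coindex-square .proj₂) ⟩
        ξ * ξ ^ (k ℕ.* 6)          ≈⟨ *-congˡ (∣⇒^≈1 6 ξ⁶≈1 (divides k ≡.refl)) ⟩
        ξ * 1#                     ≈⟨ *-identityʳ ξ ⟩
        ξ                          ∎
        where
        k : ℕ
        k = F.coindex-square .proj₁

  module _ (T : Character) (T-generates : IsGenerator T) where
    private
      t = T ⟪ F.γ ⟫
      χ = T ^ᶻ + m
      χ̄ = T ^ᶻ + (5 ℕ.* m)
      τ = χ ⟪ F.γ ⟫

    T^[m*6]≈1 : ∀ {u} → u F.# F.0# → T ⟪ u ⟫ ^ (m ℕ.* 6) ≈ 1#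
    T^[m*6]≈1 {u} u#0 = trans (sym (⟪⟫-^ T u (m ℕ.* 6))) (trans (⟪⟫-cong T (F.u^[q-1]≈1 u#0)) (⟪⟫-1 T))

    χ⁶≈1 : ∀ {u} → u F.# F.0# → χ ⟪ u ⟫ ^ 6 ≈ 1#
    χ⁶≈1 u#0 = trans (^-congˡ 6 (^ᶻ-⟪⟫ T m u#0)) (trans (^-assocʳ _ m 6) (T^[m*6]≈1 u#0))

    -- Here the generator hypothesis enters: the lifted character ψ is a power of T, so ψ(γ)^m is a
    -- power of τ. As it is a primitive sixth root of unity, neither τ³ nor τ² can be 1.
    Φ₆[τ] : τ ^ 2 - τ + 1# ≈ 0#
    Φ₆[τ] = sixth-root-primitive (χ⁶≈1 F.γ#0) (λ e → Φ₆⇒^3≉1 Φ₆ψ (ψ-torsion 3 e)) (λ e → Φ₆⇒^2≉1 Φ₆ψ (ψ-torsion 2 e))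
      where
      ψ = sexticLift .proj₁
      Φ₆ψ = sexticLift .proj₂
      k = T-generates ψ .proj₁

      ψ-torsion : ∀ n → τ ^ n ≈ 1# → (ψ ⟪ F.γ ⟫ ^ m) ^ n ≈ 1#
      ψ-torsion n τ^n≈1 = begin
        (ψ ⟪ F.γ ⟫ ^ m) ^ n            ≈⟨ ^-assocʳ _ m n ⟩
        ψ ⟪ F.γ ⟫ ^ (m ℕ.* n)          ≈⟨ ^-congˡ (m ℕ.* n) ψ≈T^k ⟩
        (T ^ᶻ k) ⟪ F.γ ⟫ ^ (m ℕ.* n)   ≈⟨ ^ᶻ-⟪⟫-torsion T k (m ℕ.* n) F.γ#0
                                           (trans (sym (^-assocʳ t m n)) (trans (^-congˡ n (sym (^ᶻ-⟪⟫ T m F.γ#0))) τ^n≈1)) ⟩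
        1#                             ∎
        where
        ψ≈T^k : ψ ⟪ F.γ ⟫ ≈ (T ^ᶻ k) ⟪ F.γ ⟫
        ψ≈T^k = trans (⟪⟫-unit ψ F.γ#0) (trans (T-generates ψ .proj₂ (F.γ , F.γ#0)) (sym (⟪⟫-unit (T ^ᶻ k) F.γ#0)))

    χ*χ̄≈1 : ∀ {x} → x F.# F.0# → χ ⟪ x ⟫ * χ̄ ⟪ x ⟫ ≈ 1#
    χ*χ̄≈1 {x} x#0 = begin
      χ ⟪ x ⟫ * χ̄ ⟪ x ⟫                     ≈⟨ *-cong (^ᶻ-⟪⟫ T m x#0) (^ᶻ-⟪⟫ T (5 ℕ.* m) x#0) ⟩
      T ⟪ x ⟫ ^ m * T ⟪ x ⟫ ^ (5 ℕ.* m)     ≈⟨ ^-homo-* _ m (5 ℕ.* m) ⟨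
      T ⟪ x ⟫ ^ (6 ℕ.* m)                   ≡⟨ ≡.cong (T ⟪ x ⟫ ^_) (ℕ.*-comm 6 m) ⟩
      T ⟪ x ⟫ ^ (m ℕ.* 6)                   ≈⟨ T^[m*6]≈1 x#0 ⟩
      1#                                    ∎

    χ̄⁶≈1 : ∀ {x} → x F.# F.0# → χ̄ ⟪ x ⟫ ^ 6 ≈ 1#
    χ̄⁶≈1 {x} x#0 = begin
      χ̄ ⟪ x ⟫ ^ 6                  ≈⟨ *-identityˡ _ ⟨
      1# * χ̄ ⟪ x ⟫ ^ 6             ≈⟨ *-congʳ (χ⁶≈1 x#0) ⟨
      χ ⟪ x ⟫ ^ 6 * χ̄ ⟪ x ⟫ ^ 6    ≈⟨ ^-distrib-* _ _ 6 ⟨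
      (χ ⟪ x ⟫ * χ̄ ⟪ x ⟫) ^ 6      ≈⟨ ^-congˡ 6 (χ*χ̄≈1 x#0) ⟩
      1# ^ 6                       ≈⟨ 1^n≈1 6 ⟩
      1#                           ∎

    private
      square-^3 : ∀ {v} → v F.# F.0# → χ ⟪ v F.* v ⟫ ^ 3 ≈ 1#
      square-^3 {v} v#0 = begin
        χ ⟪ v F.* v ⟫ ^ 3            ≈⟨ ^-congˡ 3 (⟪⟫-* χ v v) ⟩
        (χ ⟪ v ⟫ * χ ⟪ v ⟫) ^ 3      ≈⟨ solve 1 (λ x → (x :* x) :^ 3 := x :^ 6) refl (χ ⟪ v ⟫) ⟩
        χ ⟪ v ⟫ ^ 6                  ≈⟨ χ⁶≈1 v#0 ⟩
        1#                           ∎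

      χ̄[γ^k*v³]² : ∀ k {v} → v F.# F.0# → χ̄ ⟪ F.γ F.^ k F.* v F.^ 3 ⟫ ^ 2 ≈ (χ̄ ⟪ F.γ ⟫ ^ k) ^ 2
      χ̄[γ^k*v³]² k {v} v#0 = begin
        χ̄ ⟪ F.γ F.^ k F.* v F.^ 3 ⟫ ^ 2           ≈⟨ ^-congˡ 2 (⟪⟫-* χ̄ _ _) ⟩
        (χ̄ ⟪ F.γ F.^ k ⟫ * χ̄ ⟪ v F.^ 3 ⟫) ^ 2     ≈⟨ ^-congˡ 2 (*-cong (⟪⟫-^ χ̄ F.γ k) (⟪⟫-^ χ̄ v 3)) ⟩
        (χ̄ ⟪ F.γ ⟫ ^ k * χ̄ ⟪ v ⟫ ^ 3) ^ 2         ≈⟨ solve 2 (λ a x → (a :* x :^ 3) :^ 2 := a :^ 2 :* x :^ 6) refl (χ̄ ⟪ F.γ ⟫ ^ k) (χ̄ ⟪ v ⟫) ⟩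
        (χ̄ ⟪ F.γ ⟫ ^ k) ^ 2 * χ̄ ⟪ v ⟫ ^ 6         ≈⟨ trans (*-congˡ (χ̄⁶≈1 v#0)) (*-identityʳ _) ⟩
        (χ̄ ⟪ F.γ ⟫ ^ k) ^ 2                       ∎

    -- At v² the cube of χ is χ(v)⁶ = 1, and every other unit is γ v² with τ³ = -1.
    φ≈χ³ : ∀ x → φ x ≈ χ ⟪ x ⟫ ^ 3
    φ≈χ³ x = [ at-0 , (λ x#0 → [ at-square x#0 , at-nonsquare x#0 ]′ (F.square-class x#0)) ]′ (F.0-or-#0 x)
      where
      at-0 : x F.≈ F.0# → φ x ≈ χ ⟪ x ⟫ ^ 3
      at-0 x≈0 = begin
        φ x              ≈⟨ φ-0 x≈0 ⟩
        0#               ≈⟨ zeroˡ _ ⟨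
        0# * 0# ^ 2      ≈⟨ ^-congˡ 3 (⟪⟫-0 χ x≈0) ⟨
        χ ⟪ x ⟫ ^ 3      ∎

      at-square : x F.# F.0# → ∃[ v ] v F.# F.0# × x F.≈ v F.* v → φ x ≈ χ ⟪ x ⟫ ^ 3
      at-square x#0 (v , v#0 , x≈) = begin
        φ x                      ≈⟨ φ-square x#0 (v , F.sym x≈) ⟩
        1#                       ≈⟨ square-^3 v#0 ⟨
        χ ⟪ v F.* v ⟫ ^ 3        ≈⟨ ^-congˡ 3 (⟪⟫-cong χ x≈) ⟨
        χ ⟪ x ⟫ ^ 3              ∎

      at-nonsquare : x F.# F.0# → ∃[ v ] v F.# F.0# × x F.≈ F.γ F.* (v F.* v) → φ x ≈ χ ⟪ x ⟫ ^ 3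
      at-nonsquare x#0 (v , v#0 , x≈) = begin
        φ x                               ≈⟨ φ-nonsquare x#0 (λ (y , y²≈x) → F.γ*square-nonsquare v#0
                                               (F.xy#0⇒x#0 (F.≈-resp-#0 (F.sym y²≈x) x#0)) (F.trans y²≈x x≈)) ⟩
        - 1#                              ≈⟨ *-identityʳ _ ⟨
        - 1# * 1#                         ≈⟨ *-cong (Φ₆⇒^3 Φ₆[τ]) (square-^3 v#0) ⟨
        τ ^ 3 * χ ⟪ v F.* v ⟫ ^ 3         ≈⟨ ^-distrib-* τ (χ ⟪ v F.* v ⟫) 3 ⟨
        (τ * χ ⟪ v F.* v ⟫) ^ 3           ≈⟨ ^-congˡ 3 (⟪⟫-* χ F.γ (v F.* v)) ⟨
        χ ⟪ F.γ F.* (v F.* v) ⟫ ^ 3       ≈⟨ ^-congˡ 3 (⟪⟫-cong χ x≈) ⟨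
        χ ⟪ x ⟫ ^ 3                       ∎

    noncube : ∀ {x} → x F.# F.0# → ¬ (∃[ s ] s F.^ 3 F.≈ x) → 1# + χ̄ ⟪ x ⟫ ^ 2 + χ̄ ⟪ x ⟫ ^ 4 ≈ 0#
    noncube {x} x#0 ¬cube = by-class (F.cube-class x#0)
      where
      χ̄x²≈ : ∀ k {v} → v F.# F.0# → x F.≈ F.γ F.^ k F.* v F.^ 3 → χ̄ ⟪ x ⟫ ^ 2 ≈ (χ̄ ⟪ F.γ ⟫ ^ k) ^ 2
      χ̄x²≈ k v#0 x≈ = trans (^-congˡ 2 (⟪⟫-cong χ̄ x≈)) (χ̄[γ^k*v³]² k v#0)

      by-class : ∃[ v ] v F.# F.0# × (x F.≈ v F.^ 3 ⊎ x F.≈ F.γ F.^ 1 F.* v F.^ 3 ⊎ x F.≈ F.γ F.^ 2 F.* v F.^ 3) →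
                 1# + χ̄ ⟪ x ⟫ ^ 2 + χ̄ ⟪ x ⟫ ^ 4 ≈ 0#
      by-class (v , v#0 , inj₁ x≈)        = contradiction (v , F.sym x≈) ¬cube
      by-class (v , v#0 , inj₂ (inj₁ x≈)) = Φ₆-sum₁ (Φ₆-inverse (χ*χ̄≈1 F.γ#0) Φ₆[τ]) (χ̄x²≈ 1 v#0 x≈)
      by-class (v , v#0 , inj₂ (inj₂ x≈)) = Φ₆-sum₂ (Φ₆-inverse (χ*χ̄≈1 F.γ#0) Φ₆[τ]) (χ̄x²≈ 2 v#0 x≈)

    isSexticCharacter : IsSexticCharacter 𝔽 𝕂 (χ ⟪_⟫) (χ̄ ⟪_⟫)
    isSexticCharacter = record
      { χ-cong = ⟪⟫-cong χ ; χ̄-cong = ⟪⟫-cong χ̄ ; χ-* = ⟪⟫-* χ ; χ̄-* = ⟪⟫-* χ̄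
      ; χ-0 = ⟪⟫-0 χ ; χ̄-0 = ⟪⟫-0 χ̄ ; χ*χ̄≈1 = χ*χ̄≈1 ; χ̄⁶≈1 = χ̄⁶≈1
      ; φ≈χ³ = φ≈χ³ ; noncube = noncube ; γ = F.γ ; γ#0 = F.γ#0 ; Φ₆[χγ] = Φ₆[τ]
      }

-- The cubic Dickson polynomial

module CubicDickson {q c ℓ₁ ℓ₂} (𝔽 : FiniteField q c ℓ₁ ℓ₂) (m : ℕ) (q≡ : q ≡ suc (m ℕ.* 6)) where
  open FiniteField 𝔽 hiding (sum; zero)
  open SexticGenerator 𝔽 m q≡
  open FiniteFieldProperties 𝔽
  open SetoidReasoning setoid

  -- The Dickson polynomial of degree 3 with parameter 1, a rescaled Chebyshev polynomial,
  -- characterised by D₃(w + 1/w) = w³ + 1/w³.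
  D₃ : Carrier → Carrier
  D₃ v = v ^ 3 - nat 3 * v

  D₃-cong : ∀ {v w} → v ≈ w → D₃ v ≈ D₃ w
  D₃-cong v≈w = +-cong (^-congˡ 3 v≈w) (-‿cong (*-congˡ v≈w))

  Square : Carrier → Set _
  Square x = ∃[ y ] y * y ≈ x

  Square-cong : ∀ {x y} → x ≈ y → Square x → Square y
  Square-cong x≈y (z , e) = z , trans e x≈y

  square/square : ∀ {x} k → k # 0# → Square (k * k * x) → Square x
  square/square {x} k k#0 (z , e) = z * inv k , (begin
    z * inv k * (z * inv k)                ≈⟨ solve 2 (λ z i → z :* i :* (z :* i) := z :* z :* (i :* i)) refl z (inv k) ⟩
    z * z * (inv k * inv k)                ≈⟨ *-congʳ e ⟩
    k * k * x * (inv k * inv k)            ≈⟨ solve 3 (λ k x i → k :* k :* x :* (i :* i) := (k :* i) :* (k :* i) :* x) refl k x (inv k) ⟩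
    (k * inv k) * (k * inv k) * x          ≈⟨ *-congʳ (*-cong (inv-inverseʳ k#0) (inv-inverseʳ k#0)) ⟩
    1# * 1# * x                            ≈⟨ solve 1 (λ x → con (+ 1) :* con (+ 1) :* x := x) refl x ⟩
    x                                      ∎)

  θ : Carrier
  θ = - ρ

  θ²+θ+1≈0 : θ ^ 2 + θ + 1# ≈ 0#
  θ²+θ+1≈0 = trans (solve 1 (λ r → (:- r) :^ 2 :+ (:- r) :+ con (+ 1) := r :^ 2 :- r :+ con (+ 1)) refl ρ) ρ²-ρ+1≈0

  √-3 : Carrier
  √-3 = nat 2 * θ + 1#

  √-3²≈-3 : √-3 * √-3 ≈ - nat 3
  √-3²≈-3 = begin
    √-3 * √-3                          ≈⟨ solve 1 (λ t → (con (+ 2) :* t :+ con (+ 1)) :* (con (+ 2) :* t :+ con (+ 1))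
                                            := con (+ 4) :* (t :^ 2 :+ t :+ con (+ 1)) :- con (+ 3)) refl θ ⟩
    nat 4 * (θ ^ 2 + θ + 1#) - nat 3   ≈⟨ +-congʳ (trans (*-congˡ θ²+θ+1≈0) (zeroʳ _)) ⟩
    0# - nat 3                         ≈⟨ +-identityˡ _ ⟩
    - nat 3                            ∎

  √-3#0 : √-3 # 0#
  √-3#0 = xy#0⇒x#0 (≈-resp-#0 (trans (*-congˡ (sym √-3²≈-3))
      (solve 1 (λ k → (:- con (+ 1)) :* (k :* k) := k :* (:- k)) refl √-3))
    (≈-resp-#0 (solve 0 (con (+ 3) := (:- con (+ 1)) :* (:- con (+ 3))) refl) 3#0))

  -- For v = w + 1/w both sides are (w³ - 1/w³)². So D₃ preserves the quadratic class of v² - 4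
  -- wherever v² is not 1.
  D₃²-4 : ∀ v → D₃ v * D₃ v - nat 4 ≈ (v * v - 1#) * (v * v - 1#) * (v * v - nat 4)
  D₃²-4 = solve 1 (λ v → (v :^ 3 :- con (+ 3) :* v) :* (v :^ 3 :- con (+ 3) :* v) :- con (+ 4)
    := (v :* v :- con (+ 1)) :* (v :* v :- con (+ 1)) :* (v :* v :- con (+ 4))) refl

  -- In the exceptional case v² = 1, the value v² - 4 is -3, which is a square because 𝔽 contains a
  -- primitive cube root of unity.
  square-D₃⇒square : ∀ {v} → Square (D₃ v * D₃ v - nat 4) → Square (v * v - nat 4)
  square-D₃⇒square {v} sq with 0-or-#0 (v * v - 1#)
  ... | inj₁ v²-1≈0 = √-3 , (begin
    √-3 * √-3                 ≈⟨ √-3²≈-3 ⟩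
    - nat 3                   ≈⟨ +-identityˡ _ ⟨
    0# - nat 3                ≈⟨ +-congʳ v²-1≈0 ⟨
    (v * v - 1#) - nat 3      ≈⟨ solve 1 (λ v → (v :* v :- con (+ 1)) :- con (+ 3) := v :* v :- con (+ 4)) refl v ⟩
    v * v - nat 4             ∎)
  ... | inj₂ v²-1#0 = square/square _ v²-1#0 (Square-cong (D₃²-4 v) sq)

  square⇒square-D₃ : ∀ {v} → Square (v * v - nat 4) → Square (D₃ v * D₃ v - nat 4)
  square⇒square-D₃ {v} (z , e) = (v * v - 1#) * z , (begin
    (v * v - 1#) * z * ((v * v - 1#) * z)            ≈⟨ solve 2 (λ a z → a :* z :* (a :* z) := a :* a :* (z :* z)) refl _ z ⟩
    (v * v - 1#) * (v * v - 1#) * (z * z)            ≈⟨ *-congˡ e ⟩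
    (v * v - 1#) * (v * v - 1#) * (v * v - nat 4)    ≈⟨ D₃²-4 v ⟨
    D₃ v * D₃ v - nat 4                              ∎)

  -- If w differs from v, it is a root of the quotient w² + v w + v² - 3, whose discriminant is -3
  -- (v² - 4). That discriminant and -3 being squares, v² - 4 would be one.
  D₃-injective : ∀ {v w} → ¬ Square (v * v - nat 4) → D₃ v ≈ D₃ w → v ≈ w
  D₃-injective {v} {w} ¬sq e with v ≟ w
  ... | yes v≈w = v≈w
  ... | no  v≉w = contradiction (square/square √-3 √-3#0 (nat 2 * w + v , (begin
    (nat 2 * w + v) * (nat 2 * w + v)
      ≈⟨ solve 2 (λ v w → (con (+ 2) :* w :+ v) :* (con (+ 2) :* w :+ v) :=
           con (+ 4) :* (v :* v :+ v :* w :+ w :* w :- con (+ 3)) :- con (+ 3) :* (v :* v :- con (+ 4))) refl v w ⟩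
    nat 4 * (v * v + v * w + w * w - nat 3) - nat 3 * (v * v - nat 4)
      ≈⟨ +-congʳ (*-congˡ quotient≈0) ⟩
    nat 4 * 0# - nat 3 * (v * v - nat 4)
      ≈⟨ solve 1 (λ a → con (+ 4) :* con (+ 0) :- con (+ 3) :* a := (:- con (+ 3)) :* a) refl _ ⟩
    - nat 3 * (v * v - nat 4)
      ≈⟨ *-congʳ √-3²≈-3 ⟨
    √-3 * √-3 * (v * v - nat 4) ∎))) ¬sq
    where
    quotient≈0 : v * v + v * w + w * w - nat 3 ≈ 0#
    quotient≈0 = xy≈0⇒y≈0 (≉⇒-#0 v≉w) (trans
      (solve 2 (λ v w → (v :- w) :* (v :* v :+ v :* w :+ w :* w :- con (+ 3))
        := (v :^ 3 :- con (+ 3) :* v) :- (w :^ 3 :- con (+ 3) :* w)) refl v w)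
      (x≈y⇒x-y≈0 e))

  -- D₃ is injective on the v with v² - 4 a nonsquare and maps this set to itself; hence onto itself.
  D₃-surjective : ∀ {u} → ¬ Square (u * u - nat 4) → ∃[ v ] D₃ v ≈ u
  D₃-surjective {u} ¬sq = let (v , e) = injective⇒surjective f f-injective u in v , D₃v≈u v e
    where
    ²-4-cong : ∀ {v w} → v ≈ w → v * v - nat 4 ≈ w * w - nat 4
    ²-4-cong v≈w = +-congʳ (*-cong v≈w v≈w)

    -- The extension by the identity allows pigeonhole on the whole field. The two pieces cannot
    -- collide, since D₃ keeps v² - 4 a nonsquare.
    f : Carrier → Carrier
    f v with square? (v * v - nat 4)
    ... | yes _ = v
    ... | no  _ = D₃ v

    f-injective : ∀ {v w} → f v ≈ f w → v ≈ w
    f-injective {v} {w} e with square? (v * v - nat 4) | square? (w * w - nat 4)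
    ... | yes _  | yes _  = e
    ... | yes sq | no ¬sq = contradiction (square-D₃⇒square (Square-cong (²-4-cong e) sq)) ¬sq
    ... | no ¬sq | yes sq = contradiction (square-D₃⇒square (Square-cong (²-4-cong (sym e)) sq)) ¬sq
    ... | no ¬sq | no _   = D₃-injective ¬sq e

    D₃v≈u : ∀ v → f v ≈ u → D₃ v ≈ u
    D₃v≈u v e with square? (v * v - nat 4)
    ... | yes sq = contradiction (Square-cong (²-4-cong e) sq) ¬sq
    ... | no  _  = e

  ½ : Carrier
  ½ = inv (nat 2)

  2*½≈1 : nat 2 * ½ ≈ 1#
  2*½≈1 = inv-inverseʳ 2#0

  quadratic-roots : ∀ {u s} → s * s ≈ u * u - nat 4 →
    ∃[ r ] ∃[ r′ ] r + r′ ≈ u × r * r′ ≈ 1# × r - r′ ≈ s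
  quadratic-roots {u} {s} s²≈ = (u + s) * ½ , (u - s) * ½ ,
    (begin
      (u + s) * ½ + (u - s) * ½    ≈⟨ solve 3 (λ u s h → (u :+ s) :* h :+ (u :- s) :* h := (con (+ 2) :* h) :* u) refl u s ½ ⟩
      (nat 2 * ½) * u              ≈⟨ trans (*-congʳ 2*½≈1) (*-identityˡ u) ⟩
      u                            ∎) ,
    (begin
      (u + s) * ½ * ((u - s) * ½)       ≈⟨ solve 3 (λ u s h → (u :+ s) :* h :* ((u :- s) :* h) := (u :* u :- s :* s) :* (h :* h)) refl u s ½ ⟩
      (u * u - s * s) * (½ * ½)         ≈⟨ *-congʳ (+-congˡ (-‿cong s²≈)) ⟩
      (u * u - (u * u - nat 4)) * (½ * ½) ≈⟨ solve 2 (λ u h → (u :* u :- (u :* u :- con (+ 4))) :* (h :* h) := (con (+ 2) :* h) :* (con (+ 2) :* h)) refl u ½ ⟩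
      (nat 2 * ½) * (nat 2 * ½)         ≈⟨ *-cong 2*½≈1 2*½≈1 ⟩
      1# * 1#                           ≈⟨ *-identityˡ 1# ⟩
      1#                                ∎) ,
    (begin
      (u + s) * ½ - (u - s) * ½    ≈⟨ solve 3 (λ u s h → (u :+ s) :* h :- (u :- s) :* h := (con (+ 2) :* h) :* s) refl u s ½ ⟩
      (nat 2 * ½) * s              ≈⟨ trans (*-congʳ 2*½≈1) (*-identityˡ s) ⟩
      s                            ∎)

  quadratic-factor : ∀ {u r r′} z → r + r′ ≈ u → r * r′ ≈ 1# →
    (z - r) * (z - r′) ≈ (z * z + 1#) - u * z
  quadratic-factor {u} {r} {r′} z r+r′≈u rr′≈1 = begin
    (z - r) * (z - r′)                    ≈⟨ solve 3 (λ z r s → (z :- r) :* (z :- s) := (z :* z :+ r :* s) :- (r :+ s) :* z) refl z r r′ ⟩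
    (z * z + r * r′) - (r + r′) * z       ≈⟨ +-cong (+-congˡ rr′≈1) (-‿cong (*-congʳ r+r′≈u)) ⟩
    (z * z + 1#) - u * z                  ∎

  D₃-+ : ∀ {w w′} → w * w′ ≈ 1# → D₃ (w + w′) ≈ w ^ 3 + w′ ^ 3
  D₃-+ {w} {w′} ww′≈1 = begin
    D₃ (w + w′)
      ≈⟨ solve 2 (λ w x → (w :+ x) :^ 3 :- con (+ 3) :* (w :+ x) := (w :^ 3 :+ x :^ 3) :+ con (+ 3) :* (w :+ x) :* (w :* x :- con (+ 1))) refl w w′ ⟩
    (w ^ 3 + w′ ^ 3) + nat 3 * (w + w′) * (w * w′ - 1#)
      ≈⟨ +-congˡ (trans (*-congˡ (x≈y⇒x-y≈0 ww′≈1)) (zeroʳ _)) ⟩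
    (w ^ 3 + w′ ^ 3) + 0#   ≈⟨ +-identityʳ _ ⟩
    w ^ 3 + w′ ^ 3          ∎

  -- A root v of D₃ v = u is w + 1/w with w ³ one of the roots r of r + 1/r = u.
  D₃-root⇒cube : ∀ {u r r′ v} → Square (u * u - nat 4) → r + r′ ≈ u → r * r′ ≈ 1# → D₃ v ≈ u →
                 ∃[ w ] w ^ 3 ≈ r
  D₃-root⇒cube {u} {r} {r′} {v} sq r+r′≈u rr′≈1 D₃v≈u = case-split (xy≈0⇒x≈0⊎y≈0 product≈0)
    where
    sqv : Square (v * v - nat 4)
    sqv = square-D₃⇒square (Square-cong (+-congʳ (sym (*-cong D₃v≈u D₃v≈u))) sq)
    ws = quadratic-roots (sqv .proj₂)
    w  = ws .proj₁
    w′ = ws .proj₂ .proj₁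
    w+w′≈v : w + w′ ≈ v
    w+w′≈v = ws .proj₂ .proj₂ .proj₁
    ww′≈1 : w * w′ ≈ 1#
    ww′≈1 = ws .proj₂ .proj₂ .proj₂ .proj₁

    product≈0 : (w ^ 3 - r) * (w ^ 3 - r′) ≈ 0#
    product≈0 = begin
      (w ^ 3 - r) * (w ^ 3 - r′)              ≈⟨ quadratic-factor (w ^ 3) r+r′≈u rr′≈1 ⟩
      (w ^ 3 * w ^ 3 + 1#) - u * w ^ 3        ≈⟨ +-congˡ (-‿cong (*-congʳ (trans (sym D₃v≈u) (trans (D₃-cong (sym w+w′≈v)) (D₃-+ ww′≈1))))) ⟩
      (w ^ 3 * w ^ 3 + 1#) - (w ^ 3 + w′ ^ 3) * w ^ 3
        ≈⟨ solve 2 (λ w x → (w :^ 3 :* w :^ 3 :+ con (+ 1)) :- (w :^ 3 :+ x :^ 3) :* w :^ 3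
             := con (+ 1) :- (w :* x) :^ 3) refl w w′ ⟩
      1# - (w * w′) ^ 3                       ≈⟨ x≈y⇒x-y≈0 (sym (trans (^-congˡ 3 ww′≈1) (1^n≈1 3))) ⟩
      0#                                      ∎

    case-split : w ^ 3 - r ≈ 0# ⊎ w ^ 3 - r′ ≈ 0# → ∃[ w ] w ^ 3 ≈ r
    case-split (inj₁ e) = w , x-y≈0⇒x≈y _ _ e
    case-split (inj₂ e) = w′ , *-cancelˡ-#0 (invertible⇒#0 r rr′≈1) (begin
      r′ * w′ ^ 3          ≈⟨ *-congʳ (x-y≈0⇒x≈y _ _ e) ⟨
      w ^ 3 * w′ ^ 3       ≈⟨ ^-distrib-* w w′ 3 ⟨
      (w * w′) ^ 3         ≈⟨ trans (^-congˡ 3 ww′≈1) (1^n≈1 3) ⟩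
      1#                   ≈⟨ rr′≈1 ⟨
      r * r′               ≈⟨ *-comm r r′ ⟩
      r′ * r               ∎)

  -- Cardano's formula: multiplying w by a cube root of unity and w′ by its inverse changes neither
  -- w³ nor w′³. The factor `- 1# - θ` is θ², the inverse of θ.
  D₃-factor : ∀ {w w′} v → w * w′ ≈ 1# →
    (v - (w + w′)) * ((v - (θ * w + (- 1# - θ) * w′)) * (v - ((- 1# - θ) * w + θ * w′))) ≈ D₃ v - (w ^ 3 + w′ ^ 3)
  D₃-factor {w} {w′} v ww′≈1 = sym (begin
    D₃ v - (w ^ 3 + w′ ^ 3)
      ≈⟨ solve 4 (λ t w x v → (v :^ 3 :- con (+ 3) :* v) :- (w :^ 3 :+ x :^ 3) :=
           (v :- (w :+ x)) :* ((v :- (t :* w :+ (:- con (+ 1) :- t) :* x)) :* (v :- ((:- con (+ 1) :- t) :* w :+ t :* x)))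
           :+ (t :^ 2 :+ t :+ con (+ 1)) :* ((w :- x) :* (w :- x) :* (v :- (w :+ x)))
           :+ (w :* x :- con (+ 1)) :* (con (+ 3) :* v)) refl θ w w′ v ⟩
    P + (θ ^ 2 + θ + 1#) * A + (w * w′ - 1#) * (nat 3 * v)
      ≈⟨ +-cong (+-congˡ (trans (*-congʳ θ²+θ+1≈0) (zeroˡ _))) (trans (*-congʳ (x≈y⇒x-y≈0 ww′≈1)) (zeroˡ _)) ⟩
    P + 0# + 0#    ≈⟨ trans (+-identityʳ _) (+-identityʳ P) ⟩
    P              ∎)
    where
    P = (v - (w + w′)) * ((v - (θ * w + (- 1# - θ) * w′)) * (v - ((- 1# - θ) * w + θ * w′)))
    A = (w - w′) * (w - w′) * (v - (w + w′))

  private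
    Q = θ ^ 2 + θ + 1#

    mod-Q : ∀ {x y} z → x ≈ y + Q * z → x ≈ y
    mod-Q z e = trans e (trans (+-congˡ (trans (*-congʳ θ²+θ+1≈0) (zeroˡ z))) (+-identityʳ _))

  1-θ#0 : 1# - θ # 0#
  1-θ#0 = xy#0⇒x#0 (≈-resp-#0 (sym (mod-Q (- 1#)
    (solve 1 (λ t → (con (+ 1) :- t) :* (con (+ 2) :+ t) := con (+ 3) :+ (t :^ 2 :+ t :+ con (+ 1)) :* (:- con (+ 1))) refl θ))) 3#0)

  θ²³≈1 : (- 1# - θ) ^ 3 ≈ 1#
  θ²³≈1 = mod-Q (- (nat 2 + θ)) (solve 1 (λ t → (:- con (+ 1) :- t) :^ 3
    := con (+ 1) :+ (t :^ 2 :+ t :+ con (+ 1)) :* (:- (con (+ 2) :+ t))) refl θ)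

  -- The difference of two of the three roots is a unit times w - η w′ with η³ = 1, so a coincidence
  -- would give w³ = w′³. The next two lemmas rest on the same reason.
  D₃-roots-distinct₀₁ : ∀ {w w′} → ¬ w ^ 3 ≈ w′ ^ 3 → ¬ (θ * w + (- 1# - θ) * w′) ≈ w + w′
  D₃-roots-distinct₀₁ {w} {w′} w³≉w′³ e = w³≉w′³ (begin
    w ^ 3                        ≈⟨ ^-congˡ 3 (x-y≈0⇒x≈y _ _ (xy≈0⇒y≈0 1-θ#0 (trans (mod-Q (- w′)
      (solve 3 (λ t w x → (con (+ 1) :- t) :* (w :- (:- con (+ 1) :- t) :* x)
        := ((w :+ x) :- (t :* w :+ (:- con (+ 1) :- t) :* x)) :+ (t :^ 2 :+ t :+ con (+ 1)) :* (:- x)) refl θ w w′))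
      (x≈y⇒x-y≈0 (sym e))))) ⟩
    ((- 1# - θ) * w′) ^ 3        ≈⟨ ^-distrib-* _ _ 3 ⟩
    (- 1# - θ) ^ 3 * w′ ^ 3      ≈⟨ trans (*-congʳ θ²³≈1) (*-identityˡ _) ⟩
    w′ ^ 3                       ∎)

  D₃-roots-distinct₀₂ : ∀ {w w′} → ¬ w ^ 3 ≈ w′ ^ 3 → ¬ ((- 1# - θ) * w + θ * w′) ≈ w + w′
  D₃-roots-distinct₀₂ w³≉w′³ e = D₃-roots-distinct₀₁ (w³≉w′³ ∘ sym) (trans (+-comm _ _) (trans e (+-comm _ _)))

  D₃-roots-distinct₁₂ : ∀ {w w′} → ¬ w ^ 3 ≈ w′ ^ 3 →
                        ¬ ((- 1# - θ) * w + θ * w′) ≈ θ * w + (- 1# - θ) * w′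
  D₃-roots-distinct₁₂ {w} {w′} w³≉w′³ e = w³≉w′³ (^-congˡ 3 (x-y≈0⇒x≈y _ _ (xy≈0⇒y≈0 √-3#0 (trans
    (solve 3 (λ t w x → (con (+ 2) :* t :+ con (+ 1)) :* (w :- x) :=
      (t :* w :+ (:- con (+ 1) :- t) :* x) :- ((:- con (+ 1) :- t) :* w :+ t :* x)) refl θ w w′)
    (x≈y⇒x-y≈0 (sym e))))))

-- Sums over 𝔽 with few nonzero terms

module FieldSums {q c ℓ₁ ℓ₂ c′ ℓ₁′ ℓ₂′} (𝔽 : FiniteField q c ℓ₁ ℓ₂) (𝕂 : AlgClosedField₀ c′ ℓ₁′ ℓ₂′) where
  private
    module F where
      open FiniteField 𝔽 public
      open FiniteFieldProperties 𝔽 public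
  open FieldOps (AlgClosedField₀.heytingField 𝕂) hiding (zero)
  open FieldProperties (AlgClosedField₀.heytingField 𝕂)
  open Characters 𝔽 𝕂 using (Σ𝔽)
  open F.Sums +-commutativeMonoid public
    using (Congruent)
    renaming (Σᶠ-cong to Σ-cong; Σᶠ-∙ to Σ-+; Σᶠ-comm to Σ-comm; Σᶠ-ε to Σ-0; Σᶠ-reindex to Σ-reindex; Σᶠ-single to Σ-single)
  open SemiringSum semiring using (*-distribˡ-sum; *-distribʳ-sum)
  open SetoidReasoning setoid

  Σ-*ˡ : ∀ k s → k * Σ𝔽 s ≈ Σ𝔽 (λ x → k * s x)
  Σ-*ˡ k s = *-distribˡ-sum {q} k (λ i → s (F.element i))

  Σ-*ʳ : ∀ k s → Σ𝔽 s * k ≈ Σ𝔽 (λ x → s x * k)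
  Σ-*ʳ k s = *-distribʳ-sum {q} k (λ i → s (F.element i))

  δ : ∀ {p} {P : Set p} → Dec P → Carrier
  δ (yes _) = 1#
  δ (no _)  = 0#

  δ-yes : ∀ {p} {P : Set p} (P? : Dec P) → P → δ P? ≈ 1#
  δ-yes (yes _) p = refl
  δ-yes (no ¬p) p = contradiction p ¬p

  δ-no : ∀ {p} {P : Set p} (P? : Dec P) → ¬ P → δ P? ≈ 0#
  δ-no (yes p) ¬p = contradiction p ¬p
  δ-no (no _)  ¬p = refl

  δ-cong : ∀ {p r} {P : Set p} {R : Set r} (P? : Dec P) (R? : Dec R) → (P → R) → (R → P) → δ P? ≈ δ R?
  δ-cong (yes p) R? to from = sym (δ-yes R? (to p))
  δ-cong (no ¬p) R? to from = sym (δ-no R? (¬p ∘ from))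

  infixl 6 _∖_
  _∖_ : (F.Carrier → Carrier) → F.Carrier → F.Carrier → Carrier
  (s ∖ a) x with x F.≟ a
  ... | yes _ = 0#
  ... | no  _ = s x

  ∖-at : ∀ s {a x} → x F.≈ a → (s ∖ a) x ≈ 0#
  ∖-at s {a} {x} x≈a with x F.≟ a
  ... | yes _   = refl
  ... | no  x≉a = contradiction x≈a x≉a

  ∖-off : ∀ s {a x} → ¬ x F.≈ a → (s ∖ a) x ≈ s x
  ∖-off s {a} {x} x≉a with x F.≟ a
  ... | yes x≈a = contradiction x≈a x≉a
  ... | no  _   = refl

  ∖-cong : ∀ {s} → Congruent s → ∀ a → Congruent (s ∖ a)
  ∖-cong {s} s-cong a {x} {y} x≈y with y F.≟ a
  ... | yes y≈a = ∖-at s (F.trans x≈y y≈a)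
  ... | no  y≉a = trans (∖-off s (λ x≈a → y≉a (F.trans (F.sym x≈y) x≈a))) (s-cong x≈y)

  Σ-remove : ∀ {s} → Congruent s → ∀ a → Σ𝔽 s ≈ s a + Σ𝔽 (s ∖ a)
  Σ-remove {s} s-cong a = begin
    Σ𝔽 s                                   ≈⟨ Σ-cong split ⟩
    Σ𝔽 (λ x → at x + (s ∖ a) x)            ≈⟨ Σ-+ at (s ∖ a) ⟩
    Σ𝔽 at + Σ𝔽 (s ∖ a)                     ≈⟨ +-congʳ (trans (Σ-single at-cong a at-off) (trans (*-congʳ (δ-yes (a F.≟ a) F.refl)) (*-identityˡ _))) ⟩
    s a + Σ𝔽 (s ∖ a)                       ∎
    where
    at : F.Carrier → Carrier
    at x = δ (x F.≟ a) * s x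

    at-cong : Congruent at
    at-cong x≈y = *-cong (δ-cong (_ F.≟ a) (_ F.≟ a) (F.trans (F.sym x≈y)) (F.trans x≈y)) (s-cong x≈y)

    at-off : ∀ x → ¬ x F.≈ a → at x ≈ 0#
    at-off x x≉a = trans (*-congʳ (δ-no (x F.≟ a) x≉a)) (zeroˡ _)

    split : ∀ x → s x ≈ at x + (s ∖ a) x
    split x with x F.≟ a
    ... | yes _ = sym (trans (+-identityʳ _) (*-identityˡ _))
    ... | no  _ = sym (trans (+-congʳ (zeroˡ _)) (+-identityˡ _))

  Σ-pair : ∀ {s} → Congruent s → ∀ a b → ¬ b F.≈ a → (∀ x → ¬ x F.≈ a → ¬ x F.≈ b → s x ≈ 0#) →
           Σ𝔽 s ≈ s a + s b
  Σ-pair {s} s-cong a b b≉a s≈0 = trans (Σ-remove s-cong a) (+-congˡ (trans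
    (Σ-single (∖-cong s-cong a) b off) (∖-off s b≉a)))
    where
    off : ∀ x → ¬ x F.≈ b → (s ∖ a) x ≈ 0#
    off x x≉b with x F.≟ a
    ... | yes _   = refl
    ... | no  x≉a = s≈0 x x≉a x≉b

  Σ-triple : ∀ {s} → Congruent s → ∀ a b d → ¬ b F.≈ a → ¬ d F.≈ a → ¬ d F.≈ b →
             (∀ x → ¬ x F.≈ a → ¬ x F.≈ b → ¬ x F.≈ d → s x ≈ 0#) →
             Σ𝔽 s ≈ s a + (s b + s d)
  Σ-triple {s} s-cong a b d b≉a d≉a d≉b s≈0 = trans (Σ-remove s-cong a) (+-congˡ (trans
    (Σ-pair (∖-cong s-cong a) b d d≉b off) (+-cong (∖-off s b≉a) (∖-off s d≉a))))
    where
    off : ∀ x → ¬ x F.≈ b → ¬ x F.≈ d → (s ∖ a) x ≈ 0#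
    off x x≉b x≉d with x F.≟ a
    ... | yes _   = refl
    ... | no  x≉a = s≈0 x x≉a x≉b x≉d

  Σ-pick : ∀ {s} → Congruent s → ∀ a → Σ𝔽 (λ x → δ (a F.≟ x) * s x) ≈ s a
  Σ-pick {s} s-cong a = trans
    (Σ-single (λ x≈y → *-cong (δ-cong (a F.≟ _) (a F.≟ _) (λ e → F.trans e x≈y) (λ e → F.trans e (F.sym x≈y))) (s-cong x≈y)) a
      (λ x x≉a → trans (*-congʳ (δ-no (a F.≟ x) (x≉a ∘ F.sym))) (zeroˡ _)))
    (trans (*-congʳ (δ-yes (a F.≟ a) F.refl)) (*-identityˡ _))

-- Vanishing character sums and the fibres of the Dickson polynomial

module SexticSums {q c ℓ₁ ℓ₂ c′ ℓ₁′ ℓ₂′} (𝔽 : FiniteField q c ℓ₁ ℓ₂) (𝕂 : AlgClosedField₀ c′ ℓ₁′ ℓ₂′)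
                  (m : ℕ) (q≡ : q ≡ suc (m ℕ.* 6))
                  (χ χ̄ : FiniteField.Carrier 𝔽 → FieldOps.Carrier (AlgClosedField₀.heytingField 𝕂))
                  (χ-sextic : IsSexticCharacter 𝔽 𝕂 χ χ̄) where
  private
    module F where
      open FiniteField 𝔽 public
      open SexticStructure 𝔽 m q≡ public
      open FiniteFieldProperties 𝔽 public
      open CubicDickson 𝔽 m q≡ public
  open AlgClosedField₀ 𝕂 using (charZero)
  open FieldOps (AlgClosedField₀.heytingField 𝕂) hiding (zero)
  open FieldProperties (AlgClosedField₀.heytingField 𝕂)
  open Characters 𝔽 𝕂 using (φ; Σ𝔽)
  open QuadraticCharacter 𝔽 𝕂
  open FieldSums 𝔽 𝕂
  open IsSexticCharacter χ-sextic
  open SetoidReasoning setoid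

  φ-cong : ∀ {x y} → x F.≈ y → φ x ≈ φ y
  φ-cong {x} {y} x≈y = begin
    φ x        ≈⟨ φ≈χ³ x ⟩
    χ x ^ 3    ≈⟨ ^-congˡ 3 (χ-cong x≈y) ⟩
    χ y ^ 3    ≈⟨ φ≈χ³ y ⟨
    φ y        ∎

  φ-* : ∀ x y → φ (x F.* y) ≈ φ x * φ y
  φ-* x y = begin
    φ (x F.* y)          ≈⟨ φ≈χ³ (x F.* y) ⟩
    χ (x F.* y) ^ 3      ≈⟨ ^-congˡ 3 (χ-* x y) ⟩
    (χ x * χ y) ^ 3      ≈⟨ ^-distrib-* (χ x) (χ y) 3 ⟩
    χ x ^ 3 * χ y ^ 3    ≈⟨ *-cong (φ≈χ³ x) (φ≈χ³ y) ⟨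
    φ x * φ y            ∎

  φ-square-* : ∀ {k} x → k F.# F.0# → φ (k F.* k F.* x) ≈ φ x
  φ-square-* {k} x k#0 = begin
    φ (k F.* k F.* x)    ≈⟨ φ-* (k F.* k) x ⟩
    φ (k F.* k) * φ x    ≈⟨ *-congʳ (φ-square (F.x#0y#0→xy#0 k#0 k#0) (k , F.refl)) ⟩
    1# * φ x             ≈⟨ *-identityˡ _ ⟩
    φ x                  ∎

  χ≈φ*χ̄² : ∀ x → χ x ≈ φ x * χ̄ x ^ 2
  χ≈φ*χ̄² x = [ at-0 , at-unit ]′ (F.0-or-#0 x)
    where
    at-0 : x F.≈ F.0# → χ x ≈ φ x * χ̄ x ^ 2
    at-0 x≈0 = begin
      χ x               ≈⟨ χ-0 x≈0 ⟩
      0#                ≈⟨ zeroˡ _ ⟨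
      0# * χ̄ x ^ 2      ≈⟨ *-congʳ (φ-0 x≈0) ⟨
      φ x * χ̄ x ^ 2     ∎

    at-unit : x F.# F.0# → χ x ≈ φ x * χ̄ x ^ 2
    at-unit x#0 = begin
      χ x                         ≈⟨ *-identityʳ _ ⟨
      χ x * 1#                    ≈⟨ *-congˡ (1^n≈1 2) ⟨
      χ x * 1# ^ 2                ≈⟨ *-congˡ (^-congˡ 2 (χ*χ̄≈1 x#0)) ⟨
      χ x * (χ x * χ̄ x) ^ 2       ≈⟨ solve 2 (λ a b → a :* (a :* b) :^ 2 := a :^ 3 :* b :^ 2) refl (χ x) (χ̄ x) ⟩
      χ x ^ 3 * χ̄ x ^ 2           ≈⟨ *-congʳ (φ≈χ³ x) ⟨
      φ x * χ̄ x ^ 2               ∎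

  -- Multiplication by γ permutes 𝔽, so the sum equals k times itself.
  Σ-twist : ∀ {s} → Congruent s → ∀ k → (∀ x → s (γ F.* x) ≈ k * s x) → 1# - k # 0# → Σ𝔽 s ≈ 0#
  Σ-twist {s} s-cong k s-γ 1-k#0 = xy≈0⇒y≈0 1-k#0 (begin
    (1# - k) * Σ𝔽 s                 ≈⟨ solve 2 (λ k S → (con (+ 1) :- k) :* S := S :- k :* S) refl k (Σ𝔽 s) ⟩
    Σ𝔽 s - k * Σ𝔽 s                 ≈⟨ x≈y⇒x-y≈0 Σ≈kΣ ⟩
    0#                              ∎)
    where
    Σ≈kΣ : Σ𝔽 s ≈ k * Σ𝔽 s
    Σ≈kΣ = begin
      Σ𝔽 s                          ≈⟨ Σ-reindex s-cong (γ F.*_) (F.inv γ F.*_) F.*-congˡ F.*-congˡ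
                                         (λ x → F.trans (F.sym (F.*-assoc _ _ _)) (F.trans (F.*-congʳ (F.inv-inverseʳ γ#0)) (F.*-identityˡ x)))
                                         (λ x → F.trans (F.sym (F.*-assoc _ _ _)) (F.trans (F.*-congʳ (F.inv-inverseˡ γ#0)) (F.*-identityˡ x))) ⟨
      Σ𝔽 (λ x → s (γ F.* x))        ≈⟨ Σ-cong s-γ ⟩
      Σ𝔽 (λ x → k * s x)            ≈⟨ Σ-*ˡ k s ⟨
      k * Σ𝔽 s                      ∎

  χγ³≈-1 : χ γ ^ 3 ≈ - 1#
  χγ³≈-1 = begin
    χ γ ^ 3                                     ≈⟨ solve 1 (λ x → x :^ 3 := (x :+ con (+ 1)) :* (x :^ 2 :- x :+ con (+ 1)) :- con (+ 1)) refl (χ γ) ⟩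
    (χ γ + 1#) * (χ γ ^ 2 - χ γ + 1#) - 1#      ≈⟨ +-congʳ (trans (*-congˡ Φ₆[χγ]) (zeroʳ _)) ⟩
    0# - 1#                                     ≈⟨ +-identityˡ _ ⟩
    - 1#                                        ∎

  Σχ≈0 : Σ𝔽 χ ≈ 0#
  Σχ≈0 = Σ-twist χ-cong (χ γ) (χ-* γ) (invertible⇒#0 (χ γ) (begin
    χ γ * (1# - χ γ)               ≈⟨ solve 1 (λ x → x :* (con (+ 1) :- x) := con (+ 1) :- (x :^ 2 :- x :+ con (+ 1))) refl (χ γ) ⟩
    1# - (χ γ ^ 2 - χ γ + 1#)      ≈⟨ +-congˡ (trans (-‿cong Φ₆[χγ]) -0#≈0#) ⟩
    1# + 0#                        ≈⟨ +-identityʳ 1# ⟩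
    1#                             ∎))

  Σφ≈0 : Σ𝔽 φ ≈ 0#
  Σφ≈0 = Σ-twist φ-cong (- 1#) (λ x → trans (φ-* γ x) (*-congʳ (trans (φ≈χ³ γ) χγ³≈-1)))
    (≈-resp-#0 (trans (×ⁿ≈nat* 2 1#) (solve 0 (con (+ 2) :* con (+ 1) := con (+ 1) :- (:- con (+ 1))) refl)) (charZero 2))

  Σφ[x+a]≈0 : ∀ a → Σ𝔽 (λ x → φ (x F.+ a)) ≈ 0#
  Σφ[x+a]≈0 a = trans (Σ-reindex φ-cong (F._+ a) (F._- a) F.+-congʳ F.+-congʳ
    (λ x → F.solve 2 (λ x a → (x F.:- a) F.:+ a F.:= x) F.refl x a)
    (λ x → F.solve 2 (λ x a → (x F.:+ a) F.:- a F.:= x) F.refl x a)) Σφ≈0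

  δ-square-sum : ∀ D → Σ𝔽 (λ y → δ (y F.* y F.≟ D)) ≈ 1# + φ D
  δ-square-sum D = [ at-0 , (λ D#0 → at-unit D#0 (F.square? D)) ]′ (F.0-or-#0 D)
    where
    s : F.Carrier → Carrier
    s y = δ (y F.* y F.≟ D)

    s-cong : Congruent s
    s-cong x≈y = δ-cong (_ F.≟ D) (_ F.≟ D) (F.trans (F.sym (F.*-cong x≈y x≈y))) (F.trans (F.*-cong x≈y x≈y))

    at-0 : D F.≈ F.0# → Σ𝔽 s ≈ 1# + φ D
    at-0 D≈0 = begin
      Σ𝔽 s           ≈⟨ Σ-single s-cong F.0# (λ y y≉0 → δ-no (y F.* y F.≟ D) (λ e →
                          [ y≉0 , y≉0 ]′ (F.xy≈0⇒x≈0⊎y≈0 (F.trans e D≈0)))) ⟩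
      s F.0#         ≈⟨ δ-yes (F.0# F.* F.0# F.≟ D) (F.trans (F.zeroˡ F.0#) (F.sym D≈0)) ⟩
      1#             ≈⟨ +-identityʳ 1# ⟨
      1# + 0#        ≈⟨ +-congˡ (φ-0 D≈0) ⟨
      1# + φ D       ∎

    at-unit : D F.# F.0# → Dec (F.Square D) → Σ𝔽 s ≈ 1# + φ D
    at-unit D#0 (yes (z , z²≈D)) = begin
      Σ𝔽 s            ≈⟨ Σ-pair s-cong z (F.- z) -z≉z off ⟩
      s z + s (F.- z) ≈⟨ +-cong (δ-yes (z F.* z F.≟ D) z²≈D) (δ-yes (F.- z F.* F.- z F.≟ D)
                           (F.trans (F.solve 1 (λ z → (F.:- z) F.:* (F.:- z) F.:= z F.:* z) F.refl z) z²≈D)) ⟩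
      1# + 1#         ≈⟨ +-congˡ (φ-square D#0 (z , z²≈D)) ⟨
      1# + φ D        ∎
      where
      -z≉z : ¬ F.- z F.≈ z
      -z≉z e = F.#⇒≉ (F.x#0y#0→xy#0 F.2#0 (F.xy#0⇒x#0 (F.≈-resp-#0 (F.sym z²≈D) D#0)))
        (F.trans (F.solve 1 (λ z → F.con (+ 2) F.:* z F.:= z F.:- (F.:- z)) F.refl z) (F.x≈y⇒x-y≈0 (F.sym e)))

      off : ∀ x → ¬ x F.≈ z → ¬ x F.≈ F.- z → s x ≈ 0#
      off x x≉z x≉-z = δ-no (x F.* x F.≟ D) (λ e → [ (λ e′ → x≉z (F.x-y≈0⇒x≈y _ _ e′)) , (λ e′ → x≉-z (F.x-y≈0⇒x≈y _ _ e′)) ]′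
        (F.xy≈0⇒x≈0⊎y≈0 (F.trans
          (F.solve 2 (λ x z → (x F.:- z) F.:* (x F.:- (F.:- z)) F.:= x F.:* x F.:- z F.:* z) F.refl x z)
          (F.x≈y⇒x-y≈0 (F.trans e (F.sym z²≈D))))))
    at-unit D#0 (no ¬sq) = begin
      Σ𝔽 s           ≈⟨ Σ-0 (λ y → δ-no (y F.* y F.≟ D) (λ e → ¬sq (y , e))) ⟩
      0#             ≈⟨ -‿inverseʳ 1# ⟨
      1# - 1#        ≈⟨ +-congˡ (φ-nonsquare D#0 ¬sq) ⟨
      1# + φ D       ∎

  -- Built from `χ̄` and not from `χ`, so that φω = χ³χ⁻² is `χ` itself.
  ω : F.Carrier → Carrier
  ω r = χ̄ r ^ 2

  ω-cong : ∀ {x y} → x F.≈ y → ω x ≈ ω y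
  ω-cong x≈y = ^-congˡ 2 (χ̄-cong x≈y)

  χ̄-1 : χ̄ F.1# ≈ 1#
  χ̄-1 = *-cancelˡ-#0 (invertible⇒#0 (χ F.1#) (χ*χ̄≈1 F.1#0)) (begin
    χ̄ F.1# * χ̄ F.1#       ≈⟨ χ̄-* F.1# F.1# ⟨
    χ̄ (F.1# F.* F.1#)     ≈⟨ χ̄-cong (F.*-identityˡ F.1#) ⟩
    χ̄ F.1#                ≈⟨ *-identityʳ _ ⟨
    χ̄ F.1# * 1#           ∎)

  χ̄*χ̄≈1 : ∀ {x y} → x F.* y F.≈ F.1# → χ̄ x * χ̄ y ≈ 1#
  χ̄*χ̄≈1 {x} {y} xy≈1 = trans (sym (χ̄-* x y)) (trans (χ̄-cong xy≈1) χ̄-1)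

  ω-cube : ∀ {w} → w F.# F.0# → ω (w F.^ 3) ≈ 1#
  ω-cube {w} w#0 = begin
    χ̄ (w F.^ 3) ^ 2                          ≈⟨ ^-congˡ 2 (trans (χ̄-* w _) (*-congˡ (trans (χ̄-* w _) (*-congˡ (χ̄-* w _))))) ⟩
    (χ̄ w * (χ̄ w * (χ̄ w * χ̄ F.1#))) ^ 2       ≈⟨ ^-congˡ 2 (*-congˡ (*-congˡ (*-congˡ χ̄-1))) ⟩
    (χ̄ w ^ 3) ^ 2                            ≈⟨ ^-assocʳ (χ̄ w) 3 2 ⟩
    χ̄ w ^ 6                                  ≈⟨ χ̄⁶≈1 w#0 ⟩
    1#                                       ∎

  #D₃⁻¹ : F.Carrier → Carrier
  #D₃⁻¹ u = Σ𝔽 (λ v → δ (F.D₃ v F.≟ u))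

  -- The condition r + 1/r = u is cleared of its denominator; this adds no solution, since r = 0
  -- would give 1 = 0.
  Σω : F.Carrier → Carrier
  Σω u = Σ𝔽 (λ r → δ (r F.* r F.+ F.1# F.≟ u F.* r) * ω r)

  module _ (u : F.Carrier) where
    private
      D : F.Carrier
      D = u F.* u F.- F.nat 4

      s : F.Carrier → Carrier
      s v = δ (F.D₃ v F.≟ u)

      t : F.Carrier → Carrier
      t r = δ (r F.* r F.+ F.1# F.≟ u F.* r) * ω r

      s-cong : Congruent s
      s-cong v≈w = δ-cong (_ F.≟ u) (_ F.≟ u) (F.trans (F.sym (F.D₃-cong v≈w))) (F.trans (F.D₃-cong v≈w))

      t-cong : Congruent t
      t-cong r≈r′ = *-cong
        (δ-cong (_ F.≟ _) (_ F.≟ _) (λ e → F.trans (F.sym (eq r≈r′)) (F.trans e (F.*-congˡ r≈r′)))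
                                    (λ e → F.trans (eq r≈r′) (F.trans e (F.sym (F.*-congˡ r≈r′)))))
        (ω-cong r≈r′)
        where
        eq : ∀ {r r′} → r F.≈ r′ → r F.* r F.+ F.1# F.≈ r′ F.* r′ F.+ F.1#
        eq e = F.+-congʳ (F.*-cong e e)

      s-on : ∀ {v} → F.D₃ v F.≈ u → s v ≈ 1#
      s-on {v} = δ-yes (F.D₃ v F.≟ u)

      s-off : ∀ {v} → ¬ F.D₃ v F.≈ u → s v ≈ 0#
      s-off {v} = δ-no (F.D₃ v F.≟ u)

      t-on : ∀ {r} → r F.* r F.+ F.1# F.≈ u F.* r → t r ≈ ω r
      t-on {r} e = trans (*-congʳ (δ-yes (r F.* r F.+ F.1# F.≟ u F.* r) e)) (*-identityˡ _)

      t-off : ∀ {r} → ¬ r F.* r F.+ F.1# F.≈ u F.* r → t r ≈ 0#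
      t-off {r} ne = trans (*-congʳ (δ-no (r F.* r F.+ F.1# F.≟ u F.* r) ne)) (zeroˡ _)

      nonsquare-case : ¬ F.Square D → Σ𝔽 s ≈ 1# + Σ𝔽 t
      nonsquare-case ¬sq = begin
        Σ𝔽 s            ≈⟨ Σ-single s-cong v (λ w w≉v → s-off (λ e → w≉v (F.sym (F.D₃-injective ¬sqv (F.trans D₃v≈u (F.sym e)))))) ⟩
        s v             ≈⟨ s-on D₃v≈u ⟩
        1#              ≈⟨ +-identityʳ 1# ⟨
        1# + 0#         ≈⟨ +-congˡ (Σ-0 (λ r → t-off (λ e → ¬sq (square {r} e)))) ⟨
        1# + Σ𝔽 t       ∎
        where
        v : F.Carrier
        v = F.D₃-surjective ¬sq .proj₁

        D₃v≈u : F.D₃ v F.≈ u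
        D₃v≈u = F.D₃-surjective ¬sq .proj₂

        ¬sqv : ¬ F.Square (v F.* v F.- F.nat 4)
        ¬sqv sq = ¬sq (F.Square-cong (F.+-congʳ (F.*-cong D₃v≈u D₃v≈u)) (F.square⇒square-D₃ sq))

        square : ∀ {r} → r F.* r F.+ F.1# F.≈ u F.* r → F.Square D
        square {r} e = F.nat 2 F.* r F.- u , F.trans
          (F.solve 2 (λ r u → (F.con (+ 2) F.:* r F.:- u) F.:* (F.con (+ 2) F.:* r F.:- u)
            F.:= (u F.:* u F.:- F.con (+ 4)) F.:+ F.con (+ 4) F.:* ((r F.:* r F.:+ F.con (+ 1)) F.:- u F.:* r)) F.refl r u)
          (F.trans (F.+-congˡ (F.trans (F.*-congˡ (F.x≈y⇒x-y≈0 e)) (F.zeroʳ _))) (F.+-identityʳ _))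

      module _ {r r′ : F.Carrier} (r+r′≈u : r F.+ r′ F.≈ u) (rr′≈1 : r F.* r′ F.≈ F.1#) where
        root-r : r F.* r F.+ F.1# F.≈ u F.* r
        root-r = F.x-y≈0⇒x≈y _ _ (F.trans (F.sym (F.quadratic-factor r r+r′≈u rr′≈1))
          (F.trans (F.*-congʳ (F.-‿inverseʳ r)) (F.zeroˡ _)))

        root-r′ : r′ F.* r′ F.+ F.1# F.≈ u F.* r′
        root-r′ = F.x-y≈0⇒x≈y _ _ (F.trans (F.sym (F.quadratic-factor r′ r+r′≈u rr′≈1))
          (F.trans (F.*-congˡ (F.-‿inverseʳ r′)) (F.zeroʳ _)))

        t-off-roots : ∀ z → ¬ z F.≈ r → ¬ z F.≈ r′ → t z ≈ 0#
        t-off-roots z z≉r z≉r′ = t-off (λ e → [ (λ e′ → z≉r (F.x-y≈0⇒x≈y _ _ e′)) , (λ e′ → z≉r′ (F.x-y≈0⇒x≈y _ _ e′)) ]′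
          (F.xy≈0⇒x≈0⊎y≈0 (F.trans (F.quadratic-factor z r+r′≈u rr′≈1) (F.x≈y⇒x-y≈0 e))))

        r#0 : r F.# F.0#
        r#0 = F.invertible⇒#0 r′ (F.trans (F.*-comm r′ r) rr′≈1)

        -- Now r² = 1 and u = 2r, so D₃ v - u = (v - 2r)(v + r)² has only two distinct roots. On the
        -- other side only r itself contributes, with ω r = χ̄(r²) = 1.
        double-case : r F.≈ r′ → Σ𝔽 s ≈ 1# + Σ𝔽 t
        double-case r≈r′ = begin
          Σ𝔽 s                     ≈⟨ Σ-pair s-cong (F.nat 2 F.* r) (F.- r) distinct s-off-roots ⟩
          s (F.nat 2 F.* r) + s (F.- r)
            ≈⟨ +-cong (s-on (F.x-y≈0⇒x≈y _ _ (F.trans (F.sym (factor _)) (F.trans (F.*-congʳ (F.-‿inverseʳ _)) (F.zeroˡ _)))))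
                      (s-on (F.x-y≈0⇒x≈y _ _ (F.trans (F.sym (factor _)) (F.trans (F.*-congˡ (F.trans (F.*-congʳ (F.-‿inverseˡ r)) (F.zeroˡ _))) (F.zeroʳ _))))) ⟩
          1# + 1#                  ≈⟨ +-congˡ (trans (*-congˡ (*-identityʳ (χ̄ r))) (χ̄*χ̄≈1 r²≈1)) ⟨
          1# + ω r                 ≈⟨ +-congˡ (t-on root-r) ⟨
          1# + t r                 ≈⟨ +-congˡ (Σ-single t-cong r (λ z z≉r → t-off-roots z z≉r (λ z≈r′ → z≉r (F.trans z≈r′ (F.sym r≈r′))))) ⟨
          1# + Σ𝔽 t                ∎
          where
          r²≈1 : r F.* r F.≈ F.1#
          r²≈1 = F.trans (F.*-congˡ r≈r′) rr′≈1

          factor : ∀ v → (v F.- F.nat 2 F.* r) F.* ((v F.+ r) F.* (v F.+ r)) F.≈ F.D₃ v F.- u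
          factor v = F.trans
            (F.solve 2 (λ v r → (v F.:- F.con (+ 2) F.:* r) F.:* ((v F.:+ r) F.:* (v F.:+ r)) F.:=
               ((v F.:^ 3 F.:- F.con (+ 3) F.:* v) F.:- (r F.:+ r))
               F.:+ (F.con (+ 1) F.:- r F.:* r) F.:* (F.con (+ 3) F.:* v F.:+ F.con (+ 2) F.:* r)) F.refl v r)
            (F.trans (F.+-congˡ (F.trans (F.*-congʳ (F.x≈y⇒x-y≈0 (F.sym r²≈1))) (F.zeroˡ _)))
              (F.trans (F.+-identityʳ _) (F.+-congˡ (F.-‿cong (F.trans (F.+-congˡ r≈r′) r+r′≈u)))))

          distinct : ¬ F.- r F.≈ F.nat 2 F.* r
          distinct e = F.#⇒≉ (F.x#0y#0→xy#0 F.3#0 r#0) (F.trans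
            (F.solve 1 (λ r → F.con (+ 3) F.:* r F.:= F.con (+ 2) F.:* r F.:- (F.:- r)) F.refl r) (F.x≈y⇒x-y≈0 (F.sym e)))

          s-off-roots : ∀ v → ¬ v F.≈ F.nat 2 F.* r → ¬ v F.≈ F.- r → s v ≈ 0#
          s-off-roots v v≉2r v≉-r = s-off (λ e → [ (λ e′ → v≉2r (F.x-y≈0⇒x≈y _ _ e′)) , (λ e′ → [ v+r≉0 , v+r≉0 ]′ (F.xy≈0⇒x≈0⊎y≈0 e′)) ]′
            (F.xy≈0⇒x≈0⊎y≈0 (F.trans (factor v) (F.x≈y⇒x-y≈0 e))))
            where
            v+r≉0 : ¬ v F.+ r F.≈ F.0#
            v+r≉0 e = v≉-r (F.x-y≈0⇒x≈y _ _ (F.trans (F.+-congˡ (F.-‿involutive r)) e))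

        Σt-pair : ¬ r′ F.≈ r → Σ𝔽 t ≈ ω r + ω r′
        Σt-pair r′≉r = trans (Σ-pair t-cong r r′ r′≉r t-off-roots) (+-cong (t-on root-r) (t-on root-r′))

        -- No v maps to u, and since r′ = 1/r and χ̄(r)⁶ = 1, the right side is 1 + ω(r) + ω(r)²,
        -- which is 0 at a non-cube.
        noncube-case : F.Square D → ¬ r′ F.≈ r → ¬ (∃[ w ] w F.^ 3 F.≈ r) → Σ𝔽 s ≈ 1# + Σ𝔽 t
        noncube-case sq r′≉r ¬cube = begin
          Σ𝔽 s                     ≈⟨ Σ-0 (λ v → s-off (λ e → ¬cube (F.D₃-root⇒cube {u} {r} {r′} {v} sq r+r′≈u rr′≈1 e))) ⟩
          0#                       ≈⟨ noncube r#0 ¬cube ⟨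
          1# + a ^ 2 + a ^ 4       ≈⟨ +-congˡ a⁴≈b² ⟩
          1# + a ^ 2 + b ^ 2       ≈⟨ +-assoc 1# _ _ ⟩
          1# + (ω r + ω r′)        ≈⟨ +-congˡ (Σt-pair r′≉r) ⟨
          1# + Σ𝔽 t                ∎
          where
          a : Carrier
          a = χ̄ r

          b : Carrier
          b = χ̄ r′

          a⁴≈b² : a ^ 4 ≈ b ^ 2
          a⁴≈b² = begin
            a ^ 4                  ≈⟨ *-identityˡ _ ⟨
            1# * a ^ 4             ≈⟨ *-congʳ (trans (^-congˡ 2 (χ̄*χ̄≈1 rr′≈1)) (1^n≈1 2)) ⟨
            (a * b) ^ 2 * a ^ 4    ≈⟨ solve 2 (λ a b → (a :* b) :^ 2 :* a :^ 4 := a :^ 6 :* b :^ 2) refl a b ⟩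
            a ^ 6 * b ^ 2          ≈⟨ *-congʳ (χ̄⁶≈1 r#0) ⟩
            1# * b ^ 2             ≈⟨ *-identityˡ _ ⟩
            b ^ 2                  ∎

        cube-case : ¬ r′ F.≈ r → ∃[ w ] w F.^ 3 F.≈ r → Σ𝔽 s ≈ 1# + Σ𝔽 t
        cube-case r′≉r (w , w³≈r) = begin
          Σ𝔽 s
            ≈⟨ Σ-triple s-cong v₀ v₁ v₂ (F.D₃-roots-distinct₀₁ w³≉w′³) (F.D₃-roots-distinct₀₂ w³≉w′³) (F.D₃-roots-distinct₁₂ w³≉w′³) s-off-roots ⟩
          s v₀ + (s v₁ + s v₂)
            ≈⟨ +-cong (s-on (root v₀ (F.trans (F.*-congʳ (F.-‿inverseʳ v₀)) (F.zeroˡ _))))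
                (+-cong (s-on (root v₁ (F.trans (F.*-congˡ (F.trans (F.*-congʳ (F.-‿inverseʳ v₁)) (F.zeroˡ _))) (F.zeroʳ _))))
                        (s-on (root v₂ (F.trans (F.*-congˡ (F.trans (F.*-congˡ (F.-‿inverseʳ v₂)) (F.zeroʳ _))) (F.zeroʳ _))))) ⟩
          1# + (1# + 1#)
            ≈⟨ +-congˡ (+-cong (trans (ω-cong (F.sym w³≈r)) (ω-cube w#0)) (trans (ω-cong (F.sym w′³≈r′)) (ω-cube w′#0))) ⟨
          1# + (ω r + ω r′)        ≈⟨ +-congˡ (Σt-pair r′≉r) ⟨
          1# + Σ𝔽 t                ∎
          where
          w#0 : w F.# F.0#
          w#0 = F.xy#0⇒x#0 (F.≈-resp-#0 (F.sym w³≈r) r#0)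

          w′ : F.Carrier
          w′ = F.inv w

          w′#0 : w′ F.# F.0#
          w′#0 = F.inv#0 w#0

          ww′≈1 : w F.* w′ F.≈ F.1#
          ww′≈1 = F.inv-inverseʳ w#0

          w′³≈r′ : w′ F.^ 3 F.≈ r′
          w′³≈r′ = F.*-cancelˡ-#0 r#0 (F.trans (F.*-congʳ (F.sym w³≈r)) (F.trans (F.sym (F.^-distrib-* w w′ 3))
            (F.trans (F.^-congˡ 3 ww′≈1) (F.trans (F.1^n≈1 3) (F.sym rr′≈1)))))

          w³≉w′³ : ¬ w F.^ 3 F.≈ w′ F.^ 3
          w³≉w′³ e = r′≉r (F.trans (F.sym w′³≈r′) (F.trans (F.sym e) w³≈r))

          u≈ : w F.^ 3 F.+ w′ F.^ 3 F.≈ u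
          u≈ = F.trans (F.+-cong w³≈r w′³≈r′) r+r′≈u

          v₀ : F.Carrier
          v₀ = w F.+ w′

          v₁ : F.Carrier
          v₁ = F.θ F.* w F.+ (F.- F.1# F.- F.θ) F.* w′

          v₂ : F.Carrier
          v₂ = (F.- F.1# F.- F.θ) F.* w F.+ F.θ F.* w′

          root : ∀ v → (v F.- v₀) F.* ((v F.- v₁) F.* (v F.- v₂)) F.≈ F.0# → F.D₃ v F.≈ u
          root v e = F.trans (F.x-y≈0⇒x≈y _ _ (F.trans (F.sym (F.D₃-factor v ww′≈1)) e)) u≈

          s-off-roots : ∀ v → ¬ v F.≈ v₀ → ¬ v F.≈ v₁ → ¬ v F.≈ v₂ → s v ≈ 0#
          s-off-roots v v≉v₀ v≉v₁ v≉v₂ = s-off (λ e → F.#⇒≉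
            (F.x#0y#0→xy#0 (F.≉⇒-#0 v≉v₀) (F.x#0y#0→xy#0 (F.≉⇒-#0 v≉v₁) (F.≉⇒-#0 v≉v₂)))
            (F.trans (F.D₃-factor v ww′≈1) (F.x≈y⇒x-y≈0 (F.trans e (F.sym u≈)))))

        cube? : Dec (∃[ w ] w F.^ 3 F.≈ r)
        cube? = map′ (λ (i , e) → F.element i , e)
                     (λ (w , e) → F.index w , F.trans (F.^-congˡ 3 (F.element-index w)) e)
                     (Fin.any? (λ i → F.element i F.^ 3 F.≟ r))

        split-case : F.Square D → Dec (r′ F.≈ r) → Dec (∃[ w ] w F.^ 3 F.≈ r) → Σ𝔽 s ≈ 1# + Σ𝔽 t
        split-case sq (yes r′≈r) _          = double-case (F.sym r′≈r)
        split-case sq (no r′≉r)  (yes cube) = cube-case r′≉r cube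
        split-case sq (no r′≉r)  (no ¬cube) = noncube-case sq r′≉r ¬cube

      by-discriminant : Dec (F.Square D) → Σ𝔽 s ≈ 1# + Σ𝔽 t
      by-discriminant (no ¬sq) = nonsquare-case ¬sq
      by-discriminant (yes sq) =
        let (r , r′ , r+r′≈u , rr′≈1 , _) = F.quadratic-roots (sq .proj₂)
        in split-case r+r′≈u rr′≈1 sq (r′ F.≟ r) (cube? r+r′≈u rr′≈1)

    -- If u = r + 1/r, then v = w + 1/w runs over the solutions as w runs over the cube roots of r,
    -- which 1 + ω r + ω r⁻¹ counts.
    #D₃⁻¹≈1+Σω : #D₃⁻¹ u ≈ 1# + Σω u
    #D₃⁻¹≈1+Σω = by-discriminant (F.square? D)

-- From the Dickson sum to the hypergeometric sum

module SexticEvaluation {q c ℓ₁ ℓ₂ c′ ℓ₁′ ℓ₂′} (𝔽 : FiniteField q c ℓ₁ ℓ₂) (𝕂 : AlgClosedField₀ c′ ℓ₁′ ℓ₂′)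
                  (m : ℕ) (q≡ : q ≡ suc (m ℕ.* 6))
                  (χ χ̄ : FiniteField.Carrier 𝔽 → FieldOps.Carrier (AlgClosedField₀.heytingField 𝕂))
                  (χ-sextic : IsSexticCharacter 𝔽 𝕂 χ χ̄) where
  private
    module F where
      open FiniteField 𝔽 public
      open SexticStructure 𝔽 m q≡ public
      open FiniteFieldProperties 𝔽 public
      open CubicDickson 𝔽 m q≡ public
  open FieldOps (AlgClosedField₀.heytingField 𝕂) hiding (zero)
  open FieldProperties (AlgClosedField₀.heytingField 𝕂)
  open Characters 𝔽 𝕂 using (φ; Σ𝔽)
  open FieldSums 𝔽 𝕂
  open IsSexticCharacter χ-sextic
  open SexticSums 𝔽 𝕂 m q≡ χ χ̄ χ-sextic
  open SetoidReasoning setoid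

  -- The terms are grouped by u = D₃ v. In the count 1 + `Σω` of the fibre, the 1 contributes the
  -- sum of φ(u + c) over all u, which is 0.
  Σφ[D₃+c] : ∀ c → Σ𝔽 (λ v → φ (F.D₃ v F.+ c)) ≈ Σ𝔽 (λ u → Σω u * φ (u F.+ c))
  Σφ[D₃+c] c = begin
    Σ𝔽 (λ v → φ (F.D₃ v F.+ c))
      ≈⟨ Σ-cong (λ v → Σ-pick φ₊-cong (F.D₃ v)) ⟨
    Σ𝔽 (λ v → Σ𝔽 (λ u → δ (F.D₃ v F.≟ u) * φ (u F.+ c)))
      ≈⟨ Σ-comm (λ v u → δ (F.D₃ v F.≟ u) * φ (u F.+ c)) ⟩
    Σ𝔽 (λ u → Σ𝔽 (λ v → δ (F.D₃ v F.≟ u) * φ (u F.+ c)))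
      ≈⟨ Σ-cong (λ u → Σ-*ʳ (φ (u F.+ c)) (λ v → δ (F.D₃ v F.≟ u))) ⟨
    Σ𝔽 (λ u → #D₃⁻¹ u * φ (u F.+ c))
      ≈⟨ Σ-cong (λ u → trans (*-congʳ (#D₃⁻¹≈1+Σω u)) (trans (distribʳ (φ (u F.+ c)) 1# (Σω u)) (+-congʳ (*-identityˡ _)))) ⟩
    Σ𝔽 (λ u → φ (u F.+ c) + Σω u * φ (u F.+ c))
      ≈⟨ Σ-+ (λ u → φ (u F.+ c)) (λ u → Σω u * φ (u F.+ c)) ⟩
    Σ𝔽 (λ u → φ (u F.+ c)) + Σ𝔽 (λ u → Σω u * φ (u F.+ c))
      ≈⟨ +-congʳ (Σφ[x+a]≈0 c) ⟩
    0# + Σ𝔽 (λ u → Σω u * φ (u F.+ c))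
      ≈⟨ +-identityˡ _ ⟩
    Σ𝔽 (λ u → Σω u * φ (u F.+ c)) ∎
    where
    φ₊-cong : Congruent (λ u → φ (u F.+ c))
    φ₊-cong u≈v = φ-cong (F.+-congʳ u≈v)

  module _ {x c : F.Carrier} (x#0 : x F.# F.0#) (c+4x≈2 : c F.+ F.nat 4 F.* x F.≈ F.nat 2) where

    -- It joins the two sides: disc r is the discriminant in y of r x y² - (r + 1) y + 1, the
    -- equation r y (1 - x y) = 1 - y, and r disc r is r² (r + 1/r + c) for c = 2 - 4x.
    disc : F.Carrier → F.Carrier
    disc r = (r F.+ F.1#) F.* (r F.+ F.1#) F.- F.nat 4 F.* (r F.* x)

    -- For a nonzero r only u = r + 1/r survives. Multiplying u + c by the square r² gives r disc r,
    -- and the resulting φ(r) completes ω(r) to χ(r).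
    Σωφ : Σ𝔽 (λ u → Σω u * φ (u F.+ c)) ≈ Σ𝔽 (λ r → χ r * φ (disc r))
    Σωφ = begin
      Σ𝔽 (λ u → Σω u * φ (u F.+ c))               ≈⟨ Σ-cong (λ u → Σ-*ʳ (φ (u F.+ c)) (λ r → δ (r F.* r F.+ F.1# F.≟ u F.* r) * ω r)) ⟩
      Σ𝔽 (λ u → Σ𝔽 (λ r → term r u))              ≈⟨ Σ-comm (λ u r → term r u) ⟩
      Σ𝔽 (λ r → Σ𝔽 (λ u → term r u))              ≈⟨ Σ-cong (λ r → [ at-0 r , at-unit r ]′ (F.0-or-#0 r)) ⟩
      Σ𝔽 (λ r → χ r * φ (disc r))                 ∎
      where
      term : F.Carrier → F.Carrier → Carrier
      term r u = δ (r F.* r F.+ F.1# F.≟ u F.* r) * ω r * φ (u F.+ c)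

      term-off : ∀ r u → ¬ r F.* r F.+ F.1# F.≈ u F.* r → term r u ≈ 0#
      term-off r u ne = trans (*-congʳ (trans (*-congʳ (δ-no (r F.* r F.+ F.1# F.≟ u F.* r) ne)) (zeroˡ _))) (zeroˡ _)

      at-0 : ∀ r → r F.≈ F.0# → Σ𝔽 (term r) ≈ χ r * φ (disc r)
      at-0 r r≈0 = trans (Σ-0 (λ u → term-off r u (λ e → F.1≉0 (F.trans (F.sym (F.+-identityˡ F.1#))
          (F.trans (F.+-congʳ (F.sym (F.trans (F.*-congʳ r≈0) (F.zeroˡ r)))) (F.trans e (F.trans (F.*-congˡ r≈0) (F.zeroʳ u))))))))
        (sym (trans (*-congʳ (χ-0 r≈0)) (zeroˡ _)))

      at-unit : ∀ r → r F.# F.0# → Σ𝔽 (term r) ≈ χ r * φ (disc r)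
      at-unit r r#0 = begin
        Σ𝔽 (term r)                   ≈⟨ Σ-single term-cong a (λ u u≉a → term-off r u (λ e → u≉a (F.*-cancelˡ-#0 r#0
                                           (F.trans (F.*-comm r u) (F.trans (F.sym e) (F.sym ra≈)))))) ⟩
        term r a                      ≈⟨ *-congʳ (trans (*-congʳ (δ-yes (r F.* r F.+ F.1# F.≟ a F.* r) (F.trans (F.sym ra≈) (F.*-comm r a)))) (*-identityˡ _)) ⟩
        ω r * φ (a F.+ c)             ≈⟨ *-congˡ (φ-square-* (a F.+ c) r#0) ⟨
        ω r * φ (r F.* r F.* (a F.+ c)) ≈⟨ *-congˡ (φ-cong r²[a+c]≈) ⟩
        ω r * φ (r F.* disc r)        ≈⟨ *-congˡ (φ-* r (disc r)) ⟩
        ω r * (φ r * φ (disc r))      ≈⟨ *-assoc _ _ _ ⟨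
        ω r * φ r * φ (disc r)        ≈⟨ *-congʳ (trans (*-comm _ _) (sym (χ≈φ*χ̄² r))) ⟩
        χ r * φ (disc r)              ∎
        where
        a : F.Carrier
        a = (r F.* r F.+ F.1#) F.* F.inv r

        ra≈ : r F.* a F.≈ r F.* r F.+ F.1#
        ra≈ = F.trans (F.*-comm r a) (F.trans (F.*-assoc _ _ _) (F.trans (F.*-congˡ (F.inv-inverseˡ r#0)) (F.*-identityʳ _)))

        term-cong : Congruent (term r)
        term-cong u≈v = *-cong (*-congʳ (δ-cong (_ F.≟ _) (_ F.≟ _) (λ e → F.trans e (F.*-congʳ u≈v)) (λ e → F.trans e (F.sym (F.*-congʳ u≈v)))))
                               (φ-cong (F.+-congʳ u≈v))

        r²[a+c]≈ : r F.* r F.* (a F.+ c) F.≈ r F.* disc r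
        r²[a+c]≈ = F.trans
          (F.solve 4 (λ r a c x → r F.:* r F.:* (a F.:+ c) F.:=
             r F.:* ((r F.:+ F.con (+ 1)) F.:* (r F.:+ F.con (+ 1)) F.:- F.con (+ 4) F.:* (r F.:* x))
             F.:+ (r F.:* (r F.:* a F.:- (r F.:* r F.:+ F.con (+ 1)))
             F.:+ r F.:* r F.:* ((c F.:+ F.con (+ 4) F.:* x) F.:- F.con (+ 2)))) F.refl r a c x)
          (F.trans (F.+-congˡ (F.trans (F.+-cong (F.trans (F.*-congˡ (F.x≈y⇒x-y≈0 ra≈)) (F.zeroʳ _))
            (F.trans (F.*-congˡ (F.x≈y⇒x-y≈0 c+4x≈2)) (F.zeroʳ _))) (F.+-identityʳ _))) (F.+-identityʳ _))

    denominator : F.Carrier → F.Carrier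
    denominator y = y F.* (F.1# F.- x F.* y)

    fibre : F.Carrier → F.Carrier → Carrier
    fibre r y = δ (F.1# F.- y F.≟ r F.* denominator y)

    -- Completing the square: z = 2 r x y - (r + 1) turns the equation of the fibre into z² = disc
    -- r, and y ↦ z is bijective because r and x are units.
    Σfibre : ∀ {r} → r F.# F.0# → Σ𝔽 (fibre r) ≈ 1# + φ (disc r)
    Σfibre {r} r#0 = begin
      Σ𝔽 (fibre r)                          ≈⟨ Σ-cong (λ y → δ-cong (_ F.≟ _) (_ F.≟ _) (to y) (from y)) ⟩
      Σ𝔽 (λ y → s (k F.* y F.- l))          ≈⟨ Σ-reindex s-cong (λ y → k F.* y F.- l) (λ z → F.inv k F.* (z F.+ l))
                                                 (λ e → F.+-congʳ (F.*-congˡ e)) (λ e → F.*-congˡ (F.+-congʳ e)) fg gf ⟩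
      Σ𝔽 s                                  ≈⟨ δ-square-sum (disc r) ⟩
      1# + φ (disc r)                       ∎
      where
      k : F.Carrier
      k = F.nat 2 F.* (r F.* x)

      l : F.Carrier
      l = r F.+ F.1#

      k#0 : k F.# F.0#
      k#0 = F.x#0y#0→xy#0 F.2#0 (F.x#0y#0→xy#0 r#0 x#0)

      s : F.Carrier → Carrier
      s z = δ (z F.* z F.≟ disc r)

      s-cong : Congruent s
      s-cong e = δ-cong (_ F.≟ _) (_ F.≟ _) (F.trans (F.sym (F.*-cong e e))) (F.trans (F.*-cong e e))

      fg : ∀ z → k F.* (F.inv k F.* (z F.+ l)) F.- l F.≈ z
      fg z = F.trans (F.+-congʳ (F.trans (F.sym (F.*-assoc _ _ _)) (F.trans (F.*-congʳ (F.inv-inverseʳ k#0)) (F.*-identityˡ _))))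
        (F.solve 2 (λ z l → (z F.:+ l) F.:- l F.:= z) F.refl z l)

      gf : ∀ y → F.inv k F.* ((k F.* y F.- l) F.+ l) F.≈ y
      gf y = F.trans (F.*-congˡ (F.solve 2 (λ a l → (a F.:- l) F.:+ l F.:= a) F.refl (k F.* y) l))
        (F.trans (F.sym (F.*-assoc _ _ _)) (F.trans (F.*-congʳ (F.inv-inverseˡ k#0)) (F.*-identityˡ y)))

      complete-square : ∀ y → (k F.* y F.- l) F.* (k F.* y F.- l) F.- disc r F.≈
                              (F.nat 2 F.* k) F.* ((F.1# F.- y) F.- r F.* denominator y)
      complete-square y = F.solve 3 (λ r x y →
        (F.con (+ 2) F.:* (r F.:* x) F.:* y F.:- (r F.:+ F.con (+ 1))) F.:* (F.con (+ 2) F.:* (r F.:* x) F.:* y F.:- (r F.:+ F.con (+ 1)))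
          F.:- ((r F.:+ F.con (+ 1)) F.:* (r F.:+ F.con (+ 1)) F.:- F.con (+ 4) F.:* (r F.:* x))
        F.:= (F.con (+ 2) F.:* (F.con (+ 2) F.:* (r F.:* x))) F.:*
          ((F.con (+ 1) F.:- y) F.:- r F.:* (y F.:* (F.con (+ 1) F.:- x F.:* y)))) F.refl r x y

      to : ∀ y → F.1# F.- y F.≈ r F.* denominator y → (k F.* y F.- l) F.* (k F.* y F.- l) F.≈ disc r
      to y e = F.x-y≈0⇒x≈y _ _ (F.trans (complete-square y) (F.trans (F.*-congˡ (F.x≈y⇒x-y≈0 e)) (F.zeroʳ _)))

      from : ∀ y → (k F.* y F.- l) F.* (k F.* y F.- l) F.≈ disc r → F.1# F.- y F.≈ r F.* denominator y
      from y e = F.x-y≈0⇒x≈y _ _ (F.xy≈0⇒y≈0 (F.x#0y#0→xy#0 F.2#0 k#0) (F.trans (F.sym (complete-square y)) (F.x≈y⇒x-y≈0 e)))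

    -- Adding the sum of χ, which is 0, replaces φ(disc r) by 1 + φ(disc r), the number of points
    -- over r.
    Σχφ : Σ𝔽 (λ r → χ r * φ (disc r)) ≈ Σ𝔽 (λ r → Σ𝔽 (λ y → χ r * fibre r y))
    Σχφ = begin
      Σ𝔽 (λ r → χ r * φ (disc r))                       ≈⟨ +-identityˡ _ ⟨
      0# + Σ𝔽 (λ r → χ r * φ (disc r))                  ≈⟨ +-congʳ Σχ≈0 ⟨
      Σ𝔽 χ + Σ𝔽 (λ r → χ r * φ (disc r))                ≈⟨ Σ-+ χ (λ r → χ r * φ (disc r)) ⟨
      Σ𝔽 (λ r → χ r + χ r * φ (disc r))                 ≈⟨ Σ-cong (λ r → [ at-0 r , at-unit r ]′ (F.0-or-#0 r)) ⟩
      Σ𝔽 (λ r → χ r * Σ𝔽 (fibre r))                     ≈⟨ Σ-cong (λ r → Σ-*ˡ (χ r) (fibre r)) ⟩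
      Σ𝔽 (λ r → Σ𝔽 (λ y → χ r * fibre r y))             ∎
      where
      at-0 : ∀ r → r F.≈ F.0# → χ r + χ r * φ (disc r) ≈ χ r * Σ𝔽 (fibre r)
      at-0 r r≈0 = begin
        χ r + χ r * φ (disc r)    ≈⟨ +-cong (χ-0 r≈0) (trans (*-congʳ (χ-0 r≈0)) (zeroˡ _)) ⟩
        0# + 0#                   ≈⟨ +-identityʳ 0# ⟩
        0#                        ≈⟨ zeroˡ _ ⟨
        0# * Σ𝔽 (fibre r)         ≈⟨ *-congʳ (χ-0 r≈0) ⟨
        χ r * Σ𝔽 (fibre r)        ∎

      at-unit : ∀ r → r F.# F.0# → χ r + χ r * φ (disc r) ≈ χ r * Σ𝔽 (fibre r)
      at-unit r r#0 = begin
        χ r + χ r * φ (disc r)         ≈⟨ +-congʳ (*-identityʳ _) ⟨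
        χ r * 1# + χ r * φ (disc r)    ≈⟨ distribˡ (χ r) 1# (φ (disc r)) ⟨
        χ r * (1# + φ (disc r))        ≈⟨ *-congˡ (Σfibre r#0) ⟨
        χ r * Σ𝔽 (fibre r)             ∎

    -- The summand of ₂F₁ for A = χ, B = χ̄ and trivial C.
    summand : F.Carrier → Carrier
    summand y = χ̄ y * χ (F.1# F.- y) * χ̄ (F.1# F.- x F.* y)

    -- If y (1 - x y) is nonzero, exactly one r lies under y, namely its inverse times 1 - y.
    -- Otherwise the condition does not involve r, and a multiple of the vanishing sum of χ is left.
    Σχfibre : ∀ y → Σ𝔽 (λ r → χ r * fibre r y) ≈ summand y
    Σχfibre y = [ degenerate (F.1# F.- y F.≟ F.0#) , generic ]′ (F.0-or-#0 p)
      where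
      p : F.Carrier
      p = denominator y

      summand≈ : summand y ≈ χ (F.1# F.- y) * χ̄ p
      summand≈ = begin
        χ̄ y * χ (F.1# F.- y) * χ̄ (F.1# F.- x F.* y)
          ≈⟨ solve 3 (λ a b c → a :* b :* c := b :* (a :* c)) refl (χ̄ y) (χ (F.1# F.- y)) (χ̄ (F.1# F.- x F.* y)) ⟩
        χ (F.1# F.- y) * (χ̄ y * χ̄ (F.1# F.- x F.* y))   ≈⟨ *-congˡ (χ̄-* y (F.1# F.- x F.* y)) ⟨
        χ (F.1# F.- y) * χ̄ p                            ∎

      degenerate : Dec (F.1# F.- y F.≈ F.0#) → p F.≈ F.0# → Σ𝔽 (λ r → χ r * fibre r y) ≈ summand y
      degenerate 1-y? p≈0 = begin
        Σ𝔽 (λ r → χ r * fibre r y)        ≈⟨ Σ-cong (λ r → *-congˡ {χ r} (δ-cong (_ F.≟ _) 1-y?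
                                                (λ e → F.trans e (rp≈0 r)) (λ e → F.trans e (F.sym (rp≈0 r))))) ⟩
        Σ𝔽 (λ r → χ r * δ 1-y?)           ≈⟨ Σ-*ʳ (δ 1-y?) χ ⟨
        Σ𝔽 χ * δ 1-y?                     ≈⟨ trans (*-congʳ Σχ≈0) (zeroˡ _) ⟩
        0#                                ≈⟨ zeroʳ _ ⟨
        χ (F.1# F.- y) * 0#               ≈⟨ *-congˡ (χ̄-0 p≈0) ⟨
        χ (F.1# F.- y) * χ̄ p              ≈⟨ summand≈ ⟨
        summand y                         ∎
        where
        rp≈0 : ∀ r → r F.* p F.≈ F.0#
        rp≈0 r = F.trans (F.*-congˡ p≈0) (F.zeroʳ r)

      generic : p F.# F.0# → Σ𝔽 (λ r → χ r * fibre r y) ≈ summand y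
      generic p#0 = begin
        Σ𝔽 (λ r → χ r * fibre r y)
          ≈⟨ Σ-single (λ e → *-cong (χ-cong e) (δ-cong (_ F.≟ _) (_ F.≟ _) (λ e′ → F.trans e′ (F.*-congʳ e)) (λ e′ → F.trans e′ (F.sym (F.*-congʳ e)))))
               r₀ (λ r r≉r₀ → trans (*-congˡ (δ-no (_ F.≟ _) (λ e → r≉r₀ (F.*-cancelˡ-#0 p#0
                 (F.trans (F.*-comm p r) (F.trans (F.sym e) (F.trans (F.sym r₀p≈) (F.*-comm r₀ p)))))))) (zeroʳ _)) ⟩
        χ r₀ * fibre r₀ y                        ≈⟨ *-congˡ (δ-yes (_ F.≟ _) (F.sym r₀p≈)) ⟩
        χ r₀ * 1#                                ≈⟨ *-identityʳ _ ⟩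
        χ r₀                                     ≈⟨ χ-* (F.1# F.- y) (F.inv p) ⟩
        χ (F.1# F.- y) * χ (F.inv p)             ≈⟨ *-congˡ χ[inv-p]≈χ̄p ⟩
        χ (F.1# F.- y) * χ̄ p                     ≈⟨ summand≈ ⟨
        summand y                                ∎
        where
        r₀ : F.Carrier
        r₀ = (F.1# F.- y) F.* F.inv p

        r₀p≈ : r₀ F.* p F.≈ F.1# F.- y
        r₀p≈ = F.trans (F.*-assoc _ _ _) (F.trans (F.*-congˡ (F.inv-inverseˡ p#0)) (F.*-identityʳ _))

        χ-1 : χ F.1# ≈ 1#
        χ-1 = *-cancelˡ-#0 (invertible⇒#0 (χ̄ F.1#) (trans (*-comm _ _) (χ*χ̄≈1 F.1#0)))
          (trans (sym (χ-* F.1# F.1#)) (trans (χ-cong (F.*-identityˡ F.1#)) (sym (*-identityʳ _))))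

        χ[inv-p]≈χ̄p : χ (F.inv p) ≈ χ̄ p
        χ[inv-p]≈χ̄p = *-cancelˡ-#0 (invertible⇒#0 (χ̄ p) (trans (*-comm _ _) (χ*χ̄≈1 p#0))) (begin
          χ p * χ (F.inv p)      ≈⟨ χ-* p (F.inv p) ⟨
          χ (p F.* F.inv p)      ≈⟨ χ-cong (F.inv-inverseʳ p#0) ⟩
          χ F.1#                 ≈⟨ χ-1 ⟩
          1#                     ≈⟨ χ*χ̄≈1 p#0 ⟨
          χ p * χ̄ p              ∎)

    Σφ[D₃+c]≈Σsummand : Σ𝔽 (λ v → φ (F.D₃ v F.+ c)) ≈ Σ𝔽 summand
    Σφ[D₃+c]≈Σsummand = begin
      Σ𝔽 (λ v → φ (F.D₃ v F.+ c))                  ≈⟨ Σφ[D₃+c] c ⟩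
      Σ𝔽 (λ u → Σω u * φ (u F.+ c))                ≈⟨ Σωφ ⟩
      Σ𝔽 (λ r → χ r * φ (disc r))                  ≈⟨ Σχφ ⟩
      Σ𝔽 (λ r → Σ𝔽 (λ y → χ r * fibre r y))        ≈⟨ Σ-comm (λ r y → χ r * fibre r y) ⟩
      Σ𝔽 (λ y → Σ𝔽 (λ r → χ r * fibre r y))        ≈⟨ Σ-cong Σχfibre ⟩
      Σ𝔽 summand                                   ∎

-- Values of the composite characters in ₂F₁

module HypergeometricValue {q c ℓ₁ ℓ₂ c′ ℓ₁′ ℓ₂′} (𝔽 : FiniteField q c ℓ₁ ℓ₂) (𝕂 : AlgClosedField₀ c′ ℓ₁′ ℓ₂′) where
  private
    module F where
      open FiniteField 𝔽 public
      open FiniteFieldProperties 𝔽 public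
  open FieldOps (AlgClosedField₀.heytingField 𝕂) hiding (zero)
  open FieldProperties (AlgClosedField₀.heytingField 𝕂)
  open Characters 𝔽 𝕂
  open CharacterValues 𝔽 𝕂
  open FieldSums 𝔽 𝕂
  open SumProperties +-commutativeMonoid using (sum-cong-≋)
  open GroupHomomorphism using (⟦_⟧)
  open SetoidReasoning setoid

  ⟨⟩≈⟪⟫ : ∀ χ x → χ ⟨ x ⟩ ≈ χ ⟪ x ⟫
  ⟨⟩≈⟪⟫ χ x = reflexive (≡.sym (⟪⟫≡⟨⟩ χ x))

  -- Serves to read compound characters of ₂F₁, such as the inverse of B times ε, as A or B; the
  -- value at 0 agrees by convention.
  ⟨⟩-value : ∀ χ ψ → (∀ u → proj₁ (⟦ χ ⟧ u) ≈ proj₁ (⟦ ψ ⟧ u)) → ∀ z → χ ⟨ z ⟩ ≈ ψ ⟪ z ⟫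
  ⟨⟩-value χ ψ χ≈ψ z = trans (⟨⟩≈⟪⟫ χ z) ([ at-0 , at-unit ]′ (F.0-or-#0 z))
    where
    at-0 : z F.≈ F.0# → χ ⟪ z ⟫ ≈ ψ ⟪ z ⟫
    at-0 z≈0 = trans (⟪⟫-0 χ z≈0) (sym (⟪⟫-0 ψ z≈0))

    at-unit : z F.# F.0# → χ ⟪ z ⟫ ≈ ψ ⟪ z ⟫
    at-unit z#0 = trans (⟪⟫-unit χ z#0) (trans (χ≈ψ (z , z#0)) (sym (⟪⟫-unit ψ z#0)))

  ⟨⟩-value-1 : ∀ χ → (∀ u → proj₁ (⟦ χ ⟧ u) ≈ 1#) → ∀ {z} → z F.# F.0# → χ ⟨ z ⟩ ≈ 1#
  ⟨⟩-value-1 χ χ≈1 {z} z#0 = trans (⟨⟩≈⟪⟫ χ z) (trans (⟪⟫-unit χ z#0) (χ≈1 (z , z#0)))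

  recip-value : ∀ A B → (∀ {x} → x F.# F.0# → A ⟪ x ⟫ * B ⟪ x ⟫ ≈ 1#) →
                ∀ u → recip (proj₂ (⟦ A ⟧ u)) ≈ proj₁ (⟦ B ⟧ u)
  recip-value A B AB≈1 (x , x#0) = *-cancelˡ-#0 (proj₂ (⟦ A ⟧ (x , x#0)))
    (trans (recip-inverseʳ (proj₂ (⟦ A ⟧ (x , x#0)))) (sym (trans
      (sym (*-cong (⟪⟫-unit A x#0) (⟪⟫-unit B x#0))) (AB≈1 x#0))))

-- The cubic behind the quartic sum

module CubicModel {q c ℓ₁ ℓ₂} (𝔽 : FiniteField q c ℓ₁ ℓ₂) (m : ℕ) (q≡ : q ≡ suc (m ℕ.* 6)) where
  open FiniteField 𝔽 hiding (sum; zero)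
  open SexticStructure 𝔽 m q≡
  open FiniteFieldProperties 𝔽
  open CubicDickson 𝔽 m q≡ using (D₃)
  open SetoidReasoning setoid

  -- What is left of the quartic at x = a/z once the square factor a²/z⁴ is removed.
  Π₃ : (a b c z : Carrier) → Carrier
  Π₃ a b c z = (1# + z) * ((a + b * z) * (a + c * z))

  -- `P`, `Q`, `R` are the lower coefficients of the cubic divided by b c. They are given through
  -- their products with b c, which keeps division out of the identities.
  module _ {a b c h P Q R f g : Carrier}
           (P*bc : P * (b * c) ≈ a * b + b * c + c * a)
           (Q*bc : Q * (b * c) ≈ a * b + c * a + a ^ 2)
           (R*bc : R * (b * c) ≈ a ^ 2)
           (critical : nat 3 * h ^ 2 + nat 2 * P * h + Q ≈ 0#)
           (f≈ : f ≈ nat 3 * h + P)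
           (g≈ : g ≈ h ^ 3 + P * h ^ 2 + Q * h + R) where

    -- Taylor expansion at h: up to the factor b c, g is the value, f half the second derivative,
    -- and the linear coefficient is the derivative, which `critical` makes zero.
    Π₃≈cubic : ∀ w → Π₃ a b c (h + w) ≈ b * c * (w ^ 3 + f * w ^ 2 + g)
    Π₃≈cubic w = begin
      Π₃ a b c z
        ≈⟨ solve 4 (λ a b c z → (con (+ 1) :+ z) :* ((a :+ b :* z) :* (a :+ c :* z)) :=
             b :* c :* z :^ 3 :+ (a :* b :+ b :* c :+ c :* a) :* z :^ 2 :+ (a :* b :+ c :* a :+ a :^ 2) :* z :+ a :^ 2) refl a b c z ⟩
      b * c * z ^ 3 + (a * b + b * c + c * a) * z ^ 2 + (a * b + c * a + a ^ 2) * z + a ^ 2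
        ≈⟨ +-cong (+-cong (+-congˡ (*-congʳ P*bc)) (*-congʳ Q*bc)) R*bc ⟨
      b * c * z ^ 3 + P * (b * c) * z ^ 2 + Q * (b * c) * z + R * (b * c)
        ≈⟨ solve 6 (λ k P Q R h w → k :* (h :+ w) :^ 3 :+ P :* k :* (h :+ w) :^ 2 :+ Q :* k :* (h :+ w) :+ R :* k :=
             k :* (w :^ 3 :+ (con (+ 3) :* h :+ P) :* w :^ 2 :+ (h :^ 3 :+ P :* h :^ 2 :+ Q :* h :+ R))
             :+ (con (+ 3) :* h :^ 2 :+ con (+ 2) :* P :* h :+ Q) :* (k :* w)) refl (b * c) P Q R h w ⟩
      b * c * (w ^ 3 + (nat 3 * h + P) * w ^ 2 + (h ^ 3 + P * h ^ 2 + Q * h + R)) + (nat 3 * h ^ 2 + nat 2 * P * h + Q) * (b * c * w)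
        ≈⟨ +-cong (*-congˡ (+-cong (+-congˡ (*-congʳ (sym f≈))) (sym g≈))) (trans (*-congʳ critical) (zeroˡ _)) ⟩
      b * c * (w ^ 3 + f * w ^ 2 + g) + 0#
        ≈⟨ +-identityʳ _ ⟩
      b * c * (w ^ 3 + f * w ^ 2 + g) ∎
      where
      z : Carrier
      z = h + w

    -- The left side is the derivative of `Π₃` at h by the product rule, and equals b c times the
    -- left side of `critical`.
    Π₃′≈0 : (a + b * h) * (a + c * h) + (b * ((1# + h) * (a + c * h)) + c * ((1# + h) * (a + b * h))) ≈ 0#
    Π₃′≈0 = begin
      (a + b * h) * (a + c * h) + (b * ((1# + h) * (a + c * h)) + c * ((1# + h) * (a + b * h)))
        ≈⟨ solve 4 (λ a b c h → (a :+ b :* h) :* (a :+ c :* h) :+ (b :* ((con (+ 1) :+ h) :* (a :+ c :* h)) :+ c :* ((con (+ 1) :+ h) :* (a :+ b :* h)))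
             := con (+ 3) :* h :^ 2 :* (b :* c) :+ con (+ 2) :* h :* (a :* b :+ b :* c :+ c :* a) :+ (a :* b :+ c :* a :+ a :^ 2)) refl a b c h ⟩
      nat 3 * h ^ 2 * (b * c) + nat 2 * h * (a * b + b * c + c * a) + (a * b + c * a + a ^ 2)
        ≈⟨ +-cong (+-congˡ (*-congˡ P*bc)) Q*bc ⟨
      nat 3 * h ^ 2 * (b * c) + nat 2 * h * (P * (b * c)) + Q * (b * c)
        ≈⟨ solve 4 (λ k h P Q → con (+ 3) :* h :^ 2 :* k :+ con (+ 2) :* h :* (P :* k) :+ Q :* k
             := (con (+ 3) :* h :^ 2 :+ con (+ 2) :* P :* h :+ Q) :* k) refl (b * c) h P Q ⟩
      (nat 3 * h ^ 2 + nat 2 * P * h + Q) * (b * c)   ≈⟨ trans (*-congʳ critical) (zeroˡ _) ⟩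
      0# ∎

    -- g vanishes only if h is a double root of the cubic, whose roots -1, -a/b, -a/c are distinct.
    g#0 : ¬ a ≈ b → ¬ b ≈ c → ¬ c ≈ a → b # 0# → c # 0# → h # 0# → g # 0#
    g#0 a≉b b≉c c≉a b#0 c#0 h#0 = ≉0⇒#0 λ g≈0 →
      [ first , (λ e → [ second , third′ ]′ (xy≈0⇒x≈0⊎y≈0 e)) ]′ (xy≈0⇒x≈0⊎y≈0 (Π₃h≈0 g≈0))
      where
      X Y Z : Carrier
      X = 1# + h
      Y = a + b * h
      Z = a + c * h

      Π₃h≈0 : g ≈ 0# → X * (Y * Z) ≈ 0#
      Π₃h≈0 g≈0 = begin
        Π₃ a b c h           ≈⟨ *-cong (+-congˡ h≈h+0) (*-cong (+-congˡ (*-congˡ h≈h+0)) (+-congˡ (*-congˡ h≈h+0))) ⟩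
        Π₃ a b c (h + 0#)    ≈⟨ Π₃≈cubic 0# ⟩
        b * c * (0# ^ 3 + f * 0# ^ 2 + g)   ≈⟨ *-congˡ (+-congˡ g≈0) ⟩
        b * c * (0# ^ 3 + f * 0# ^ 2 + 0#)
          ≈⟨ solve 2 (λ k f → k :* (con (+ 0) :^ 3 :+ f :* con (+ 0) :^ 2 :+ con (+ 0)) := con (+ 0)) refl (b * c) f ⟩
        0#                   ∎
        where
        h≈h+0 : h ≈ h + 0#
        h≈h+0 = sym (+-identityʳ h)

      not-XY : X ≈ 0# → ¬ Y ≈ 0#
      not-XY X≈0 Y≈0 = a≉b (x-y≈0⇒x≈y _ _ (trans
        (solve 3 (λ a b h → a :- b := (a :+ b :* h) :- b :* (con (+ 1) :+ h)) refl a b h)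
        (trans (+-cong Y≈0 (-‿cong (trans (*-congˡ X≈0) (zeroʳ b)))) (-‿inverseʳ 0#))))

      not-XZ : X ≈ 0# → ¬ Z ≈ 0#
      not-XZ X≈0 Z≈0 = c≉a (sym (x-y≈0⇒x≈y _ _ (trans
        (solve 3 (λ a b h → a :- b := (a :+ b :* h) :- b :* (con (+ 1) :+ h)) refl a c h)
        (trans (+-cong Z≈0 (-‿cong (trans (*-congˡ X≈0) (zeroʳ c)))) (-‿inverseʳ 0#)))))

      not-YZ : Y ≈ 0# → ¬ Z ≈ 0#
      not-YZ Y≈0 Z≈0 = b≉c (x-y≈0⇒x≈y _ _ (xy≈0⇒y≈0 h#0 (trans
        (solve 4 (λ a b c h → h :* (b :- c) := (a :+ b :* h) :- (a :+ c :* h)) refl a b c h)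
        (trans (+-cong Y≈0 (-‿cong Z≈0)) (-‿inverseʳ 0#)))))

      -- When one factor vanishes, the derivative reduces to the product of the other two, up to a
      -- unit. So a second factor vanishes, and two of a, b, c coincide.
      first : ¬ X ≈ 0#
      first X≈0 = [ not-XY X≈0 , not-XZ X≈0 ]′ (xy≈0⇒x≈0⊎y≈0 (trans
        (sym (trans (+-congˡ (trans (+-cong (trans (*-congˡ (trans (*-congʳ X≈0) (zeroˡ Z))) (zeroʳ b))
                                            (trans (*-congˡ (trans (*-congʳ X≈0) (zeroˡ Y))) (zeroʳ c))) (+-identityʳ 0#))) (+-identityʳ _)))
        Π₃′≈0))

      second : ¬ Y ≈ 0#
      second Y≈0 = [ (λ X≈0 → not-XY X≈0 Y≈0) , not-YZ Y≈0 ]′ (xy≈0⇒x≈0⊎y≈0 (xy≈0⇒y≈0 b#0 (trans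
        (sym (trans (+-cong (trans (*-congʳ Y≈0) (zeroˡ Z)) (trans (+-congˡ (trans (*-congˡ (trans (*-congˡ Y≈0) (zeroʳ X))) (zeroʳ c))) (+-identityʳ _))) (+-identityˡ _)))
        Π₃′≈0)))

      third′ : ¬ Z ≈ 0#
      third′ Z≈0 = [ (λ X≈0 → not-XZ X≈0 Z≈0) , (λ Y≈0 → not-YZ Y≈0 Z≈0) ]′ (xy≈0⇒x≈0⊎y≈0 (xy≈0⇒y≈0 c#0 (trans
        (sym (trans (+-cong (trans (*-congˡ Z≈0) (zeroʳ Y)) (trans (+-congʳ (trans (*-congˡ (trans (*-congˡ Z≈0) (zeroʳ X))) (zeroʳ b))) (+-identityˡ _))) (+-identityˡ _)))
        Π₃′≈0)))

    module _ (f#0 : f # 0#) {x : Carrier} (4f³x≈-27g : x * (nat 4 * f ^ 3) ≈ - (nat 27 * g)) where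

      ⅓ : Carrier
      ⅓ = inv (nat 3)

      3*⅓≈1 : nat 3 * ⅓ ≈ 1#
      3*⅓≈1 = inv-inverseʳ 3#0

      -- The substitution w = (f/3)(v - 1) is forced by w³ + f w² = (f/3)³ (v³ - 3v + 2). By the
      -- choice of x, the constant g contributes -4x inside the same bracket.
      slope : Carrier
      slope = f * ⅓

      slope#0 : slope # 0#
      slope#0 = x#0y#0→xy#0 f#0 (inv#0 3#0)

      -- The factor (f/3)³ is written as (f/9)² times 3f, so that the quadratic character sees only
      -- 3f.
      Π₃≈D₃ : ∀ v → Π₃ a b c (h + slope * (v - 1#)) ≈
                    b * c * ((slope * ⅓) * (slope * ⅓) * ((nat 3 * f) * (D₃ v + (nat 2 - nat 4 * x))))
      Π₃≈D₃ v = trans (Π₃≈cubic (slope * (v - 1#))) (*-congˡ (sym (begin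
        (slope * ⅓) * (slope * ⅓) * ((nat 3 * f) * (D₃ v + (nat 2 - nat 4 * x)))
          ≈⟨ solve 4 (λ f t v x → (f :* t :* t) :* (f :* t :* t) :* ((con (+ 3) :* f) :* ((v :^ 3 :- con (+ 3) :* v) :+ (con (+ 2) :- con (+ 4) :* x))) :=
               (con (+ 3) :* t) :* (f :^ 3 :* t :^ 3 :* (v :- con (+ 1)) :^ 3)
               :+ (con (+ 3) :* t) :* (con (+ 3) :* t) :* (f :^ 3 :* t :^ 2 :* (v :- con (+ 1)) :^ 2)
               :- (con (+ 3) :* t) :* t :^ 3 :* (x :* (con (+ 4) :* f :^ 3))) refl f ⅓ v x ⟩
        (nat 3 * ⅓) * (f ^ 3 * ⅓ ^ 3 * (v - 1#) ^ 3) + (nat 3 * ⅓) * (nat 3 * ⅓) * (f ^ 3 * ⅓ ^ 2 * (v - 1#) ^ 2)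
          - (nat 3 * ⅓) * ⅓ ^ 3 * (x * (nat 4 * f ^ 3))
          ≈⟨ +-cong (+-cong (*-congʳ 3*⅓≈1) (*-congʳ (*-cong 3*⅓≈1 3*⅓≈1))) (-‿cong (*-cong (*-congʳ 3*⅓≈1) 4f³x≈-27g)) ⟩
        1# * (f ^ 3 * ⅓ ^ 3 * (v - 1#) ^ 3) + 1# * 1# * (f ^ 3 * ⅓ ^ 2 * (v - 1#) ^ 2) - 1# * ⅓ ^ 3 * (- (nat 27 * g))
          ≈⟨ solve 4 (λ f t v g → con (+ 1) :* (f :^ 3 :* t :^ 3 :* (v :- con (+ 1)) :^ 3) :+ con (+ 1) :* con (+ 1) :* (f :^ 3 :* t :^ 2 :* (v :- con (+ 1)) :^ 2)
                 :- con (+ 1) :* t :^ 3 :* (:- (con (+ 27) :* g)) :=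
               (f :* t :* (v :- con (+ 1))) :^ 3 :+ f :* (f :* t :* (v :- con (+ 1))) :^ 2 :+ (con (+ 3) :* t) :^ 3 :* g) refl f ⅓ v g ⟩
        (slope * (v - 1#)) ^ 3 + f * (slope * (v - 1#)) ^ 2 + (nat 3 * ⅓) ^ 3 * g
          ≈⟨ +-congˡ (trans (*-congʳ (trans (^-congˡ 3 3*⅓≈1) (1^n≈1 3))) (*-identityˡ g)) ⟩
        (slope * (v - 1#)) ^ 3 + f * (slope * (v - 1#)) ^ 2 + g ∎)))

  critical-×ⁿ : ∀ {h P Q} → 3 ×ⁿ (h ^ 2) + (2 ×ⁿ P) * h + Q ≈ 0# → nat 3 * h ^ 2 + nat 2 * P * h + Q ≈ 0#
  critical-×ⁿ {h} {P} e = trans (sym (+-congʳ (+-cong (×ⁿ≈nat* 3 (h ^ 2)) (*-congʳ (×ⁿ≈nat* 2 P))))) e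

-- The quartic sum as a sum over the cubic

module LegendreSum {q c ℓ₁ ℓ₂ c′ ℓ₁′ ℓ₂′} (𝔽 : FiniteField q c ℓ₁ ℓ₂) (𝕂 : AlgClosedField₀ c′ ℓ₁′ ℓ₂′)
                  (m : ℕ) (q≡ : q ≡ suc (m ℕ.* 6))
                  (χ χ̄ : FiniteField.Carrier 𝔽 → FieldOps.Carrier (AlgClosedField₀.heytingField 𝕂))
                  (χ-sextic : IsSexticCharacter 𝔽 𝕂 χ χ̄) where
  private
    module F where
      open FiniteField 𝔽 public
      open SexticStructure 𝔽 m q≡ public
      open FiniteFieldProperties 𝔽 public
      open CubicDickson 𝔽 m q≡ public
      open CubicModel 𝔽 m q≡ public
  open FieldOps (AlgClosedField₀.heytingField 𝕂) hiding (zero)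
  open FieldProperties (AlgClosedField₀.heytingField 𝕂)
  open Characters 𝔽 𝕂 using (φ; Σ𝔽; φ₁₁₁)
  open QuadraticCharacter 𝔽 𝕂
  open FieldSums 𝔽 𝕂
  open IsSexticCharacter χ-sextic
  open SexticSums 𝔽 𝕂 m q≡ χ χ̄ χ-sextic
  open SumProperties +-commutativeMonoid using (sum-cong-≋)
  open SetoidReasoning setoid

  φ₁₁₁-values : ∀ a b c → φ₁₁₁ a b c ≈ Σ𝔽 (λ x → χ x ^ 3 * χ (x F.+ a) ^ 3 * χ (x F.+ b) ^ 3 * χ (x F.+ c) ^ 3)
  φ₁₁₁-values a b c = sum-cong-≋ {q} (λ i → *-cong (*-cong (*-cong (φ≈χ³ _) (φ≈χ³ _)) (φ≈χ³ _)) (φ≈χ³ _))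

  χ³-product : ∀ x y z w → χ x ^ 3 * χ y ^ 3 * χ z ^ 3 * χ w ^ 3 ≈ φ (x F.* y F.* z F.* w)
  χ³-product x y z w = begin
    χ x ^ 3 * χ y ^ 3 * χ z ^ 3 * χ w ^ 3      ≈⟨ *-cong (*-cong (*-cong (φ≈χ³ x) (φ≈χ³ y)) (φ≈χ³ z)) (φ≈χ³ w) ⟨
    φ x * φ y * φ z * φ w                      ≈⟨ *-congʳ (*-congʳ (φ-* x y)) ⟨
    φ (x F.* y) * φ z * φ w                    ≈⟨ *-congʳ (φ-* (x F.* y) z) ⟨
    φ (x F.* y F.* z) * φ w                    ≈⟨ φ-* (x F.* y F.* z) w ⟨
    φ (x F.* y F.* z F.* w)                    ∎

  quartic : (a b c x : F.Carrier) → F.Carrier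
  quartic a b c x = x F.* (x F.+ a) F.* (x F.+ b) F.* (x F.+ c)

  quartic-cong : ∀ a b c {x y} → x F.≈ y → quartic a b c x F.≈ quartic a b c y
  quartic-cong a b c e = F.*-cong (F.*-cong (F.*-cong e (F.+-congʳ e)) (F.+-congʳ e)) (F.+-congʳ e)

  -- x = a/z turns the quartic into a² z⁻⁴ times a cubic; only the point z = 0 is lost.
  Σφ-quartic : ∀ {a} b c → a F.# F.0# →
               Σ𝔽 (λ x → φ (quartic a b c x)) ≈ - 1# + Σ𝔽 (λ z → φ (F.Π₃ a b c z))
  Σφ-quartic {a} b c a#0 = begin
    Σ𝔽 (λ x → φ (quartic a b c x))                       ≈⟨ Σ-reindex (λ e → φ-cong (quartic-cong a b c e)) τ τ τ-cong τ-cong ττ ττ ⟨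
    Σ𝔽 (λ z → φ (quartic a b c (τ z)))                   ≈⟨ Σ-cong (λ z → [ at-0 z , at-unit z ]′ (F.0-or-#0 z)) ⟩
    Σ𝔽 (λ z → δ (z F.≟ F.0#) * - 1# + φ (F.Π₃ a b c z))  ≈⟨ Σ-+ (λ z → δ (z F.≟ F.0#) * - 1#) (λ z → φ (F.Π₃ a b c z)) ⟩
    Σ𝔽 (λ z → δ (z F.≟ F.0#) * - 1#) + Σ𝔽 (λ z → φ (F.Π₃ a b c z)) ≈⟨ +-congʳ Σδ≈-1 ⟩
    - 1# + Σ𝔽 (λ z → φ (F.Π₃ a b c z))                   ∎
    where
    τ : F.Carrier → F.Carrier
    τ z = a F.* F.inv z

    τ-0 : ∀ {z} → z F.≈ F.0# → τ z F.≈ F.0#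
    τ-0 z≈0 = F.trans (F.*-congˡ (F.inv-0 z≈0)) (F.zeroʳ a)

    τ#0 : ∀ {z} → z F.# F.0# → τ z F.# F.0#
    τ#0 z#0 = F.x#0y#0→xy#0 a#0 (F.inv#0 z#0)

    z*τz≈a : ∀ {z} → z F.# F.0# → z F.* τ z F.≈ a
    z*τz≈a {z} z#0 = F.trans (F.solve 3 (λ z a i → z F.:* (a F.:* i) F.:= a F.:* (z F.:* i)) F.refl z a (F.inv z))
      (F.trans (F.*-congˡ (F.inv-inverseʳ z#0)) (F.*-identityʳ a))

    τ-cong : ∀ {y z} → y F.≈ z → τ y F.≈ τ z
    τ-cong {y} {z} y≈z = [ by-0 , by-unit ]′ (F.0-or-#0 z)
      where
      by-0 : z F.≈ F.0# → τ y F.≈ τ z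
      by-0 z≈0 = F.trans (τ-0 (F.trans y≈z z≈0)) (F.sym (τ-0 z≈0))

      by-unit : z F.# F.0# → τ y F.≈ τ z
      by-unit z#0 = F.*-cancelˡ-#0 z#0 (F.trans (F.*-congʳ (F.sym y≈z))
        (F.trans (z*τz≈a (F.≈-resp-#0 (F.sym y≈z) z#0)) (F.sym (z*τz≈a z#0))))

    ττ : ∀ z → τ (τ z) F.≈ z
    ττ z = [ by-0 , by-unit ]′ (F.0-or-#0 z)
      where
      by-0 : z F.≈ F.0# → τ (τ z) F.≈ z
      by-0 z≈0 = F.trans (τ-0 (τ-0 z≈0)) (F.sym z≈0)

      by-unit : z F.# F.0# → τ (τ z) F.≈ z
      by-unit z#0 = F.*-cancelˡ-#0 (τ#0 z#0) (F.trans (z*τz≈a (τ#0 z#0))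
        (F.trans (F.sym (z*τz≈a z#0)) (F.*-comm z (τ z))))

    Σδ≈-1 : Σ𝔽 (λ z → δ (z F.≟ F.0#) * - 1#) ≈ - 1#
    Σδ≈-1 = trans (Σ-single (λ e → *-congʳ (δ-cong (_ F.≟ _) (_ F.≟ _) (F.trans (F.sym e)) (F.trans e))) F.0#
        (λ z z≉0 → trans (*-congʳ (δ-no (z F.≟ F.0#) z≉0)) (zeroˡ (- 1#))))
      (trans (*-congʳ (δ-yes (F.0# F.≟ F.0#) F.refl)) (*-identityˡ (- 1#)))

    -- The origin of the -1: the quartic vanishes at τ 0 = 0, whereas the cubic takes there the
    -- nonzero square value a².
    at-0 : ∀ z → z F.≈ F.0# → φ (quartic a b c (τ z)) ≈ δ (z F.≟ F.0#) * - 1# + φ (F.Π₃ a b c z)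
    at-0 z z≈0 = begin
      φ (quartic a b c (τ z))      ≈⟨ φ-0 (F.trans (quartic-cong a b c (τ-0 z≈0))
                                        (F.solve 3 (λ a b c → F.con (+ 0) F.:* (F.con (+ 0) F.:+ a) F.:* (F.con (+ 0) F.:+ b) F.:* (F.con (+ 0) F.:+ c) F.:= F.con (+ 0)) F.refl a b c)) ⟩
      0#                           ≈⟨ -‿inverseˡ 1# ⟨
      - 1# + 1#                    ≈⟨ +-cong (trans (*-congʳ (δ-yes (z F.≟ F.0#) z≈0)) (*-identityˡ (- 1#)))
                                             (φ-square (F.≈-resp-#0 Π₃≈a² (F.x#0y#0→xy#0 a#0 a#0)) (a , Π₃≈a²)) ⟨
      δ (z F.≟ F.0#) * - 1# + φ (F.Π₃ a b c z)   ∎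
      where
      Π₃≈a² : a F.* a F.≈ F.Π₃ a b c z
      Π₃≈a² = F.trans (F.solve 3 (λ a b c → a F.:* a F.:= (F.con (+ 1) F.:+ F.con (+ 0)) F.:* ((a F.:+ b F.:* F.con (+ 0)) F.:* (a F.:+ c F.:* F.con (+ 0)))) F.refl a b c)
        (F.sym (F.*-cong (F.+-congˡ z≈0) (F.*-cong (F.+-congˡ (F.*-congˡ z≈0)) (F.+-congˡ (F.*-congˡ z≈0)))))

    at-unit : ∀ z → z F.# F.0# → φ (quartic a b c (τ z)) ≈ δ (z F.≟ F.0#) * - 1# + φ (F.Π₃ a b c z)
    at-unit z z#0 = begin
      φ (quartic a b c (τ z))
        ≈⟨ φ-square-* (quartic a b c (τ z)) (F.x#0y#0→xy#0 z#0 z#0) ⟨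
      φ ((z F.* z) F.* (z F.* z) F.* quartic a b c (τ z))
        ≈⟨ φ-cong rescale ⟩
      φ (a F.* a F.* F.Π₃ a b c z)
        ≈⟨ φ-square-* (F.Π₃ a b c z) a#0 ⟩
      φ (F.Π₃ a b c z)
        ≈⟨ +-identityˡ _ ⟨
      0# + φ (F.Π₃ a b c z)
        ≈⟨ +-congʳ (trans (*-congʳ (δ-no (z F.≟ F.0#) (F.#⇒≉ z#0))) (zeroˡ (- 1#))) ⟨
      δ (z F.≟ F.0#) * - 1# + φ (F.Π₃ a b c z) ∎
      where
      rescale : (z F.* z) F.* (z F.* z) F.* quartic a b c (τ z) F.≈ a F.* a F.* F.Π₃ a b c z
      rescale = F.trans
        (F.solve 5 (λ a b c z x → (z F.:* z) F.:* (z F.:* z) F.:* (x F.:* (x F.:+ a) F.:* (x F.:+ b) F.:* (x F.:+ c)) F.:=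
          (z F.:* x) F.:* ((z F.:* x) F.:+ z F.:* a) F.:* ((z F.:* x) F.:+ z F.:* b) F.:* ((z F.:* x) F.:+ z F.:* c)) F.refl a b c z (τ z))
        (F.trans (F.*-cong (F.*-cong (F.*-cong (z*τz≈a z#0) (F.+-congʳ (z*τz≈a z#0))) (F.+-congʳ (z*τz≈a z#0))) (F.+-congʳ (z*τz≈a z#0)))
          (F.solve 4 (λ a b c z → a F.:* (a F.:+ z F.:* a) F.:* (a F.:+ z F.:* b) F.:* (a F.:+ z F.:* c) F.:=
            a F.:* a F.:* ((F.con (+ 1) F.:+ z) F.:* ((a F.:+ b F.:* z) F.:* (a F.:+ c F.:* z)))) F.refl a b c z))

  Σφ-affine : ∀ {p : F.Carrier → F.Carrier} → (∀ {y z} → y F.≈ z → p y F.≈ p z) →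
    ∀ {h s k e} {r : F.Carrier → F.Carrier} → s F.# F.0# → e F.# F.0# →
    (∀ v → p (h F.+ s F.* (v F.- F.1#)) F.≈ k F.* (e F.* e F.* r v)) →
    Σ𝔽 (λ z → φ (p z)) ≈ φ k * Σ𝔽 (λ v → φ (r v))
  Σφ-affine {p} p-cong {h} {s} {k} {e} {r} s#0 e#0 p≈ = begin
    Σ𝔽 (λ z → φ (p z))
      ≈⟨ Σ-reindex (λ y≈z → φ-cong (p-cong y≈z)) (λ v → h F.+ s F.* (v F.- F.1#)) (λ z → F.inv s F.* (z F.- h) F.+ F.1#)
           (λ v≈w → F.+-congˡ (F.*-congˡ (F.+-congʳ v≈w))) (λ v≈w → F.+-congʳ (F.*-congˡ (F.+-congʳ v≈w))) fg gf ⟨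
    Σ𝔽 (λ v → φ (p (h F.+ s F.* (v F.- F.1#))))
      ≈⟨ Σ-cong (λ v → trans (φ-cong (p≈ v)) (trans (φ-* k (e F.* e F.* r v)) (*-congˡ (φ-square-* (r v) e#0)))) ⟩
    Σ𝔽 (λ v → φ k * φ (r v))
      ≈⟨ Σ-*ˡ (φ k) (λ v → φ (r v)) ⟨
    φ k * Σ𝔽 (λ v → φ (r v)) ∎
    where
    cancel : ∀ y → s F.* (F.inv s F.* y) F.≈ y
    cancel y = F.trans (F.sym (F.*-assoc _ _ _)) (F.trans (F.*-congʳ (F.inv-inverseʳ s#0)) (F.*-identityˡ y))

    fg : ∀ z → h F.+ s F.* ((F.inv s F.* (z F.- h) F.+ F.1#) F.- F.1#) F.≈ z
    fg z = F.trans (F.solve 3 (λ h s y → h F.:+ s F.:* ((y F.:+ F.con (+ 1)) F.:- F.con (+ 1)) F.:= h F.:+ s F.:* y) F.refl h s (F.inv s F.* (z F.- h)))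
      (F.trans (F.+-congˡ (cancel (z F.- h))) (F.solve 2 (λ h z → h F.:+ (z F.:- h) F.:= z) F.refl h z))

    gf : ∀ v → F.inv s F.* ((h F.+ s F.* (v F.- F.1#)) F.- h) F.+ F.1# F.≈ v
    gf v = F.trans (F.+-congʳ (F.trans (F.*-congˡ (F.solve 2 (λ h y → (h F.:+ y) F.:- h F.:= y) F.refl h (s F.* (v F.- F.1#))))
        (F.trans (F.sym (F.*-assoc _ _ _)) (F.trans (F.*-congʳ (F.inv-inverseˡ s#0)) (F.*-identityˡ _)))))
      (F.solve 1 (λ v → (v F.:- F.con (+ 1)) F.:+ F.con (+ 1) F.:= v) F.refl v)

  -- The product is χ²(-1) = χ(1). It cancels the factor B(-1) of ₂F₁ against the sign φ(-1) between
  -- φ(-3f) and φ(3f).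
  φ[-1]*χ̄[-1]≈1 : φ (F.- F.1#) * χ̄ (F.- F.1#) ≈ 1#
  φ[-1]*χ̄[-1]≈1 = begin
    φ n * χ̄ n                  ≈⟨ *-congʳ (φ≈χ³ n) ⟩
    χ n ^ 3 * χ̄ n              ≈⟨ solve 2 (λ a b → a :^ 3 :* b := (a :* a) :* (a :* b)) refl (χ n) (χ̄ n) ⟩
    (χ n * χ n) * (χ n * χ̄ n)  ≈⟨ *-cong (χ-* n n) (sym (χ*χ̄≈1 n#0)) ⟨
    χ (n F.* n) * 1#           ≈⟨ *-identityʳ _ ⟩
    χ (n F.* n)                ≈⟨ χ-cong (F.solve 0 ((F.:- F.con (+ 1)) F.:* (F.:- F.con (+ 1)) F.:= F.con (+ 1)) F.refl) ⟩
    χ F.1#                     ≈⟨ trans (sym (*-identityʳ _)) (trans (*-congˡ (sym χ̄-1)) (χ*χ̄≈1 F.1#0)) ⟩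
    1#                         ∎
    where
    n : F.Carrier
    n = F.- F.1#

    n#0 : n F.# F.0#
    n#0 = F.invertible⇒#0 n (F.solve 0 ((F.:- F.con (+ 1)) F.:* (F.:- F.con (+ 1)) F.:= F.con (+ 1)) F.refl)

-- Evaluation of the quartic sum

module LegendreEvaluation {q c ℓ₁ ℓ₂ c′ ℓ₁′ ℓ₂′} (𝔽 : FiniteField q c ℓ₁ ℓ₂) (𝕂 : AlgClosedField₀ c′ ℓ₁′ ℓ₂′)
                  (m : ℕ) (q≡ : q ≡ suc (m ℕ.* 6))
                  (χ χ̄ : FiniteField.Carrier 𝔽 → FieldOps.Carrier (AlgClosedField₀.heytingField 𝕂))
                  (χ-sextic : IsSexticCharacter 𝔽 𝕂 χ χ̄) where
  private
    module F where
      open FiniteField 𝔽 public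
      open SexticStructure 𝔽 m q≡ public
      open FiniteFieldProperties 𝔽 public
      open CubicDickson 𝔽 m q≡ public
      open CubicModel 𝔽 m q≡ public
  open FieldOps (AlgClosedField₀.heytingField 𝕂) hiding (zero)
  open FieldProperties (AlgClosedField₀.heytingField 𝕂)
  open Characters 𝔽 𝕂 using (φ; Σ𝔽; φ₁₁₁)
  open FieldSums 𝔽 𝕂
  open IsSexticCharacter χ-sextic
  open SexticSums 𝔽 𝕂 m q≡ χ χ̄ χ-sextic
  open SexticEvaluation 𝔽 𝕂 m q≡ χ χ̄ χ-sextic
  open LegendreSum 𝔽 𝕂 m q≡ χ χ̄ χ-sextic
  open SetoidReasoning setoid

  normalise : ∀ {y n q q⁻¹ k s t} → φ n ≈ t → F.- y F.≈ n → q * q⁻¹ ≈ 1# →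
    k * φ y * s ≈ q * k * t * (1# * (χ̄ (F.- F.1#) * q⁻¹) * s)
  normalise {y} {n} {q} {q⁻¹} {k} {s} {t} φn≈t n≈ qq⁻¹≈1 = sym (begin
    q * k * t * (1# * (u * q⁻¹) * s)                    ≈⟨ *-congʳ (*-congˡ (trans (sym φn≈t) (trans (φ-cong (F.sym n≈)) φ[-y]))) ⟩
    q * k * (e * r) * (1# * (u * q⁻¹) * s)
      ≈⟨ solve 7 (λ q q⁻¹ k e r u s → q :* k :* (e :* r) :* (con (+ 1) :* (u :* q⁻¹) :* s)
           := (q :* q⁻¹) :* (e :* u) :* (k :* r :* s)) refl q q⁻¹ k e r u s ⟩
    (q * q⁻¹) * (e * u) * (k * r * s)                   ≈⟨ *-congʳ (*-cong qq⁻¹≈1 φ[-1]*χ̄[-1]≈1) ⟩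
    1# * 1# * (k * r * s)                               ≈⟨ trans (*-congʳ (*-identityˡ 1#)) (*-identityˡ _) ⟩
    k * r * s                                           ∎)
    where
    e r u : Carrier
    e = φ (F.- F.1#)
    r = φ y
    u = χ̄ (F.- F.1#)

    φ[-y] : φ (F.- y) ≈ e * r
    φ[-y] = trans (φ-cong (F.solve 1 (λ y → F.:- y F.:= (F.:- F.con (+ 1)) F.:* y) F.refl y)) (φ-* (F.- F.1#) y)

  module _ {a b c h P Q R f g x : F.Carrier}
           (a#0 : a F.# F.0#) (b#0 : b F.# F.0#) (c#0 : c F.# F.0#) (h#0 : h F.# F.0#) (f#0 : f F.# F.0#)
           (a≉b : ¬ a F.≈ b) (b≉c : ¬ b F.≈ c) (c≉a : ¬ c F.≈ a)
           (P*bc : P F.* (b F.* c) F.≈ a F.* b F.+ b F.* c F.+ c F.* a)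
           (Q*bc : Q F.* (b F.* c) F.≈ a F.* b F.+ c F.* a F.+ a F.^ 2)
           (R*bc : R F.* (b F.* c) F.≈ a F.^ 2)
           (critical : F.nat 3 F.* h F.^ 2 F.+ F.nat 2 F.* P F.* h F.+ Q F.≈ F.0#)
           (f≈ : f F.≈ F.nat 3 F.* h F.+ P)
           (g≈ : g F.≈ h F.^ 3 F.+ P F.* h F.^ 2 F.+ Q F.* h F.+ R)
           (x*4f³ : x F.* (F.nat 4 F.* f F.^ 3) F.≈ F.- (F.nat 27 F.* g)) where

    -- Both g and 27 are units. The conclusion is needed for ε(x) = 1 in ₂F₁ and for completing the
    -- square in `Σfibre`.
    x#0 : x F.# F.0#
    x#0 = F.xy#0⇒x#0 (F.≈-resp-#0 (F.sym (F.trans x*4f³ (F.solve 1 (λ g → F.:- (F.con (+ 27) F.:* g) F.:= (F.:- (F.con (+ 3) F.:* F.con (+ 3) F.:* F.con (+ 3))) F.:* g) F.refl g)))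
      (F.x#0y#0→xy#0 -27#0 (F.g#0 P*bc Q*bc R*bc critical f≈ g≈ a≉b b≉c c≉a b#0 c#0 h#0)))
      where
      -27#0 : F.- (F.nat 3 F.* F.nat 3 F.* F.nat 3) F.# F.0#
      -27#0 = F.≈-resp-#0 (F.solve 0 ((F.:- F.con (+ 1)) F.:* (F.con (+ 3) F.:* F.con (+ 3) F.:* F.con (+ 3)) F.:= F.:- (F.con (+ 3) F.:* F.con (+ 3) F.:* F.con (+ 3))) F.refl)
        (F.x#0y#0→xy#0 (F.invertible⇒#0 (F.- F.1#) (F.solve 0 ((F.:- F.con (+ 1)) F.:* (F.:- F.con (+ 1)) F.:= F.con (+ 1)) F.refl))
          (F.x#0y#0→xy#0 (F.x#0y#0→xy#0 F.3#0 F.3#0) F.3#0))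

    φ₁₁₁-evaluation : φ₁₁₁ a b c ≈ - 1# + φ (b F.* c) * φ (F.nat 3 F.* f) *
                      Σ𝔽 (λ y → χ̄ y * χ (F.1# F.- y) * χ̄ (F.1# F.- x F.* y))
    φ₁₁₁-evaluation = begin
      φ₁₁₁ a b c
        ≈⟨ φ₁₁₁-values a b c ⟩
      Σ𝔽 (λ x → χ x ^ 3 * χ (x F.+ a) ^ 3 * χ (x F.+ b) ^ 3 * χ (x F.+ c) ^ 3)
        ≈⟨ Σ-cong (λ x → χ³-product x (x F.+ a) (x F.+ b) (x F.+ c)) ⟩
      Σ𝔽 (λ x → φ (quartic a b c x))
        ≈⟨ Σφ-quartic b c a#0 ⟩
      - 1# + Σ𝔽 (λ z → φ (F.Π₃ a b c z))
        ≈⟨ +-congˡ (Σφ-affine Π₃-cong (F.slope#0 P*bc Q*bc R*bc critical f≈ g≈ f#0 x*4f³)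
             (F.x#0y#0→xy#0 (F.slope#0 P*bc Q*bc R*bc critical f≈ g≈ f#0 x*4f³) (F.inv#0 F.3#0)) (F.Π₃≈D₃ P*bc Q*bc R*bc critical f≈ g≈ f#0 x*4f³)) ⟩
      - 1# + φ (b F.* c) * Σ𝔽 (λ v → φ (F.nat 3 F.* f F.* (F.D₃ v F.+ shift)))
        ≈⟨ +-congˡ (*-congˡ (Σ-cong (λ v → φ-* (F.nat 3 F.* f) (F.D₃ v F.+ shift)))) ⟩
      - 1# + φ (b F.* c) * Σ𝔽 (λ v → φ (F.nat 3 F.* f) * φ (F.D₃ v F.+ shift))
        ≈⟨ +-congˡ (*-congˡ (Σ-*ˡ (φ (F.nat 3 F.* f)) (λ v → φ (F.D₃ v F.+ shift)))) ⟨
      - 1# + φ (b F.* c) * (φ (F.nat 3 F.* f) * Σ𝔽 (λ v → φ (F.D₃ v F.+ shift)))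
        ≈⟨ +-congˡ (*-assoc _ _ _) ⟨
      - 1# + φ (b F.* c) * φ (F.nat 3 F.* f) * Σ𝔽 (λ v → φ (F.D₃ v F.+ shift))
        ≈⟨ +-congˡ (*-congˡ (Σφ[D₃+c]≈Σsummand x#0 (F.solve 1 (λ x → (F.con (+ 2) F.:- F.con (+ 4) F.:* x) F.:+ F.con (+ 4) F.:* x F.:= F.con (+ 2)) F.refl x))) ⟩
      - 1# + φ (b F.* c) * φ (F.nat 3 F.* f) * Σ𝔽 (λ y → χ̄ y * χ (F.1# F.- y) * χ̄ (F.1# F.- x F.* y)) ∎
      where
      shift : F.Carrier
      shift = F.nat 2 F.- F.nat 4 F.* x

      Π₃-cong : ∀ {y z} → y F.≈ z → F.Π₃ a b c y F.≈ F.Π₃ a b c z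
      Π₃-cong e = F.*-cong (F.+-congˡ e) (F.*-cong (F.+-congˡ (F.*-congˡ e)) (F.+-congˡ (F.*-congˡ e)))

  -- Character values, quotients and the value `H` of ₂F₁ enter as variables, each tied by equations
  -- to the expression used in the computation. A premise of the form `w # 0# → P * w ≈ p` says that
  -- `P` is the quotient of `p` by `w`.
  φ₁₁₁≈₂F₁ : ∀ {a b c h P Q R f g x u v y n q q⁻¹ k t H w₁ w₂ w₃ p₁ p₂ p₃} →
    a F.# F.0# → b F.# F.0# → c F.# F.0# → h F.# F.0# → f F.# F.0# →
    ¬ a F.≈ b → ¬ b F.≈ c → ¬ c F.≈ a →
    ((φ y ≈ k × y F.≈ b F.* c) × (φ n ≈ t × n F.≈ F.- (F.nat 3 F.* f)) ×
     q * q⁻¹ ≈ 1# ×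
     (x F.# F.0# → H ≈ 1# * (χ̄ (F.- F.1#) * q⁻¹) * Σ𝔽 (λ y → χ̄ y * χ (F.1# F.- y) * χ̄ (F.1# F.- x F.* y))) ×
     ((v F.# F.0# → x F.* v F.≈ u) × v F.≈ F.nat 4 F.* f F.^ 3 × u F.≈ F.- (F.nat 27 F.* g)) ×
     F.nat 3 F.* h F.^ 2 F.+ F.nat 2 F.* P F.* h F.+ Q F.≈ F.0# ×
     f F.≈ F.nat 3 F.* h F.+ P ×
     g F.≈ h F.^ 3 F.+ P F.* h F.^ 2 F.+ Q F.* h F.+ R ×
     ((w₁ F.# F.0# → P F.* w₁ F.≈ p₁) × w₁ F.≈ b F.* c × p₁ F.≈ a F.* b F.+ b F.* c F.+ c F.* a) ×
     ((w₂ F.# F.0# → Q F.* w₂ F.≈ p₂) × w₂ F.≈ b F.* c × p₂ F.≈ a F.* b F.+ c F.* a F.+ a F.^ 2) ×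
     ((w₃ F.# F.0# → R F.* w₃ F.≈ p₃) × w₃ F.≈ b F.* c × p₃ F.≈ a F.^ 2)) →
    φ₁₁₁ a b c ≈ - 1# + q * k * t * H
  φ₁₁₁≈₂F₁ {a} {b} {c} {f = f} {g} {x} {u} {v} {q = q} {q⁻¹} {k} {t} {H} a#0 b#0 c#0 h#0 f#0 a≉b b≉c c≉a
    ((φy≈k , y≈bc) , (φn≈t , n≈) , qq⁻¹≈1 , H≈ , (x*v≈u , v≈ , u≈) , critical , f≈ , g≈ ,
     (P*w₁ , w₁≈ , p₁≈) , (Q*w₂ , w₂≈ , p₂≈) , (R*w₃ , w₃≈ , p₃≈)) = begin
      φ₁₁₁ a b c
        ≈⟨ φ₁₁₁-evaluation a#0 b#0 c#0 h#0 f#0 a≉b b≉c c≉a (clear P*w₁ w₁≈ p₁≈) (clear Q*w₂ w₂≈ p₂≈) (clear R*w₃ w₃≈ p₃≈) critical f≈ g≈ x*4f³ ⟩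
      - 1# + φ (b F.* c) * φ (F.nat 3 F.* f) * S
        ≈⟨ +-congˡ (*-congʳ (*-congʳ (trans (φ-cong (F.sym y≈bc)) φy≈k))) ⟩
      - 1# + k * φ (F.nat 3 F.* f) * S
        ≈⟨ +-congˡ (normalise φn≈t (F.sym n≈) qq⁻¹≈1) ⟩
      - 1# + q * k * t * (1# * (χ̄ (F.- F.1#) * q⁻¹) * S)
        ≈⟨ +-congˡ (*-congˡ (H≈ (x#0 a#0 b#0 c#0 h#0 f#0 a≉b b≉c c≉a (clear P*w₁ w₁≈ p₁≈) (clear Q*w₂ w₂≈ p₂≈) (clear R*w₃ w₃≈ p₃≈) critical f≈ g≈ x*4f³))) ⟨
      - 1# + q * k * t * H ∎
    where
    clear : ∀ {P w p s} → (w F.# F.0# → P F.* w F.≈ p) → w F.≈ b F.* c → p F.≈ s → P F.* (b F.* c) F.≈ s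
    clear P*w≈p w≈bc p≈s = F.trans (F.*-congˡ (F.sym w≈bc))
      (F.trans (P*w≈p (F.≈-resp-#0 (F.sym w≈bc) (F.x#0y#0→xy#0 b#0 c#0))) p≈s)

    S : Carrier
    S = Σ𝔽 (λ y → χ̄ y * χ (F.1# F.- y) * χ̄ (F.1# F.- x F.* y))

    4f³#0 : F.nat 4 F.* f F.^ 3 F.# F.0#
    4f³#0 = F.≈-resp-#0 (F.solve 1 (λ y → (F.con (+ 2) F.:* F.con (+ 2)) F.:* y F.:= F.con (+ 4) F.:* y) F.refl (f F.^ 3))
      (F.x#0y#0→xy#0 (F.x#0y#0→xy#0 F.2#0 F.2#0) (F.^-#0 3 f#0))

    x*4f³ : x F.* (F.nat 4 F.* f F.^ 3) F.≈ F.- (F.nat 27 F.* g)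
    x*4f³ = F.trans (F.*-congˡ (F.sym v≈)) (F.trans (x*v≈u (F.≈-resp-#0 (F.sym v≈) 4f³#0)) u≈)

-- Assembly of the theorem

module Setup {k ℓ₁ ℓ₂ k′ ℓ₁′ ℓ₂′} (𝕂 : AlgClosedField₀ k′ ℓ₁′ ℓ₂′) (q : ℕ) (𝔽 : FiniteField q k ℓ₁ ℓ₂)
  (q%6≡1 : q % 6 ≡ 1) (T : Characters.Character 𝔽 𝕂) (T-generates : Characters.IsGenerator 𝔽 𝕂 T) where
  m : ℕ
  m = q ℕ./ 6

  q≡ : q ≡ suc (m ℕ.* 6)
  q≡ = ≡.trans (ℕ.m≡m%n+[m/n]*n q 6) (≡.cong (ℕ._+ m ℕ.* 6) q%6≡1)

  module F where
    open FiniteField 𝔽 public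
    open FiniteFieldProperties 𝔽 public
    open CubicModel 𝔽 m q≡ public using (critical-×ⁿ)
  module K where
    open FieldOps (AlgClosedField₀.heytingField 𝕂) public
    open FieldProperties (AlgClosedField₀.heytingField 𝕂) public
  open Characters 𝔽 𝕂
  open CharacterValues 𝔽 𝕂
  open SumProperties K.+-commutativeMonoid public using (sum-cong-≋)
  open GroupHomomorphism public using (⟦_⟧)

  q∸1≡ : q ∸ 1 ≡ m ℕ.* 6
  q∸1≡ = ≡.cong (_∸ 1) q≡

  exponent₁ : (q ∸ 1) ℕ./ 6 ≡ m
  exponent₁ = ≡.trans (≡.cong (ℕ._/ 6) q∸1≡) (ℕ.m*n/n≡m m 6)

  exponent₂ : (5 ℕ.* (q ∸ 1)) ℕ./ 6 ≡ 5 ℕ.* m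
  exponent₂ = ≡.trans (≡.cong (λ n → (5 ℕ.* n) ℕ./ 6) q∸1≡)
    (≡.trans (≡.cong (ℕ._/ 6) (≡.sym (ℕ.*-assoc 5 m 6))) (ℕ.m*n/n≡m (5 ℕ.* m) 6))

  sextic : IsSexticCharacter 𝔽 𝕂 ((T ^ᶻ (+ ((q ∸ 1) ℕ./ 6))) ⟪_⟫) ((T ^ᶻ (+ ((5 ℕ.* (q ∸ 1)) ℕ./ 6))) ⟪_⟫)
  sextic = ≡.subst₂ (λ n₁ n₂ → IsSexticCharacter 𝔽 𝕂 ((T ^ᶻ (+ n₁)) ⟪_⟫) ((T ^ᶻ (+ n₂)) ⟪_⟫))
    (≡.sym exponent₁) (≡.sym exponent₂) (SexticCharacters.isSexticCharacter 𝔽 𝕂 m q≡ T T-generates)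

  open HypergeometricValue 𝔽 𝕂 public

  module L = LegendreEvaluation 𝔽 𝕂 m q≡ ((T ^ᶻ (+ ((q ∸ 1) ℕ./ 6))) ⟪_⟫) ((T ^ᶻ (+ ((5 ℕ.* (q ∸ 1)) ℕ./ 6))) ⟪_⟫) sextic

  A B : Character
  A = T ^ᶻ (+ ((q ∸ 1) ℕ./ 6))
  B = T ^ᶻ (+ ((5 ℕ.* (q ∸ 1)) ℕ./ 6))

  AB≈1 : ∀ {y} → y F.# F.0# → A ⟪ y ⟫ K.* B ⟪ y ⟫ K.≈ K.1#
  AB≈1 = IsSexticCharacter.χ*χ̄≈1 sextic

  BA≈1 : ∀ {y} → y F.# F.0# → B ⟪ y ⟫ K.* A ⟪ y ⟫ K.≈ K.1#
  BA≈1 y#0 = K.trans (K.*-comm _ _) (AB≈1 y#0)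

-- The goal and the hypotheses reach `proof` and `matching` through inferred types.  In this form
-- they match the arguments of φ and ₂F₁ syntactically; otherwise type checking would compare the
-- decision procedures on which φ, _/_ and _⟨_⟩ are stuck.
proof : ∀ {k ℓ₁ ℓ₂ k′ ℓ₁′ ℓ₂′} (𝕂 : AlgClosedField₀ k′ ℓ₁′ ℓ₂′) (q : ℕ) (𝔽 : FiniteField q k ℓ₁ ℓ₂) →
  let open FiniteField 𝔽 in
  q % 6 ≡ 1 → (T : Characters.Character 𝔽 𝕂) → Characters.IsGenerator 𝔽 𝕂 T →
  (a b c : Carrier) → a # 0# → b # 0# → c # 0# → a # b → b # c → c # a →
  (h : Carrier) → h # 0# → (critical : _) → (f#0 : _) → _

matching : ∀ {k ℓ₁ ℓ₂ k′ ℓ₁′ ℓ₂′} (𝕂 : AlgClosedField₀ k′ ℓ₁′ ℓ₂′) (q : ℕ) (𝔽 : FiniteField q k ℓ₁ ℓ₂) →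
  let open FiniteField 𝔽 in
  q % 6 ≡ 1 → (T : Characters.Character 𝔽 𝕂) → Characters.IsGenerator 𝔽 𝕂 T →
  (a b c : Carrier) → a # 0# → b # 0# → c # 0# → a # b → b # c → c # a →
  (h : Carrier) → h # 0# → (critical : _) → (f#0 : _) → _

theorem1p4 :
  ∀ {k ℓ₁ ℓ₂ k′ ℓ₁′ ℓ₂′} (𝕂 : AlgClosedField₀ k′ ℓ₁′ ℓ₂′)
    (q : ℕ) (𝔽 : FiniteField q k ℓ₁ ℓ₂) →
  let open FiniteField 𝔽
      open Characters 𝔽 𝕂
      module K = FieldOps (AlgClosedField₀.heytingField 𝕂)
  in
  OddCharacteristic →
  q % 6 ≡ 1 →
  (T : Character) → IsGenerator T →
  (a b c : Carrier) → a # 0# → b # 0# → c # 0# → a # b → b # c → c # a →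
  (h : Carrier) → h # 0# →
  3 ×ⁿ (h ^ 2) + 2 ×ⁿ ((a * b + b * c + c * a) / (b * c)) * h
    + (a * b + c * a + a ^ 2) / (b * c) ≈ 0# →
  let f = 3 ×ⁿ h + (a * b + b * c + c * a) / (b * c)
      g = h ^ 3 + (a * b + b * c + c * a) / (b * c) * h ^ 2
            + (a * b + c * a + a ^ 2) / (b * c) * h + a ^ 2 / (b * c)
  in
  -- the argument of ₂F₁ below has f in its denominator
  f # 0# →
  φ₁₁₁ a b c K.≈
    K.- K.1# K.+
      qᴷ K.* φ (b * c) K.* φ (- (3 ×ⁿ f))
        K.* ₂F₁ (T ^ᶻ (+ ((q ∸ 1) ℕ./ 6))) (T ^ᶻ (+ ((5 ℕ.* (q ∸ 1)) ℕ./ 6))) εᶜ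
              ((- ((3 ℕ.^ 3) ×ⁿ g)) / ((2 ℕ.^ 2) ×ⁿ (f ^ 3)))
theorem1p4 𝕂 q 𝔽 _ q%6≡1 T T-generates a b c a#0 b#0 c#0 a#b b#c c#a h h#0 h-critical f#0 =
  proof 𝕂 q 𝔽 q%6≡1 T T-generates a b c a#0 b#0 c#0 a#b b#c c#a h h#0 h-critical f#0

proof 𝕂 q 𝔽 q%6≡1 T T-generates a b c a#0 b#0 c#0 a#b b#c c#a h h#0 h-critical f#0 =
  L.φ₁₁₁≈₂F₁ a#0 b#0 c#0 h#0 f#0 (F.#⇒≉ a#b) (F.#⇒≉ b#c) (F.#⇒≉ c#a)
    (matching 𝕂 q 𝔽 q%6≡1 T T-generates a b c a#0 b#0 c#0 a#b b#c c#a h h#0 h-critical f#0)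
  where open Setup 𝕂 q 𝔽 q%6≡1 T T-generates

matching 𝕂 q 𝔽 q%6≡1 T T-generates a b c a#0 b#0 c#0 a#b b#c c#a h h#0 h-critical f#0 =
  (K.refl , F.refl) , (K.refl , F.-‿cong (F.×ⁿ≈nat* 3 _)) ,
  K.recip-inverseʳ (AlgClosedField₀.charZero 𝕂 q {{F.q-nonZero}}) ,
  -- With C trivial, B C has the values of B; the inverse of B times C has those of A, and the
  -- inverse of A has those of B, because A and B are inverse to each other. The factor ε(x) is 1
  -- since x is a unit.
  (λ x#0 → K.*-cong
    (K.*-cong (⟨⟩-value-1 _ (λ _ → K.refl) x#0)
              (K.*-congʳ (⟨⟩-value _ B (λ u → K.*-identityʳ (proj₁ (⟦ B ⟧ u))) _)))
    (sum-cong-≋ {q} (λ i → K.*-cong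
      (K.*-cong (⟨⟩≈⟪⟫ B _)
                (⟨⟩-value _ A (λ u → K.trans (K.*-identityʳ (K.recip (proj₂ (⟦ B ⟧ u)))) (recip-value B A BA≈1 u)) _))
      (⟨⟩-value _ B (λ u → recip-value A B AB≈1 u) _)))) ,
  (F./-*-cancel _ , F.×ⁿ≈nat* 4 _ , F.-‿cong (F.×ⁿ≈nat* 27 _)) ,
  F.critical-×ⁿ h-critical , F.+-congʳ (F.×ⁿ≈nat* 3 h) , F.refl ,
  (F./-*-cancel _ , F.refl , F.refl) , (F./-*-cancel _ , F.refl , F.refl) , (F./-*-cancel _ , F.refl , F.refl)
  where open Setup 𝕂 q 𝔽 q%6≡1 T T-generates
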